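{- $\mathsf{\Sigma QSO(\Sigma_2\text{ - }2SAT)}\subseteq\mathsf{TotP}$.
   Context: $\mathsf{TotP}=\{tot_M \mid M \text{ a nondeterministic polynomial-time Turing machine}\}$, where $tot_M(x)$ is the number of all computation paths of $M$ on input $x$ minus $1$. Counting functions on finite ordered structures are viewed as functions on their standard string encodings. $\mathsf{\Sigma QSO(\Sigma_2\text{ - }2SAT)}$: first-order formulae over a relational vocabulary $\sigma$ are built by $\phi ::= x=y \mid R(\vec x) \mid \neg\phi \mid \phi\vee\phi \mid \exists x\phi \mid \top \mid \bot$ with $R\in\sigma$. A literal is $X(\vec x)$ or $\neg X(\vec x)$ with $X$ a second-order variable. A 2SAT clause over $\sigma$ is $\phi_1\vee\phi_2\vee\phi_3$ where each $\phi_i$ is a literal or a first-order formula over $\sigma$, at least one $\phi_i$ being a first-order formula. A $\Sigma_2$-2SAT formula is $\exists\vec x\forall\vec y\bigwedge_{j=1}^k C_j(\vec x,\vec y)$ with each $C_j$ a 2SAT clause. $\mathsf{\Sigma QSO(\Sigma_2\text{ - }2SAT)}$ formulae: $\alpha ::= \phi \mid s \mid (\alpha+\alpha)\mid \Sigma x.\alpha \mid \Sigma X.\alpha$, with $\phi$ a $\Sigma_2$-2SAT formula, $s\in\mathbb{N}$. Semantics: $[[\phi]]=1$ if the structure (with the current assignments) satisfies $\phi$, else $0$; $[[s]]=s$; $+$ is addition; $[[\Sigma x.\alpha]](\mathcal{A},v,V)=\sum_{a\in A}[[\alpha]](\mathcal{A},v[a/x],V)$; $[[\Sigma X.\alpha]](\mathcal{A},v,V)=\sum_{B\subseteq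 A^{\mathrm{arity}(X)}}[[\alpha]](\mathcal{A},v,V[B/X])$. A sentence $\alpha$ defines the counting function $\mathcal{A}\mapsto[[\alpha]](\mathcal{A})$; the class consists of all such functions. -}

module Defs where

open import Data.Nat using (ℕ; zero; suc; _+_; _*_; _∸_; _^_; _≤ᵇ_)
open import Data.Bool using (Bool; true; false; if_then_else_; not; _∧_; _∨_; T)
open import Data.Fin using (Fin; zero; suc; toℕ)
import Data.Fin.Properties as FinP
open import Data.List using (List; []; _∷_; _++_; map; concatMap; allFin; filter; length; replicate; cartesianProduct)
open import Data.Vec using (Vec; []; _∷_; lookup) renaming (_++_ to _++ᵛ_)
import Data.Vec.Properties as VecP
import Data.Vec
open import Data.Product using (Σ; _×_; _,_; proj₁; proj₂)
open import Data.Bool.ListAction using (any; all)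
open import Data.Nat.ListAction using (sum)
open import Data.Unit using (⊤)
open import Data.Sum using (_⊎_)
open import Data.Empty using (⊥)
open import Relation.Binary.PropositionalEquality using (_≡_)
open import Relation.Nullary using (does)

-- A vocabulary τ lists the arities of its relation symbols.  The
-- vocabulary σ used by formulae is τ together with a distinguished
-- binary symbol (index zero) interpreted as the linear order of the
-- (ordered) structure.
Vocab : Set
Vocab = List ℕ

arityτ : (τ : Vocab) → Fin (length τ) → ℕ
arityτ (a ∷ τ) zero    = a
arityτ (a ∷ τ) (suc i) = arityτ τ i

-- relation symbols of σ = {≤} ∪ τ
RelSym : Vocab → Set
RelSym τ = Fin (suc (length τ))

arity : (τ : Vocab) → RelSym τ → ℕ
arity τ zero    = 2
arity τ (suc i) = arityτ τ i

-- A finite ordered τ-structure: universe {0,…,n-1} = Fin n with its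
-- natural order, and an interpretation of every symbol of τ.
record Structure (τ : Vocab) : Set where
  field
    size : ℕ
    rel  : (i : Fin (length τ)) → Vec (Fin size) (arityτ τ i) → Bool
open Structure public

interp : ∀ {τ} (𝒜 : Structure τ) (R : RelSym τ) → Vec (Fin (size 𝒜)) (arity τ R) → Bool
interp 𝒜 zero    (a ∷ b ∷ []) = toℕ a ≤ᵇ toℕ b
interp 𝒜 (suc i) xs           = rel 𝒜 i xs

allTuples : (n k : ℕ) → List (Vec (Fin n) k)
allTuples n zero    = [] ∷ []
allTuples n (suc k) = concatMap (λ i → map (i ∷_) (allTuples n k)) (allFin n)

-- Standard string encoding of a structure (over {0,1} = Bool):
-- 1^n 0 followed by the characteristic strings of the relations of τ,
-- each listing the tuples of A^arity in lexicographic order.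

encRels : ∀ (τ : Vocab) (n : ℕ) → ((i : Fin (length τ)) → Vec (Fin n) (arityτ τ i) → Bool) → List Bool
encRels []      n r = []
encRels (a ∷ τ) n r = map (r zero) (allTuples n a) ++ encRels τ n (λ i → r (suc i))

encode : ∀ {τ} → Structure τ → List Bool
encode {τ} 𝒜 = replicate (size 𝒜) true ++ (false ∷ encRels τ (size 𝒜) (rel 𝒜))

data Move : Set where
  left right stay : Move

allMoves : List Move
allMoves = left ∷ right ∷ stay ∷ []

-- tape alphabet Fin (3 + k): 0 = blank, 1 = input bit 0, 2 = input bit 1
record NTM : Set where
  field
    nstates : ℕ                -- states are Fin (suc nstates), start state zero
    extra   : ℕ
    δ : Fin (suc nstates) → Fin (3 + extra) → (Fin (suc nstates) × Fin (3 + extra) × Move) → Bool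
open NTM public

State : NTM → Set
State M = Fin (suc (nstates M))

Sym : NTM → Set
Sym M = Fin (3 + extra M)

blank : ∀ {M} → Sym M
blank = zero

inputSym : ∀ {M} → Bool → Sym M
inputSym false = suc zero
inputSym true  = suc (suc zero)

record Config (M : NTM) : Set where
  constructor conf
  field
    st    : State M
    lft   : List (Sym M)   -- cells left of the head, nearest first
    hd    : Sym M
    rgt   : List (Sym M)   -- cells right of the head, nearest first

initConfig : (M : NTM) → List Bool → Config M
initConfig M []      = conf zero [] (blank {M}) []
initConfig M (b ∷ x) = conf zero [] (inputSym {M} b) (map (inputSym {M}) x)

apply : ∀ {M : NTM} → Config M → State M × Sym M × Move → Config M
apply {M} (conf q l h r) (q' , s , left) with l
... | []     = conf q' [] s r                 -- at the left end: stay
... | c ∷ l' = conf q' l' c (s ∷ r)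
apply {M} (conf q l h r) (q' , s , right) with r
... | []     = conf q' (s ∷ l) (blank {M}) []
... | c ∷ r' = conf q' (s ∷ l) c r'
apply {M} (conf q l h r) (q' , s , stay) = conf q' l s r

allTransitions : (M : NTM) → List (State M × Sym M × Move)
allTransitions M = cartesianProduct (allFin (suc (nstates M)))
                     (cartesianProduct (allFin (3 + extra M)) allMoves)

successors : ∀ {M} → Config M → List (Config M)
successors {M} c =
  map (apply c) (filter (λ t → T? (δ M (Config.st c) (Config.hd c) t)) (allTransitions M))
  where
    open import Relation.Nullary using (Dec; yes; no)
    T? : (b : Bool) → Dec (T b)
    T? true  = yes _
    T? false = no (λ ())

HaltsWithin : ∀ {M} → ℕ → Config M → Set
HaltsWithinAll : ∀ {M} → ℕ → List (Config M) → Set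
HaltsWithin t c with successors c
... | []     = ⊤
... | s ∷ ss with t
...   | zero  = ⊥
...   | suc t' = HaltsWithinAll t' (s ∷ ss)
HaltsWithinAll t []       = ⊤
HaltsWithinAll t (c ∷ cs) = HaltsWithin t c × HaltsWithinAll t cs

paths : ∀ {M} → ℕ → Config M → ℕ
pathsAll : ∀ {M} → ℕ → List (Config M) → ℕ
paths t c with successors c
... | []     = 1
... | s ∷ ss with t
...   | zero  = 0
...   | suc t' = pathsAll t' (s ∷ ss)
pathsAll t []       = 0
pathsAll t (c ∷ cs) = paths t c + pathsAll t cs

polyBound : ℕ → ℕ → ℕ → ℕ
polyBound c d m = c * m ^ d + c

RunsInTime : NTM → ℕ → ℕ → Set
RunsInTime M c d = ∀ (x : List Bool) → HaltsWithin (polyBound c d (length x)) (initConfig M x)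

tot : (M : NTM) (c d : ℕ) → List Bool → ℕ
tot M c d x = paths (polyBound c d (length x)) (initConfig M x) ∸ 1

InTotP : (τ : Vocab) → (Structure τ → ℕ) → Set
InTotP τ f = Σ NTM λ M → Σ ℕ λ c → Σ ℕ λ d →
               RunsInTime M c d × (∀ (𝒜 : Structure τ) → tot M c d (encode 𝒜) ≡ f 𝒜)

-- Syntax of ΣQSO(Σ₂-2SAT)
-- first-order variables: de Bruijn indices Fin m (zero = innermost)
-- second-order variables: context Δ = list of arities

data FO (τ : Vocab) : ℕ → Set where
  eq  : ∀ {m} → Fin m → Fin m → FO τ m
  atom : ∀ {m} (R : RelSym τ) → Vec (Fin m) (arity τ R) → FO τ m
  neg : ∀ {m} → FO τ m → FO τ m
  or  : ∀ {m} → FO τ m → FO τ m → FO τ m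
  ex  : ∀ {m} → FO τ (suc m) → FO τ m
  tt  : ∀ {m} → FO τ m
  ff  : ∀ {m} → FO τ m

SOCtx : Set
SOCtx = List ℕ

soArity : (Δ : SOCtx) → Fin (length Δ) → ℕ
soArity (a ∷ Δ) zero    = a
soArity (a ∷ Δ) (suc j) = soArity Δ j

data Literal (m : ℕ) (Δ : SOCtx) : Set where
  pos : (X : Fin (length Δ)) → Vec (Fin m) (soArity Δ X) → Literal m Δ
  neg : (X : Fin (length Δ)) → Vec (Fin m) (soArity Δ X) → Literal m Δ

data Component (τ : Vocab) (m : ℕ) (Δ : SOCtx) : Set where
  lit : Literal m Δ → Component τ m Δ
  fo  : FO τ m → Component τ m Δ

IsFO : ∀ {τ m Δ} → Component τ m Δ → Set
IsFO (lit _) = ⊥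
IsFO (fo _)  = ⊤

-- 2SAT clause φ₁ ∨ φ₂ ∨ φ₃ with at least one φᵢ first-order
record Clause (τ : Vocab) (m : ℕ) (Δ : SOCtx) : Set where
  field
    φ₁ φ₂ φ₃ : Component τ m Δ
    someFO   : IsFO φ₁ ⊎ (IsFO φ₂ ⊎ IsFO φ₃)

-- ∃x̄ ∀ȳ ⋀ⱼ Cⱼ(x̄,ȳ) in context (m, Δ); |x̄| = a, |ȳ| = b; the clauses live
-- in context b + (a + m): ȳ innermost, then x̄, then the outer variables.
record Σ₂2SAT (τ : Vocab) (m : ℕ) (Δ : SOCtx) : Set where
  field
    a b     : ℕ
    clauses : List (Clause τ (b + (a + m)) Δ)

data ΣQSO (τ : Vocab) : ℕ → SOCtx → Set where
  formula : ∀ {m Δ} → Σ₂2SAT τ m Δ → ΣQSO τ m Δ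
  const   : ∀ {m Δ} → ℕ → ΣQSO τ m Δ
  plus    : ∀ {m Δ} → ΣQSO τ m Δ → ΣQSO τ m Δ → ΣQSO τ m Δ
  sumFO   : ∀ {m Δ} → ΣQSO τ (suc m) Δ → ΣQSO τ m Δ
  sumSO   : ∀ {m Δ} (k : ℕ) → ΣQSO τ m (k ∷ Δ) → ΣQSO τ m Δ

Sentence : Vocab → Set
Sentence τ = ΣQSO τ 0 []

SOEnv : ℕ → SOCtx → Set
SOEnv n Δ = (X : Fin (length Δ)) → Vec (Fin n) (soArity Δ X) → Bool

extendSO : ∀ {n k Δ} → (Vec (Fin n) k → Bool) → SOEnv n Δ → SOEnv n (k ∷ Δ)
extendSO B V zero    = B
extendSO B V (suc X) = V X

lookups : ∀ {n m k} → Vec (Fin n) m → Vec (Fin m) k → Vec (Fin n) k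
lookups ρ xs = Data.Vec.map (lookup ρ) xs

module _ {τ : Vocab} (𝒜 : Structure τ) where

  private
    n = size 𝒜

  satFO : ∀ {m} → FO τ m → Vec (Fin n) m → Bool
  satFO (eq x y)    ρ = does (lookup ρ x FinP.≟ lookup ρ y)
  satFO (atom R xs) ρ = interp 𝒜 R (lookups ρ xs)
  satFO (neg φ)     ρ = not (satFO φ ρ)
  satFO (or φ ψ)    ρ = satFO φ ρ ∨ satFO ψ ρ
  satFO (ex φ)      ρ = any (λ a → satFO φ (a ∷ ρ)) (allFin n)
  satFO tt          ρ = true
  satFO ff          ρ = false

  satLit : ∀ {m Δ} → Literal m Δ → Vec (Fin n) m → SOEnv n Δ → Bool
  satLit (pos X xs) ρ V = V X (lookups ρ xs)
  satLit (neg X xs) ρ V = not (V X (lookups ρ xs))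

  satComp : ∀ {m Δ} → Component τ m Δ → Vec (Fin n) m → SOEnv n Δ → Bool
  satComp (lit l) ρ V = satLit l ρ V
  satComp (fo φ)  ρ V = satFO φ ρ

  satClause : ∀ {m Δ} → Clause τ m Δ → Vec (Fin n) m → SOEnv n Δ → Bool
  satClause C ρ V = satComp (Clause.φ₁ C) ρ V ∨ (satComp (Clause.φ₂ C) ρ V ∨ satComp (Clause.φ₃ C) ρ V)

  satΣ₂ : ∀ {m Δ} → Σ₂2SAT τ m Δ → Vec (Fin n) m → SOEnv n Δ → Bool
  satΣ₂ φ ρ V =
    any (λ xs → all (λ ys → all (λ C → satClause C (ys ++ᵛ (xs ++ᵛ ρ)) V) (Σ₂2SAT.clauses φ))
                    (allTuples n (Σ₂2SAT.b φ)))
        (allTuples n (Σ₂2SAT.a φ))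

  -- sum of g over all subsets B ⊆ A^k, the tuples of A^k being listed by ts
  -- (each subset is visited exactly once when ts lists A^k without repetition)
  sumSubsets : ∀ {k} → List (Vec (Fin n) k) → ((Vec (Fin n) k → Bool) → ℕ) → ℕ
  sumSubsets []       g = g (λ _ → false)
  sumSubsets {k} (t ∷ ts) g =
    sumSubsets ts (λ B → g (set B false)) + sumSubsets ts (λ B → g (set B true))
    where
      set : (Vec (Fin n) k → Bool) → Bool → Vec (Fin n) k → Bool
      set B v u = if does (VecP.≡-dec FinP._≟_ u t) then v else B u

  ⟦_⟧ : ∀ {m Δ} → ΣQSO τ m Δ → Vec (Fin n) m → SOEnv n Δ → ℕ
  ⟦ formula φ ⟧ ρ V = if satΣ₂ φ ρ V then 1 else 0
  ⟦ const s ⟧   ρ V = s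
  ⟦ plus α β ⟧  ρ V = ⟦ α ⟧ ρ V + ⟦ β ⟧ ρ V
  ⟦ sumFO α ⟧   ρ V = sum (map (λ a → ⟦ α ⟧ (a ∷ ρ) V) (allFin n))
  ⟦ sumSO k α ⟧ ρ V = sumSubsets (allTuples n k) (λ B → ⟦ α ⟧ ρ (extendSO B V))

  emptySO : SOEnv n []
  emptySO ()

⟦_⟧ˢ : ∀ {τ} → Sentence τ → Structure τ → ℕ
⟦ α ⟧ˢ 𝒜 = ⟦_⟧ 𝒜 α [] (emptySO 𝒜)

InΣQSOΣ₂2SAT : (τ : Vocab) → (Structure τ → ℕ) → Set
InΣQSOΣ₂2SAT τ f = Σ (Sentence τ) λ α → ∀ (𝒜 : Structure τ) → ⟦ α ⟧ˢ 𝒜 ≡ f 𝒜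

{-# OPTIONS --safe #-}

-- Pushing the sums outwards, a sentence is a sum of expressions Σ x̄ Σ X̄ φ with φ in Σ₂-2SAT. Given values of x̄ and a
-- partial assignment of X̄, it can be decided in polynomial time whether some extension satisfies φ: try all values of
-- the existential variables of φ and solve the resulting 2CNF formula by eliminating its propositional variables one by
-- one, which only produces 2-clauses. A machine that fixes the bits of X̄ one by one and branches only when both values
-- can be extended therefore has exactly one path per solution; for each x̄ with a solution it forks off this search and
-- continues, and the path that survives to the end is the additional one that tot subtracts.
--
-- The machine is compiled from programs with loops over the universe and an array of bits. A program variable is a pebble
-- on the unary part 1ⁿ of the input, and every elementary operation is one sweep of a finite transducer over the tape.
-- Such programs run in polynomial time by construction, and the number of paths is computed in continuation-passing style.

module Submission where

open import Defs
open import Data.Bool using (Bool; true; false; if_then_else_; not; _∧_; _∨_; T)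
open import Data.Bool.Properties using (∨-comm; ∨-idem; ∨-inverseˡ; ∨-inverseʳ)
open import Data.Empty using (⊥; ⊥-elim)
open import Data.Fin using (Fin; zero; suc; toℕ; join; splitAt; combine; remQuot)
import Data.Fin as Fin
import Data.Fin.Properties as FinP
open import Data.List using (List; []; _∷_; _++_; map; concatMap; allFin; filter; length; replicate; tabulate; cartesianProduct; _ʳ++_; reverse)
import Data.List.Properties as ListP
open import Data.Vec using (Vec; []; _∷_; lookup)
import Data.Vec as Vec
import Data.Vec.Properties as VecP
open import Data.List.Membership.Propositional using (_∈_)
import Data.List.Membership.Propositional.Properties as MemP
import Data.List.Membership.DecPropositional as DecMem
open import Data.List.Relation.Unary.All using (All; []; _∷_)
import Data.List.Relation.Unary.All as All
import Data.List.Relation.Unary.All.Properties as AllP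
open import Data.List.Relation.Unary.AllPairs using ([]; _∷_)
import Data.List.Relation.Unary.AllPairs as AllPairs
import Data.List.Relation.Unary.AllPairs.Properties as AllPairsP
open import Data.List.Relation.Unary.Any using (Any; here; there)
import Data.List.Relation.Unary.Any as Any
open import Data.Bool.ListAction using (any; all)
open import Data.List.Relation.Unary.Unique.Propositional using (Unique)
import Data.List.Relation.Unary.Unique.Propositional.Properties as UniqueP
open import Data.Maybe using (Maybe; just; nothing; fromMaybe)
import Data.Maybe
open import Data.Nat using (ℕ; zero; suc; _+_; _*_; _∸_; _^_; _≤_; _<_; z≤n; s≤s; _≤ᵇ_; _≟_)
open import Data.Nat.Properties hiding (_≟_)
open import Data.Nat.ListAction using (sum)
open import Data.Product using (Σ; ∃; _×_; _,_; proj₁; proj₂)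
import Data.Product.Properties as ΣP
open import Data.Sum using (_⊎_; inj₁; inj₂; [_,_])
open import Data.Sum.Properties using (inj₂-injective)
open import Data.Unit using (⊤; tt)
open import Function using (_∘_; id)
open import Relation.Binary.PropositionalEquality hiding ([_])
open import Relation.Nullary using (¬_; Dec; yes; no; does)
open import Relation.Nullary.Decidable using (isYes; toWitness; fromWitness)

-- Finite encodings

-- `tot` counts every path, so a path once opened cannot be rejected later: whether a partial
-- assignment has a solution must be known before branching on it. This can be known because a
-- clause keeps at most two literals once its first-order parts are evaluated, and fixing a variable
-- only adds a unit clause. The quantifier ∃x̄ inside a formula is tested, not summed, so it stays
-- inside the test.
--
-- The number of paths of A followed by B is not determined by the number of paths of A, since
-- different ends of A may leave different memories. Therefore the count of a program takes the
-- count of what follows as an argument, and a deterministic program is one that calls this argument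
-- exactly once.
--
-- The machine must halt in polynomial time on all strings, also on those that encode no structure.
-- Programs are therefore total: the leading 1s are the universe, the bits after the first 0 form a
-- queue, and reading from an empty queue gives `false`. The alphabet depends on the program alone,
-- because the height of a pebble stack is bounded by the nesting of loops.

record Code (A : Set) : Set where
  field
    card    : ℕ
    enc     : A → Fin card
    dec     : Fin card → A
    dec-enc : ∀ a → dec (enc a) ≡ a
open Code

retract : ∀ {A B} (f : A → B) (g : B → A) → (∀ a → g (f a) ≡ a) → Code B → Code A
retract f g gf c = record
  { card = card c ; enc = enc c ∘ f ; dec = g ∘ dec c
  ; dec-enc = λ a → trans (cong g (dec-enc c (f a))) (gf a) }

⊤-code : Code ⊤
⊤-code = record { card = 1 ; enc = λ _ → zero ; dec = λ _ → tt ; dec-enc = λ _ → refl }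

Fin-code : ∀ n → Code (Fin n)
Fin-code n = record { card = n ; enc = id ; dec = id ; dec-enc = λ _ → refl }

infixr 6 _⊎-code_
infixr 7 _×-code_

_⊎-code_ : ∀ {A B} → Code A → Code B → Code (A ⊎ B)
_⊎-code_ {A} {B} a b = record { card = card a + card b ; enc = to ; dec = from ; dec-enc = inv }
  where
  to : A ⊎ B → Fin (card a + card b)
  to (inj₁ x) = join (card a) (card b) (inj₁ (enc a x))
  to (inj₂ y) = join (card a) (card b) (inj₂ (enc b y))
  back : Fin (card a) ⊎ Fin (card b) → A ⊎ B
  back (inj₁ x) = inj₁ (dec a x)
  back (inj₂ y) = inj₂ (dec b y)
  from : Fin (card a + card b) → A ⊎ B
  from i = back (splitAt (card a) i)
  inv : ∀ x → from (to x) ≡ x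
  inv (inj₁ x) = trans (cong back (FinP.splitAt-join (card a) (card b) (inj₁ (enc a x)))) (cong inj₁ (dec-enc a x))
  inv (inj₂ y) = trans (cong back (FinP.splitAt-join (card a) (card b) (inj₂ (enc b y)))) (cong inj₂ (dec-enc b y))

_×-code_ : ∀ {A B} → Code A → Code B → Code (A × B)
_×-code_ {A} {B} a b = record
  { card = card a * card b
  ; enc = λ (x , y) → combine (enc a x) (enc b y)
  ; dec = λ i → back (remQuot (card b) i)
  ; dec-enc = λ (x , y) → trans (cong back (FinP.remQuot-combine (enc a x) (enc b y)))
                                 (cong₂ _,_ (dec-enc a x) (dec-enc b y)) }
  where
  back : Fin (card a) × Fin (card b) → A × B
  back (i , j) = dec a i , dec b j

Bool-code : Code Bool
Bool-code = retract to from (λ { true → refl ; false → refl }) (⊤-code ⊎-code ⊤-code)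
  where
  to : Bool → ⊤ ⊎ ⊤
  to true  = inj₁ tt
  to false = inj₂ tt
  from : ⊤ ⊎ ⊤ → Bool
  from (inj₁ _) = true
  from (inj₂ _) = false

Maybe-code : ∀ {A} → Code A → Code (Maybe A)
Maybe-code {A} c = retract to from (λ { nothing → refl ; (just _) → refl }) (⊤-code ⊎-code c)
  where
  to : Maybe A → ⊤ ⊎ A
  to nothing  = inj₁ tt
  to (just a) = inj₂ a
  from : ⊤ ⊎ A → Maybe A
  from (inj₁ _) = nothing
  from (inj₂ a) = just a

enc-injective : ∀ {A} (c : Code A) {x y} → enc c x ≡ enc c y → x ≡ y
enc-injective c {x} {y} p = trans (sym (dec-enc c x)) (trans (cong (dec c) p) (dec-enc c y))

-- Tape symbols

-- raw: input bit before preparation; el: an element of the universe with the stack of pebbles placed on it;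
-- sp: separator or input bit already read; inp: unread input bit; mc: memory bit with a head mark.
data Pay : Set where
  raw : Bool → Pay
  el  : List Bool → Pay
  sp  : Pay
  inp : Bool → Pay
  mc  : Bool → Bool → Pay

-- The flag of a cell marks the left end of the tape.
data Sy : Set where
  blk  : Sy
  cell : Bool → Pay → Sy

Short : ℕ → List Bool → Set
Short V bs = length bs ≤ V

-- A finite alphabet has room only for pebble stacks of bounded height; the other payloads are
-- finitely many anyway.
Good : ℕ → Pay → Set
Good V (el bs) = Short V bs
Good V _       = ⊤

Bits : ℕ → Set
Bits zero    = ⊤
Bits (suc V) = ⊤ ⊎ (Bool × Bits V)

Bits-code : ∀ V → Code (Bits V)
Bits-code zero    = ⊤-code
Bits-code (suc V) = ⊤-code ⊎-code (Bool-code ×-code Bits-code V)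

toBits : ∀ V → List Bool → Bits V
toBits zero    _        = tt
toBits (suc V) []       = inj₁ tt
toBits (suc V) (b ∷ bs) = inj₂ (b , toBits V bs)

fromBits : ∀ V → Bits V → List Bool
fromBits zero    _              = []
fromBits (suc V) (inj₁ _)       = []
fromBits (suc V) (inj₂ (b , x)) = b ∷ fromBits V x

fromBits-toBits : ∀ V bs → Short V bs → fromBits V (toBits V bs) ≡ bs
fromBits-toBits zero    []       _       = refl
fromBits-toBits (suc V) []       _       = refl
fromBits-toBits (suc V) (b ∷ bs) (s≤s p) = cong (b ∷_) (fromBits-toBits V bs p)

PayBits : ℕ → Set
PayBits V = Bool ⊎ Bits V ⊎ ⊤ ⊎ Bool ⊎ (Bool × Bool)

PayBits-code : ∀ V → Code (PayBits V)
PayBits-code V = Bool-code ⊎-code Bits-code V ⊎-code ⊤-code ⊎-code Bool-code ⊎-code Bool-code ×-code Bool-code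

toPay : ∀ V → Pay → PayBits V
toPay V (raw b)  = inj₁ b
toPay V (el bs)  = inj₂ (inj₁ (toBits V bs))
toPay V sp       = inj₂ (inj₂ (inj₁ tt))
toPay V (inp b)  = inj₂ (inj₂ (inj₂ (inj₁ b)))
toPay V (mc h b) = inj₂ (inj₂ (inj₂ (inj₂ (h , b))))

fromPay : ∀ V → PayBits V → Pay
fromPay V (inj₁ b)                             = raw b
fromPay V (inj₂ (inj₁ x))                      = el (fromBits V x)
fromPay V (inj₂ (inj₂ (inj₁ _)))               = sp
fromPay V (inj₂ (inj₂ (inj₂ (inj₁ b))))        = inp b
fromPay V (inj₂ (inj₂ (inj₂ (inj₂ (h , b)))))  = mc h b

fromPay-toPay : ∀ V p → Good V p → fromPay V (toPay V p) ≡ p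
fromPay-toPay V (raw b)  _ = refl
fromPay-toPay V (el bs)  g = cong el (fromBits-toBits V bs g)
fromPay-toPay V sp       _ = refl
fromPay-toPay V (inp b)  _ = refl
fromPay-toPay V (mc h b) _ = refl

module Symbols (V : ℕ) where

  abstract
    cellCode : Code (Bool × PayBits V)
    cellCode = Bool-code ×-code PayBits-code V

  extras : ℕ
  extras = card cellCode

  -- The unflagged raw bits are sent to the two symbols that `initConfig` writes, so the input is a
  -- tape of cells from the start.
  encCell : Bool → Pay → Fin (3 + extras)
  encCell false (raw false) = suc zero
  encCell false (raw true)  = suc (suc zero)
  encCell f     p           = suc (suc (suc (enc cellCode (f , toPay V p))))

  encS : Sy → Fin (3 + extras)
  encS blk        = zero
  encS (cell f p) = encCell f p

  decS : Fin (3 + extras) → Sy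
  decS zero                = blk
  decS (suc zero)          = cell false (raw false)
  decS (suc (suc zero))    = cell false (raw true)
  decS (suc (suc (suc i))) = cell (proj₁ (dec cellCode i)) (fromPay V (proj₂ (dec cellCode i)))

  GoodS : Sy → Set
  GoodS blk        = ⊤
  GoodS (cell _ p) = Good V p

  dec-encCell : ∀ f p → Good V p → decS (suc (suc (suc (enc cellCode (f , toPay V p))))) ≡ cell f p
  dec-encCell f p g = trans (cong (λ (f' , x) → cell f' (fromPay V x)) (dec-enc cellCode (f , toPay V p)))
                            (cong (cell f) (fromPay-toPay V p g))

  decS-encS : ∀ s → GoodS s → decS (encS s) ≡ s
  decS-encS blk                    _ = refl
  decS-encS (cell false (raw false)) _ = refl
  decS-encS (cell false (raw true))  _ = refl
  decS-encS (cell true  (raw b))   g = dec-encCell true (raw b) g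
  decS-encS (cell false (el bs))   g = dec-encCell false (el bs) g
  decS-encS (cell true  (el bs))   g = dec-encCell true (el bs) g
  decS-encS (cell false sp)        g = dec-encCell false sp g
  decS-encS (cell true  sp)        g = dec-encCell true sp g
  decS-encS (cell false (inp b))   g = dec-encCell false (inp b) g
  decS-encS (cell true  (inp b))   g = dec-encCell true (inp b) g
  decS-encS (cell false (mc h b))  g = dec-encCell false (mc h b) g
  decS-encS (cell true  (mc h b))  g = dec-encCell true (mc h b) g

-- Filtering a list without repetitions

module _ {A : Set} where

  ∈[_] : ∀ {x y : A} → x ∈ y ∷ [] → x ≡ y
  ∈[ here p ] = p

  singleton-list : ∀ {t : A} ys → Unique ys → t ∈ ys → (∀ {y} → y ∈ ys → y ≡ t) → ys ≡ t ∷ []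
  singleton-list (y ∷ [])     u i h = cong (_∷ []) (h (here refl))
  singleton-list (y ∷ z ∷ ys) ((y≢z ∷ _) ∷ _) i h =
    ⊥-elim (y≢z (trans (h (here refl)) (sym (h (there (here refl))))))

  ∈-tail : ∀ {x y : A} {ys} → x ≢ y → x ∈ y ∷ ys → x ∈ ys
  ∈-tail x≢y (here p)  = ⊥-elim (x≢y p)
  ∈-tail x≢y (there i) = i

  pair-list : ∀ {s t : A} ys → Unique ys → s ≢ t → s ∈ ys → t ∈ ys → (∀ {y} → y ∈ ys → y ≡ s ⊎ y ≡ t) →
              ys ≡ s ∷ t ∷ [] ⊎ ys ≡ t ∷ s ∷ []
  pair-list (y ∷ ys) (y∉ ∷ u) s≢t s∈ t∈ h with h (here refl)
  ... | inj₁ refl = inj₁ (cong (y ∷_) (singleton-list ys u (∈-tail (s≢t ∘ sym) t∈) other))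
    where
    other : ∀ {z} → z ∈ ys → z ≡ _
    other i with h (there i)
    ... | inj₁ p = ⊥-elim (All.lookup y∉ i (sym p))
    ... | inj₂ p = p
  ... | inj₂ refl = inj₂ (cong (y ∷_) (singleton-list ys u (∈-tail s≢t s∈) other))
    where
    other : ∀ {z} → z ∈ ys → z ≡ _
    other i with h (there i)
    ... | inj₁ p = p
    ... | inj₂ p = ⊥-elim (All.lookup y∉ i (sym p))

module _ {A : Set} {P : A → Set} (P? : ∀ x → Dec (P x)) {xs : List A} (u : Unique xs) where

  filter-empty : (∀ x → ¬ P x) → filter P? xs ≡ []
  filter-empty h = ListP.filter-none P? (All.universal h xs)

  filter-singleton : ∀ {t} → t ∈ xs → P t → (∀ {x} → P x → x ≡ t) → filter P? xs ≡ t ∷ []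
  filter-singleton t∈ Pt h = singleton-list _ (UniqueP.filter⁺ P? u) (MemP.∈-filter⁺ P? t∈ Pt)
    (λ i → h (proj₂ (MemP.∈-filter⁻ P? {xs = xs} i)))

  filter-pair : ∀ {s t} → s ≢ t → s ∈ xs → t ∈ xs → P s → P t → (∀ {x} → P x → x ≡ s ⊎ x ≡ t) →
                filter P? xs ≡ s ∷ t ∷ [] ⊎ filter P? xs ≡ t ∷ s ∷ []
  filter-pair s≢t s∈ t∈ Ps Pt h = pair-list _ (UniqueP.filter⁺ P? u) s≢t
    (MemP.∈-filter⁺ P? s∈ Ps) (MemP.∈-filter⁺ P? t∈ Pt) (λ i → h (proj₂ (MemP.∈-filter⁻ P? {xs = xs} i)))

-- Computation trees

module _ {M : NTM} where

  -- The first number counts leaves, the second bounds the height. Halting in time and the number of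
  -- paths thus follow from one and the same induction.
  data Tree : Config M → ℕ → ℕ → Set where
    leaf : ∀ {c t} → successors c ≡ [] → Tree c 1 t
    node : ∀ {c c' k t} → successors c ≡ c' ∷ [] → Tree c' k t → Tree c k (suc t)
    fork : ∀ {c c₁ c₂ k₁ k₂ t} → successors c ≡ c₁ ∷ c₂ ∷ [] → Tree c₁ k₁ t → Tree c₂ k₂ t → Tree c (k₁ + k₂) (suc t)

  Tree-mono : ∀ {c k t t'} → t ≤ t' → Tree c k t → Tree c k t'
  Tree-mono p       (leaf e)     = leaf e
  Tree-mono (s≤s p) (node e h)   = node e (Tree-mono p h)
  Tree-mono (s≤s p) (fork e h g) = fork e (Tree-mono p h) (Tree-mono p g)

  Tree⇒HaltsWithin : ∀ {c k t} → Tree c k t → HaltsWithin t c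
  Tree⇒HaltsWithin {c} (leaf e) rewrite e = tt
  Tree⇒HaltsWithin {c} (node e h) rewrite e = Tree⇒HaltsWithin h , tt
  Tree⇒HaltsWithin {c} (fork e h g) rewrite e = Tree⇒HaltsWithin h , Tree⇒HaltsWithin g , tt

  Tree⇒paths : ∀ {c k t} → Tree c k t → paths t c ≡ k
  Tree⇒paths {c} (leaf e) rewrite e = refl
  Tree⇒paths {c} (node e h) rewrite e = trans (+-identityʳ _) (Tree⇒paths h)
  Tree⇒paths {c} (fork e h g) rewrite e =
    cong₂ _+_ (Tree⇒paths h) (trans (+-identityʳ _) (Tree⇒paths g))

-- The decision procedure inside the definition of successors is local to it and cannot be named.
-- On a machine whose transitions writing one of the three fixed symbols are all disabled, filter reduces to the
-- remaining (neutral) part of the transition list, where unification recovers the procedure.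
module Probe (E : ℕ) (b : Bool) where

  enabled : Fin (3 + E) → Bool
  enabled (suc (suc (suc _))) = b
  enabled _                   = false

  probe : NTM
  probe = record { nstates = 0 ; extra = E ; δ = λ _ _ t → enabled (proj₁ (proj₂ t)) }

  start : Config probe
  start = conf zero [] zero []

  extracted : Σ (∀ t → Dec (T (δ probe zero zero t))) λ P? → successors {probe} start ≡
    map (apply start) (filter P? (map (_,_ zero) (cartesianProduct (tabulate (λ x → suc (suc (suc x)))) allMoves) ++ []))
  extracted = _ , refl

-- With one extra symbol, `enabled` at that symbol is `b` itself, so the extracted procedure decides
-- `T b` there.
enabled? : ∀ b → Dec (T b)
enabled? b = proj₁ (Probe.extracted 1 b) (zero , suc (suc (suc zero)) , stay)

successors-filter : ∀ {M} (c : Config M) →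
  successors c ≡ map (apply c) (filter (λ t → enabled? (δ M (Config.st c) (Config.hd c) t)) (allTransitions M))
successors-filter c = refl

module _ (M : NTM) where

  private
    Transition : Set
    Transition = State M × Sym M × Move

  allTransitions-unique : Unique (allTransitions M)
  allTransitions-unique = UniqueP.cartesianProduct⁺ (UniqueP.allFin⁺ _) (UniqueP.cartesianProduct⁺ (UniqueP.allFin⁺ _)
    (((λ ()) ∷ (λ ()) ∷ []) ∷ ((λ ()) ∷ []) ∷ [] ∷ []))

  ∈-allMoves : ∀ m → m ∈ allMoves
  ∈-allMoves left  = here refl
  ∈-allMoves right = there (here refl)
  ∈-allMoves stay  = there (there (here refl))

  ∈-allTransitions : ∀ t → t ∈ allTransitions M
  ∈-allTransitions (q , a , m) = MemP.∈-cartesianProduct⁺ (MemP.∈-allFin q)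
    (MemP.∈-cartesianProduct⁺ (MemP.∈-allFin a) (∈-allMoves m))

  module _ (c : Config M) where

    Enabled : Transition → Set
    Enabled t = T (δ M (Config.st c) (Config.hd c) t)

    no-successor : (∀ t → ¬ Enabled t) → successors c ≡ []
    no-successor h = trans (successors-filter c) (cong (map (apply c)) (filter-empty {P = Enabled} (λ t → enabled? _) {xs = allTransitions M} allTransitions-unique h))

    one-successor : ∀ t → Enabled t → (∀ {x} → Enabled x → x ≡ t) → successors c ≡ apply c t ∷ []
    one-successor t e h = trans (successors-filter c) (cong (map (apply c))
      (filter-singleton {P = Enabled} (λ t → enabled? _) {xs = allTransitions M} allTransitions-unique {t} (∈-allTransitions t) e h))

    -- The order depends on how the transitions are enumerated; as only a sum over both successors
    -- is taken later, either order will do.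
    two-successors : ∀ s t → s ≢ t → Enabled s → Enabled t → (∀ {x} → Enabled x → x ≡ s ⊎ x ≡ t) →
      successors c ≡ apply c s ∷ apply c t ∷ [] ⊎ successors c ≡ apply c t ∷ apply c s ∷ []
    two-successors s t s≢t es et h = subst (λ z → z ≡ apply c s ∷ apply c t ∷ [] ⊎ z ≡ apply c t ∷ apply c s ∷ []) (sym (successors-filter c)) (cases
      (filter-pair {P = Enabled} (λ t → enabled? _) {xs = allTransitions M} allTransitions-unique {s} {t} s≢t (∈-allTransitions s) (∈-allTransitions t) es et h))
      where
      cases : ∀ {xs a b} → xs ≡ a ∷ b ∷ [] ⊎ xs ≡ b ∷ a ∷ [] →
              map (apply c) xs ≡ apply c a ∷ apply c b ∷ [] ⊎ map (apply c) xs ≡ apply c b ∷ apply c a ∷ []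
      cases (inj₁ refl) = inj₁ refl
      cases (inj₂ refl) = inj₂ refl

-- Machines given by rules on decoded states and symbols

data Act (Q : Set) : Set where
  stop  : Act Q
  go    : Q → Sy → Move → Act Q
  split : Q → Q → Act Q

mapAct : ∀ {P Q} → (P → Q) → Act P → Act Q
mapAct f stop        = stop
mapAct f (go q s m)  = go (f q) s m
mapAct f (split p q) = split (f p) (f q)

mapAct-fuse : ∀ {P Q R} {f : Q → R} {g : P → Q} {h : P → R} → (∀ x → f (g x) ≡ h x) →
              ∀ a → mapAct f (mapAct g a) ≡ mapAct h a
mapAct-fuse e stop        = refl
mapAct-fuse e (go q s m)  = cong (λ z → go z s m) (e q)
mapAct-fuse e (split p q) = cong₂ split (e p) (e q)

module Machine (V : ℕ) {Q : Set} (cQ : Code Q) (rule : ⊤ ⊎ Q → Sy → Act (⊤ ⊎ Q)) where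
  open Symbols V public

  G : Set
  G = ⊤ ⊎ Q

  cG : Code G
  cG = ⊤-code ⊎-code cQ

  Transition : Set
  Transition = Fin (suc (card cQ)) × Fin (3 + extras) × Move

  -- In a split the two transitions differ in the move, which has no effect at the left end of the tape.
  transitions : Act G → Fin (3 + extras) → List Transition
  transitions stop        a = []
  transitions (go q s m)  a = (enc cG q , encS s , m) ∷ []
  transitions (split p q) a = (enc cG p , a , stay) ∷ (enc cG q , a , left) ∷ []

  _≟ᵐ_ : (m m' : Move) → Dec (m ≡ m')
  left  ≟ᵐ left  = yes refl
  left  ≟ᵐ right = no λ ()
  left  ≟ᵐ stay  = no λ ()
  right ≟ᵐ left  = no λ ()
  right ≟ᵐ right = yes refl
  right ≟ᵐ stay  = no λ ()
  stay  ≟ᵐ left  = no λ ()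
  stay  ≟ᵐ right = no λ ()
  stay  ≟ᵐ stay  = yes refl

  _≟ᵗ_ : (t u : Transition) → Dec (t ≡ u)
  _≟ᵗ_ = ΣP.≡-dec FinP._≟_ (ΣP.≡-dec FinP._≟_ _≟ᵐ_)

  open DecMem _≟ᵗ_ using (_∈?_)

  abstract
    member : Transition → List Transition → Bool
    member t ts = isYes (t ∈? ts)

    member-sound : ∀ t ts → T (member t ts) → t ∈ ts
    member-sound t ts = toWitness {a? = t ∈? ts}

    member-complete : ∀ t ts → t ∈ ts → T (member t ts)
    member-complete t ts = fromWitness {a? = t ∈? ts}

  M : NTM
  M = record
    { nstates = card cQ
    ; extra = extras
    ; δ = λ q a t → member t (transitions (rule (dec cG q) (decS a)) a) }

  δ-decides : G → Sy → Act G → Set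
  δ-decides g s act = ∀ t → (T (δ M (enc cG g) (encS s) t) → t ∈ transitions act (encS s))
                          × (t ∈ transitions act (encS s) → T (δ M (enc cG g) (encS s) t))

  decides : ∀ {g s act} → GoodS s → rule g s ≡ act → δ-decides g s act
  decides {g} {s} {act} good r t = (λ p → subst (λ z → t ∈ transitions z (encS s)) decoded (member-sound t _ p))
                                 , (λ p → member-complete t _ (subst (λ z → t ∈ transitions z (encS s)) (sym decoded) p))
    where
    decoded : rule (dec cG (enc cG g)) (decS (encS s)) ≡ act
    decoded = trans (cong₂ rule (dec-enc cG g) (decS-encS s good)) r

  at : G → List (Fin (3 + extras)) → Sy → List (Fin (3 + extras)) → Config M
  at g l s r = conf (enc cG g) l (encS s) r

  tree-stop : ∀ {g s l r t} → GoodS s → rule g s ≡ stop → Tree {M} (at g l s r) 1 t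
  tree-stop {g} {s} {l} {r} good e = leaf (no-successor M (at g l s r) (λ t p → absurd (proj₁ (decides good e t) p)))
    where
    absurd : ∀ {t : Transition} → ¬ t ∈ []
    absurd ()

  tree-go : ∀ {g s q s' m l r k t} → GoodS s → rule g s ≡ go q s' m →
    Tree {M} (apply {M} (at g l s r) (enc cG q , encS s' , m)) k t → Tree {M} (at g l s r) k (suc t)
  tree-go {g} {s} {l = l} {r} good e h = node
    (one-successor M (at g l s r) _ (proj₂ (decides good e _) (here refl)) (λ {t} p → ∈[ proj₁ (decides good e t) p ])) h

  tree-split : ∀ {g s p q r k₁ k₂ t} → GoodS s → rule g s ≡ split p q →
    Tree {M} (at p [] s r) k₁ t → Tree {M} (at q [] s r) k₂ t → Tree {M} (at g [] s r) (k₁ + k₂) (suc t)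
  tree-split {g} {s} {p} {q} {r} {k₁} {k₂} {t} good e h₁ h₂ = finish
    (two-successors M (at g [] s r) (enc cG p , encS s , stay) (enc cG q , encS s , left) (λ ())
      (proj₂ (decides good e _) (here refl)) (proj₂ (decides good e _) (there (here refl)))
      (λ {x} i → two (proj₁ (decides good e x) i)))
    where
    two : ∀ {t a b : Transition} → t ∈ a ∷ b ∷ [] → t ≡ a ⊎ t ≡ b
    two (here p)         = inj₁ p
    two (there (here p)) = inj₂ p
    finish : successors {M} (at g [] s r) ≡ at p [] s r ∷ at q [] s r ∷ [] ⊎ successors {M} (at g [] s r) ≡ at q [] s r ∷ at p [] s r ∷ [] →
             Tree {M} (at g [] s r) (k₁ + k₂) (suc t)
    finish (inj₁ x) = fork x h₁ h₂
    finish (inj₂ x) = subst (λ k → Tree {M} (at g [] s r) k (suc t)) (+-comm k₂ k₁) (fork x h₂ h₁)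

-- Sweeps: one pass over the tape by a finite transducer, followed by a rewind

record Sweep : Set₁ where
  field
    S    : Set
    cS   : Code S
    s₀   : S
    step : S → Pay → S × Pay
    -- The optional payload is a new cell at the right end; this is how the array of bits grows.
    fin  : S → Maybe Pay × Bool

infixr 5 _∷ʳᵘⁿ_

data Run {S : Set} (step : S → Pay → S × Pay) : S → List Pay → S → List Pay → Set where
  []ʳᵘⁿ  : ∀ {s} → Run step s [] s []
  _∷ʳᵘⁿ_ : ∀ {s p s₁ p' ps s' ps'} → step s p ≡ (s₁ , p') → Run step s₁ ps s' ps' → Run step s (p ∷ ps) s' (p' ∷ ps')

infixr 5 _++ʳᵘⁿ_

_++ʳᵘⁿ_ : ∀ {S} {step : S → Pay → S × Pay} {s s' s'' ps ps' qs qs'} →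
          Run step s ps s' ps' → Run step s' qs s'' qs' → Run step s (ps ++ qs) s'' (ps' ++ qs')
[]ʳᵘⁿ      ++ʳᵘⁿ r' = r'
(e ∷ʳᵘⁿ r) ++ʳᵘⁿ r' = e ∷ʳᵘⁿ (r ++ʳᵘⁿ r')

inert : ∀ {S} {step : S → Pay → S × Pay} {s ps} → All (λ p → step s p ≡ (s , p)) ps → Run step s ps s ps
inert []       = []ʳᵘⁿ
inert (e ∷ es) = e ∷ʳᵘⁿ inert es

Run-length : ∀ {S} {step : S → Pay → S × Pay} {s s' ps ps'} → Run step s ps s' ps' → length ps' ≡ length ps
Run-length []ʳᵘⁿ      = refl
Run-length (_ ∷ʳᵘⁿ r) = cong suc (Run-length r)

All-ʳ++ : ∀ {A : Set} {P : A → Set} {xs ys} → All P xs → All P ys → All P (xs ʳ++ ys)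
All-ʳ++ []       qs = qs
All-ʳ++ (p ∷ ps) qs = All-ʳ++ ps (p ∷ qs)

maybeList : ∀ {A : Set} → Maybe A → List A
maybeList nothing  = []
maybeList (just a) = a ∷ []

record Sweeps (sw : Sweep) (tape : List Pay) (b : Bool) (tape' : List Pay) : Set where
  constructor sweeps
  field
    {s'}    : Sweep.S sw
    {out}   : List Pay
    {extra} : Maybe Pay
    run     : Run (Sweep.step sw) (Sweep.s₀ sw) tape s' out
    end     : Sweep.fin sw s' ≡ (extra , b)
    result  : out ++ maybeList extra ≡ tape'

-- Program fragments with one entry and two exits, indexed by the Boolean result

record Frag : Set₁ where
  field
    Q     : Set
    cQ    : Code Q
    entry : Q
    rule  : Q → Sy → Act (Q ⊎ Bool)

module _ (sw : Sweep) where
  open Sweep sw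

  SweepState : Set
  SweepState = S ⊎ Bool ⊎ Bool

  pattern fwd s  = inj₁ s
  pattern app b  = inj₂ (inj₁ b)
  pattern back b = inj₂ (inj₂ b)

  -- Moving right after writing a new cell creates a blank behind it, so in both cases the rewind
  -- starts from a blank behind the last cell.
  sweepEnd : Maybe Pay × Bool → Act (SweepState ⊎ Bool)
  sweepEnd (nothing , b) = go (inj₁ (back b)) blk stay
  sweepEnd (just p  , b) = go (inj₁ (app b)) (cell false p) right

  sweepRule : SweepState → Sy → Act (SweepState ⊎ Bool)
  sweepRule (fwd s)  (cell f p)    = go (inj₁ (fwd (proj₁ (step s p)))) (cell f (proj₂ (step s p))) right
  sweepRule (fwd s)  blk           = sweepEnd (fin s)
  sweepRule (app b)  s             = go (inj₁ (back b)) blk stay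
  sweepRule (back b) (cell true p) = go (inj₂ b) (cell true p) stay
  sweepRule (back b) s             = go (inj₁ (back b)) s left

  sweepFrag : Frag
  sweepFrag = record { Q = SweepState ; cQ = cS ⊎-code Bool-code ⊎-code Bool-code ; entry = fwd s₀ ; rule = sweepRule }

retFrag : Bool → Frag
retFrag b = record { Q = ⊤ ; cQ = ⊤-code ; entry = tt ; rule = λ _ s → go (inj₂ b) s stay }

haltFrag : Frag
haltFrag = record { Q = ⊤ ; cQ = ⊤-code ; entry = tt ; rule = λ _ _ → stop }

-- Fragments are entered with the head on the first cell. Only there do the two moves of a split
-- lead to the same tape.
chooseFrag : Frag → Frag → Frag
chooseFrag A B = record
  { Q = ⊤ ⊎ A.Q ⊎ B.Q ; cQ = ⊤-code ⊎-code A.cQ ⊎-code B.cQ ; entry = inj₁ tt ; rule = rule }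
  where
  module A = Frag A
  module B = Frag B
  rule : ⊤ ⊎ A.Q ⊎ B.Q → Sy → Act ((⊤ ⊎ A.Q ⊎ B.Q) ⊎ Bool)
  rule (inj₁ _)        s = split (inj₁ (inj₂ (inj₁ A.entry))) (inj₁ (inj₂ (inj₂ B.entry)))
  rule (inj₂ (inj₁ q)) s = mapAct [ inj₁ ∘ inj₂ ∘ inj₁ , inj₂ ] (A.rule q s)
  rule (inj₂ (inj₂ q)) s = mapAct [ inj₁ ∘ inj₂ ∘ inj₂ , inj₂ ] (B.rule q s)

iteFrag : Frag → Frag → Frag → Frag
iteFrag A B C = record
  { Q = A.Q ⊎ B.Q ⊎ C.Q ; cQ = A.cQ ⊎-code B.cQ ⊎-code C.cQ ; entry = inj₁ A.entry ; rule = rule }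
  where
  module A = Frag A
  module B = Frag B
  module C = Frag C
  rule : A.Q ⊎ B.Q ⊎ C.Q → Sy → Act ((A.Q ⊎ B.Q ⊎ C.Q) ⊎ Bool)
  rule (inj₁ q)        s = mapAct [ inj₁ ∘ inj₁ , (λ b → inj₁ (inj₂ (if b then inj₁ B.entry else inj₂ C.entry))) ] (A.rule q s)
  rule (inj₂ (inj₁ q)) s = mapAct [ inj₁ ∘ inj₂ ∘ inj₁ , inj₂ ] (B.rule q s)
  rule (inj₂ (inj₂ q)) s = mapAct [ inj₁ ∘ inj₂ ∘ inj₂ , inj₂ ] (C.rule q s)

-- done ends a loop whose body never returned true, break one whose body did.
module Loop (init adv done break : Sweep) (P : Frag) where
  module I = Frag (sweepFrag init)
  module P = Frag P
  module A = Frag (sweepFrag adv)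
  module D = Frag (sweepFrag done)
  module B = Frag (sweepFrag break)

  LoopState : Set
  LoopState = I.Q ⊎ P.Q ⊎ A.Q ⊎ D.Q ⊎ B.Q

  pattern inI q = inj₁ q
  pattern inP q = inj₂ (inj₁ q)
  pattern inA q = inj₂ (inj₂ (inj₁ q))
  pattern inD q = inj₂ (inj₂ (inj₂ (inj₁ q)))
  pattern inB q = inj₂ (inj₂ (inj₂ (inj₂ q)))

  exitI exitP exitA exitD exitB : Bool → LoopState ⊎ Bool
  exitI b = if b then inj₁ (inP P.entry) else inj₂ false
  exitP b = if b then inj₁ (inB B.entry) else inj₁ (inA A.entry)
  exitA b = if b then inj₁ (inP P.entry) else inj₁ (inD D.entry)
  exitD b = inj₂ false
  exitB b = inj₂ true

  loopRule : LoopState → Sy → Act (LoopState ⊎ Bool)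
  loopRule (inI q) s = mapAct [ (λ q → inj₁ (inI q)) , exitI ] (I.rule q s)
  loopRule (inP q) s = mapAct [ (λ q → inj₁ (inP q)) , exitP ] (P.rule q s)
  loopRule (inA q) s = mapAct [ (λ q → inj₁ (inA q)) , exitA ] (A.rule q s)
  loopRule (inD q) s = mapAct [ (λ q → inj₁ (inD q)) , exitD ] (D.rule q s)
  loopRule (inB q) s = mapAct [ (λ q → inj₁ (inB q)) , exitB ] (B.rule q s)

  loopFrag : Frag
  loopFrag = record
    { Q = LoopState ; cQ = I.cQ ⊎-code P.cQ ⊎-code A.cQ ⊎-code D.cQ ⊎-code B.cQ
    ; entry = inI I.entry ; rule = loopRule }

-- Running a sweep on the machine

module Execution (V : ℕ) {Q : Set} (cQ : Code Q) (rule : ⊤ ⊎ Q → Sy → Act (⊤ ⊎ Q)) where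
  open Machine V cQ rule public

  Tape : Set
  Tape = List (Fin (3 + extras))

  cells : List Pay → Tape
  cells = map (encCell false)

  goTo : G → Tape → Tape → Config M
  goTo g l []      = at g l blk []
  goTo g l (a ∷ r) = conf (enc cG g) l a r

  apply-right : ∀ g l s g' a r → apply {M} (at g l s r) (enc cG g' , a , right) ≡ goTo g' (a ∷ l) r
  apply-right g l s g' a []      = refl
  apply-right g l s g' a (_ ∷ r) = refl

  tree-right : ∀ {g s q s' l r k t} → GoodS s → rule g s ≡ go q s' right →
    Tree {M} (goTo q (encS s' ∷ l) r) k t → Tree {M} (at g l s r) k (suc t)
  tree-right {g} {s} {q} {s'} {l} {r} {k} {t} good e h =
    tree-go {g} {s} {q} {s'} {right} {l} {r} good e (subst (λ c → Tree c k t) (sym (apply-right g l s q (encS s') r)) h)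

  -- The first sweep reaches the end of the input without an explicit blank; every later sweep finds
  -- the blank left by its predecessor.
  data IsBlank : Tape → Set where
    none : IsBlank []
    one  : IsBlank (zero ∷ [])

  cfg : G → List Pay → Tape → Config M
  cfg g []       r = at g [] blk r
  cfg g (p ∷ ps) r = at g [] (cell true p) (cells ps ++ r)

  -- `F` sits inside the machine with states renamed by `e` and exits wired to `x`. Correctness is
  -- proved for every embedding, which makes it compositional.
  Embeds : (F : Frag) → (Frag.Q F → G) → (Bool → G) → Set
  Embeds F e x = ∀ q s → rule (e q) s ≡ mapAct [ e , x ] (Frag.rule F q s)

  module _ (sw : Sweep) {e : SweepState sw → G} {x : Bool → G} (emb : Embeds (sweepFrag sw) e x) where
    open Sweep sw

    forward : ∀ {s ps s' ps' l r k t} → Run step s ps s' ps' → All (Good V) ps →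
      Tree {M} (goTo (e (fwd s')) (cells ps' ʳ++ l) r) k t →
      Tree {M} (goTo (e (fwd s)) l (cells ps ++ r)) k (length ps + t)
    forward []ʳᵘⁿ          []       h = h
    forward {s} {p ∷ ps} {l = l} {r} (_∷ʳᵘⁿ_ {s₁ = s₁} {p' = p'} eqn run) (g ∷ gs) h =
      tree-right {e (fwd s)} {cell false p} {e (fwd s₁)} {cell false p'} {l} g
        (trans (emb (fwd s) (cell false p)) (cong (λ z → go (e (fwd (proj₁ z))) (cell false (proj₂ z)) right) eqn))
        (forward run gs h)

    NotFirst : Sy → Set
    NotFirst blk        = ⊤
    NotFirst (cell f p) = f ≡ false

    back-rule : ∀ b s → NotFirst s → rule (e (back b)) s ≡ go (e (back b)) s left
    back-rule b blk          _    = emb (back b) blk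
    back-rule b (cell _ p)   refl = emb (back b) (cell false p)

    backward : ∀ {b p r k t} us s → NotFirst s → GoodS s → Good V p → All (Good V) us →
      Tree {M} (at (x b) [] (cell true p) (cells us ʳ++ (encS s ∷ r))) k t →
      Tree {M} (at (e (back b)) (cells us ++ encCell true p ∷ []) s r) k (length us + suc (suc t))
    backward {b} {p} {r} [] s nf gs gp [] h =
      tree-go {e (back b)} {s} {e (back b)} {s} {left} gs (back-rule b s nf)
        (tree-go {e (back b)} {cell true p} {x b} {cell true p} {stay} {[]} {encS s ∷ r} gp (emb (back b) (cell true p)) h)
    backward {b} {p} {r} (u ∷ us) s nf gs gp (gu ∷ gus) h =
      tree-go {e (back b)} {s} {e (back b)} {s} {left} gs (back-rule b s nf)
        (backward us (cell false u) refl gu gp gus h)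

    cells-reverse : ∀ us l → cells us ʳ++ l ≡ cells (reverse us) ++ l
    cells-reverse us l = trans (ListP.ʳ++-defn (cells us)) (cong (_++ l) (sym (ListP.reverse-map (encCell false) us)))

    cells-reverse' : ∀ us l → cells (reverse us) ʳ++ l ≡ cells us ++ l
    cells-reverse' us l = trans (cells-reverse (reverse us) l) (cong (λ z → cells z ++ l) (ListP.reverse-involutive us))

    rewind : ∀ {b p k t} ps → Good V p → All (Good V) ps →
      Tree {M} (cfg (x b) (p ∷ ps) (zero ∷ [])) k t →
      Tree {M} (at (e (back b)) (cells ps ʳ++ (encCell true p ∷ [])) blk []) k (length ps + suc (suc t))
    rewind {b} {p} {k} {t} ps gp gps h =
      subst₂ (λ l n → Tree {M} (at (e (back b)) l blk []) k (n + suc (suc t)))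
        (sym (cells-reverse ps _)) (ListP.length-reverse ps)
        (backward (reverse ps) blk tt tt gp (All-ʳ++ gps [])
          (subst (λ r → Tree {M} (at (x b) [] (cell true p) r) k t) (sym (cells-reverse' ps _)) h))

    goTo-blank : ∀ {g l r} → IsBlank r → goTo g l r ≡ at g l blk []
    goTo-blank none = refl
    goTo-blank one  = refl

    -- Every cell is crossed once in each direction, and the turns at both ends cost two more steps.
    -- An appended cell costs two steps as well, so the time depends only on the length of the
    -- resulting tape.
    sweep-correct : ∀ {p ps b tape' r k t} → Sweeps sw (p ∷ ps) b tape' → IsBlank r →
      All (Good V) (p ∷ ps) → All (Good V) tape' →
      Tree {M} (cfg (x b) tape' (zero ∷ [])) k t →
      Tree {M} (cfg (e (fwd s₀)) (p ∷ ps) r) k (2 + 2 * length tape' + t)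
    sweep-correct {p} {ps} {b} {_} {r} {k} {t} (sweeps {s'} {out = p' ∷ ps'} {mb} (_∷ʳᵘⁿ_ {s₁ = s₁} eqn run) end refl) bl (g ∷ gs) (g' ∷ gs') h =
      Tree-mono (≤-reflexive arith)
        (tree-right {e (fwd s₀)} {cell true p} {e (fwd s₁)} {cell true p'} {[]} g
          (trans (emb (fwd s₀) (cell true p)) (cong (λ z → go (e (fwd (proj₁ z))) (cell true (proj₂ z)) right) eqn))
          (forward run gs (subst (λ c → Tree {M} c k (suc (q mb + (n + (2 + t))))) (sym (goTo-blank {e (fwd s')} {cells ps' ʳ++ (encCell true p' ∷ [])} bl)) (finish mb end gs' h))))
      where
      n = length ps
      q : Maybe Pay → ℕ
      q nothing  = 0
      q (just _) = 2
      arith : suc (n + suc (q mb + (n + (2 + t)))) ≡ 2 + 2 * length (p' ∷ ps' ++ maybeList mb) + t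
      arith = trans (lem (q mb) (length (maybeList mb)) (q-eq mb))
        (cong (λ z → 2 + 2 * suc z + t) (sym (trans (ListP.length-++ ps') (cong (_+ length (maybeList mb)) (Run-length run)))))
        where
        q-eq : ∀ mb → q mb ≡ 2 * length (maybeList mb)
        q-eq nothing  = refl
        q-eq (just _) = refl
        open import Data.Nat.Solver using (module +-*-Solver)
        open +-*-Solver
        lem : ∀ u v → u ≡ 2 * v → suc (n + suc (u + (n + (2 + t)))) ≡ 2 + 2 * suc (n + v) + t
        lem _ v refl = solve 3 (λ n v t → con 1 :+ (n :+ (con 1 :+ (con 2 :* v :+ (n :+ (con 2 :+ t))))) := con 2 :+ con 2 :* (con 1 :+ (n :+ v)) :+ t) refl n v t
      finish : ∀ mb → fin s' ≡ (mb , b) → All (Good V) (ps' ++ maybeList mb) → Tree {M} (cfg (x b) (p' ∷ ps' ++ maybeList mb) (zero ∷ [])) k t →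
        Tree {M} (at (e (fwd s')) (cells ps' ʳ++ (encCell true p' ∷ [])) blk []) k (suc (q mb + (n + (2 + t))))
      finish nothing eqn gs' h =
        tree-go {e (fwd s')} {blk} {e (back b)} {blk} {stay} tt
          (trans (emb (fwd s') blk) (cong (λ z → mapAct [ e , x ] (sweepEnd sw z)) eqn))
          (subst (λ z → Tree _ k (z + suc (suc t))) (Run-length run)
            (rewind ps' g' (AllP.++⁻ˡ ps' gs') (subst (λ z → Tree (cfg (x b) (p' ∷ z) (zero ∷ [])) k t) (ListP.++-identityʳ ps') h)))
      finish (just y) eqn gs' h =
        tree-right {e (fwd s')} {blk} {e (app b)} {cell false y} {cells ps' ʳ++ (encCell true p' ∷ [])} {[]} tt
          (trans (emb (fwd s') blk) (cong (λ z → mapAct [ e , x ] (sweepEnd sw z)) eqn))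
          (tree-go {e (app b)} {blk} {e (back b)} {blk} {stay} tt (emb (app b) blk)
            (subst₂ (λ l z → Tree (at (e (back b)) l blk []) k z)
              (trans (cells-reverse (ps' ++ y ∷ []) _) (trans (cong (λ z → cells z ++ _) (ListP.reverse-++ ps' (y ∷ [])))
                (cong (encCell false y ∷_) (sym (cells-reverse ps' _)))))
              (trans (cong (_+ suc (suc t)) (trans (ListP.length-++ ps') (trans (cong (_+ 1) (Run-length run)) (+-comm n 1)))) refl)
              (rewind (ps' ++ y ∷ []) g' gs' h)))

-- A programming language over the universe Fin n

data Op (m : ℕ) : Set where
  cmp    : Bool → Fin m → Fin m → Op m
  input  : Op m
  rewind : Op m
  adv    : Op m
  read   : Op m
  write  : Bool → Op m

-- Programs return a Boolean. A loop runs through the universe until its body returns true, and returns whether it did.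
data Prog (m : ℕ) : Set where
  op     : Op m → Prog m
  ret    : Bool → Prog m
  ite    : Prog m → Prog m → Prog m → Prog m
  for    : Prog (suc m) → Prog m
  choose : Prog m → Prog m → Prog m
  halt   : Prog m

-- junk counts the input bits already read, inq is the unread input; bef, cur and aft form an array of bits with
-- its head on cur.
record Mem : Set where
  constructor mem
  field
    junk : ℕ
    inq  : List Bool
    bef  : List Bool
    cur  : Bool
    aft  : List Bool

-- One transducer serves both predicates on elements: with `true` this is equality, with `false` it
-- is the order ≤.
compareFin : ∀ {n} → Bool → Fin n → Fin n → Bool
compareFin e zero    zero    = true
compareFin e zero    (suc _) = not e
compareFin e (suc _) zero    = false
compareFin e (suc x) (suc y) = compareFin e x y

eqFin : ∀ {n} → Fin n → Fin n → Bool
eqFin = compareFin true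

readInput : Mem → Bool × Mem
readInput (mem j []      u c a) = false , mem j [] u c a
readInput (mem j (b ∷ q) u c a) = b , mem (suc j) q u c a

toStart : Mem → Mem
toStart (mem j q []      c a) = mem j q [] c a
toStart (mem j q (b ∷ u) c a) = mem j q [] b (u ++ c ∷ a)

advance : Mem → Mem
advance (mem j q u c [])      = mem j q (u ++ c ∷ []) false []
advance (mem j q u c (b ∷ a)) = mem j q (u ++ c ∷ []) b a

put : Bool → Mem → Mem
put b μ = record μ { cur = b }

exec : ∀ {n m} → Op m → Vec (Fin n) m → Mem → Bool × Mem
exec (cmp e i j) ρ μ = compareFin e (lookup ρ i) (lookup ρ j) , μ
exec input       ρ μ = readInput μ
exec rewind      ρ μ = false , toStart μ
exec adv         ρ μ = false , advance μ
exec read        ρ μ = Mem.cur μ , μ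
exec (write b)   ρ μ = false , put b μ

iter : ∀ {A : Set} → (A → (Bool → Mem → ℕ) → Mem → ℕ) → List A → (Bool → Mem → ℕ) → Mem → ℕ
iter f []       κ = κ false
iter f (a ∷ as) κ = f a (λ b → if b then κ true else iter f as κ)

-- sem P κ ρ μ is the number of computation paths of P when each of its ends continues with κ.
sem : ∀ {n m} → Prog m → (Bool → Mem → ℕ) → Vec (Fin n) m → Mem → ℕ
sem (op o)       κ ρ μ = κ (proj₁ (exec o ρ μ)) (proj₂ (exec o ρ μ))
sem (ret b)      κ ρ μ = κ b μ
sem (ite A B C)  κ ρ μ = sem A (λ b → if b then sem B κ ρ else sem C κ ρ) ρ μ
sem (for P)      κ ρ μ = iter (λ a κ' → sem P κ' (a ∷ ρ)) (allFin _) κ μ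
sem (choose A B) κ ρ μ = sem A κ ρ μ + sem B κ ρ μ
sem halt         κ ρ μ = 1

-- Bounds the number of loop variables alive at the same time, hence the height of the pebble
-- stacks. Sums replace maxima for simplicity.
depth : ∀ {m} → Prog m → ℕ
depth (op o)       = 0
depth (ret b)      = 0
depth (ite A B C)  = depth A + (depth B + depth C)
depth (for P)      = suc (depth P)
depth (choose A B) = depth A + depth B
depth halt         = 0

-- Time in units of one sweep. A loop pays for one push, for a body and a shift per element, and for
-- one pop. As a unit lengthens the tape by at most one cell, the cost also bounds the growth of the
-- tape.
cost : ∀ {m} → Prog m → ℕ → ℕ
cost (op o)       n = 1
cost (ret b)      n = 1
cost (ite A B C)  n = cost A n + (cost B n + cost C n)
cost (for P)      n = suc (n * (cost P n + 1) + 1)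
cost (choose A B) n = suc (cost A n + cost B n)
cost halt         n = 1

-- The tape of a state

marks : ∀ {n m} → Vec (Fin n) m → Fin n → List Bool
marks []      a = []
marks (x ∷ ρ) a = eqFin x a ∷ marks ρ a

els : ∀ {n} → (Fin n → List Bool) → List Pay
els f = tabulate (λ a → el (f a))

array : List Bool → Bool → List Bool → List Pay
array u c a = map (mc false) u ++ mc true c ∷ map (mc false) a

control : Mem → List Pay
control μ = replicate (Mem.junk μ) sp ++ map inp (Mem.inq μ)

store : Mem → List Pay
store μ = sp ∷ control μ ++ array (Mem.bef μ) (Mem.cur μ) (Mem.aft μ)

render : ∀ {n m} → Vec (Fin n) m → Mem → List Pay
render ρ μ = els (marks ρ) ++ store μ

nth : List Bool → ℕ → Bool
nth []       _       = false
nth (b ∷ bs) zero    = b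
nth (b ∷ bs) (suc i) = nth bs i

nth-marks : ∀ {n m} (ρ : Vec (Fin n) m) i a → nth (marks ρ a) (toℕ i) ≡ eqFin (lookup ρ i) a
nth-marks (x ∷ ρ) zero    a = refl
nth-marks (x ∷ ρ) (suc i) a = nth-marks ρ i a

length-marks : ∀ {n m} (ρ : Vec (Fin n) m) a → length (marks ρ a) ≡ m
length-marks []      a = refl
length-marks (x ∷ ρ) a = cong suc (length-marks ρ a)

Maybe-Bool-code : Code (Maybe Bool)
Maybe-Bool-code = Maybe-code Bool-code

quiet : ∀ {A : Set} → A → Maybe Pay × A
quiet b = nothing , b

-- The first marked cell decides a comparison.
firstMark : Bool → Bool → Bool → Maybe Bool
firstMark _     false false = nothing
firstMark true  b     c     = just (b ∧ c)
firstMark false b     _     = just b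

cmpStep : Bool → ℕ → ℕ → Maybe Bool → Pay → Maybe Bool × Pay
cmpStep e i j nothing  (el bs) = firstMark e (nth bs i) (nth bs j) , el bs
cmpStep e i j s        p       = s , p

inputStep : Maybe Bool → Pay → Maybe Bool × Pay
inputStep nothing  (inp b) = just b , sp
inputStep s        p       = s , p

rewindStep : Bool → Pay → Bool × Pay
rewindStep s (mc _ b) = true , mc (not s) b
rewindStep s p        = s , p

data Phase : Set where
  before carry after : Phase

Phase-code : Code Phase
Phase-code = retract to from inv (Fin-code 3)
  where
  to : Phase → Fin 3
  to before = zero
  to carry  = suc zero
  to after  = suc (suc zero)
  from : Fin 3 → Phase
  from zero          = before
  from (suc zero)    = carry
  from (suc (suc _)) = after
  inv : ∀ s → from (to s) ≡ s
  inv before = refl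
  inv carry  = refl
  inv after  = refl

advStep : Phase → Pay → Phase × Pay
advStep before (mc true b) = carry , mc false b
advStep carry  (mc _ b)    = after , mc true b
advStep s      p           = s , p

advEnd : Phase → Maybe Pay × Bool
advEnd carry = just (mc true false) , false
advEnd _     = nothing , false

readStep : Bool → Pay → Bool × Pay
readStep s (mc true b) = b , mc true b
readStep s p           = s , p

writeStep : Bool → ⊤ → Pay → ⊤ × Pay
writeStep v s (mc true _) = s , mc true v
writeStep v s p           = s , p

opSweep : ∀ {m} → Op m → Sweep
opSweep (cmp e i j) = record { cS = Maybe-Bool-code ; s₀ = nothing ; step = cmpStep e (toℕ i) (toℕ j) ; fin = quiet ∘ fromMaybe false }
opSweep input       = record { cS = Maybe-Bool-code ; s₀ = nothing ; step = inputStep ; fin = quiet ∘ fromMaybe false }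
opSweep rewind      = record { cS = Bool-code ; s₀ = false ; step = rewindStep ; fin = λ _ → quiet false }
opSweep adv         = record { cS = Phase-code ; s₀ = before ; step = advStep ; fin = advEnd }
opSweep read        = record { cS = Bool-code ; s₀ = false ; step = readStep ; fin = quiet }
opSweep (write v)   = record { cS = ⊤-code ; s₀ = tt ; step = writeStep v ; fin = λ _ → quiet false }

pushStep : Bool → Pay → Bool × Pay
pushStep s (el bs) = true , el (not s ∷ bs)
pushStep s p       = s , p

shiftStep : Phase → Pay → Phase × Pay
shiftStep before (el (true ∷ bs)) = carry , el (false ∷ bs)
shiftStep carry  (el (_ ∷ bs))    = after , el (true ∷ bs)
shiftStep s      p                = s , p

popStep : ⊤ → Pay → ⊤ × Pay
popStep s (el (_ ∷ bs)) = s , el bs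
popStep s p             = s , p

isAfter : Phase → Bool
isAfter after = true
isAfter _     = false

-- The answers steer a loop: the push tells whether the universe is nonempty, the shift whether
-- there was a next element.
pushSweep shiftSweep popSweep : Sweep
pushSweep  = record { cS = Bool-code ; s₀ = false ; step = pushStep ; fin = quiet }
shiftSweep = record { cS = Phase-code ; s₀ = before ; step = shiftStep ; fin = quiet ∘ isAfter }
popSweep   = record { cS = ⊤-code ; s₀ = tt ; step = popStep ; fin = λ _ → quiet true }

module _ {S : Set} {step : S → Pay → S × Pay} {s : S} where

  inert-tabulate : ∀ {n} (f : Fin n → Pay) → (∀ a → step s (f a) ≡ (s , f a)) → Run step s (tabulate f) s (tabulate f)
  inert-tabulate f h = inert (AllP.tabulate⁺ h)

  inert-map : ∀ {A : Set} (f : A → Pay) → (∀ a → step s (f a) ≡ (s , f a)) → ∀ as → Run step s (map f as) s (map f as)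
  inert-map f h as = inert (AllP.map⁺ (All.universal h as))

  inert-control : step s sp ≡ (s , sp) → (∀ b → step s (inp b) ≡ (s , inp b)) → ∀ μ → Run step s (control μ) s (control μ)
  inert-control h h' μ = inert (AllP.replicate⁺ (Mem.junk μ) h) ++ʳᵘⁿ inert-map inp h' (Mem.inq μ)

  inert-store : step s sp ≡ (s , sp) → (∀ b → step s (inp b) ≡ (s , inp b)) → (∀ h b → step s (mc h b) ≡ (s , mc h b)) →
    ∀ μ → Run step s (store μ) s (store μ)
  inert-store h h' h'' μ = h ∷ʳᵘⁿ inert-control h h' μ ++ʳᵘⁿ
    inert-map (mc false) (h'' false) (Mem.bef μ) ++ʳᵘⁿ h'' true (Mem.cur μ) ∷ʳᵘⁿ inert-map (mc false) (h'' false) (Mem.aft μ)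

-- As long as neither pebble lies on the current cell, both elements are successors, so the sweep
-- proceeds in step with `compareFin`.
cmp-els : ∀ e i j {n} (x y : Fin n) (f : Fin n → List Bool) →
  (∀ a → nth (f a) i ≡ eqFin x a) → (∀ a → nth (f a) j ≡ eqFin y a) →
  Run (cmpStep e i j) nothing (els f) (just (compareFin e x y)) (els f)
cmp-els e i j {suc n} x y f p q = first x y p q ∷ʳᵘⁿ rest e x y p q
  where
  start : Bool → Fin (suc n) → Fin (suc n) → Maybe Bool
  start e x y = firstMark e (eqFin x zero) (eqFin y zero)
  first : ∀ x y → (∀ a → nth (f a) i ≡ eqFin x a) → (∀ a → nth (f a) j ≡ eqFin y a) →
    cmpStep e i j nothing (el (f zero)) ≡ (start e x y , el (f zero))
  first x y p q = cong₂ (λ b c → firstMark e b c , el (f zero)) (p zero) (q zero)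
  done : ∀ {e} b → Run (cmpStep e i j) (just b) (els (f ∘ suc)) (just b) (els (f ∘ suc))
  done b = inert-tabulate _ (λ _ → refl)
  rest : ∀ e x y → (∀ a → nth (f a) i ≡ eqFin x a) → (∀ a → nth (f a) j ≡ eqFin y a) →
    Run (cmpStep e i j) (start e x y) (els (f ∘ suc)) (just (compareFin e x y)) (els (f ∘ suc))
  rest true  zero    zero    p q = done true
  rest false zero    zero    p q = done true
  rest true  zero    (suc y) p q = done false
  rest false zero    (suc y) p q = done true
  rest true  (suc x) zero    p q = done false
  rest false (suc x) zero    p q = done false
  rest true  (suc x) (suc y) p q = cmp-els true i j x y (f ∘ suc) (p ∘ suc) (q ∘ suc)
  rest false (suc x) (suc y) p q = cmp-els false i j x y (f ∘ suc) (p ∘ suc) (q ∘ suc)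

silent : ∀ {sw tape b s' tape'} → Run (Sweep.step sw) (Sweep.s₀ sw) tape s' tape' → Sweep.fin sw s' ≡ (nothing , b) → Sweeps sw tape b tape'
silent r e = sweeps r e (ListP.++-identityʳ _)

op-sweeps : ∀ {n m} (o : Op m) (ρ : Vec (Fin n) m) μ →
  Sweeps (opSweep o) (render ρ μ) (proj₁ (exec o ρ μ)) (render ρ (proj₂ (exec o ρ μ)))
op-sweeps (cmp e i j) ρ μ = silent
  (cmp-els e (toℕ i) (toℕ j) (lookup ρ i) (lookup ρ j) (marks ρ) (nth-marks ρ i) (nth-marks ρ j)
    ++ʳᵘⁿ inert-store refl (λ _ → refl) (λ _ _ → refl) μ) refl
op-sweeps input ρ (mem j [] u c a) = silent
  (inert-tabulate _ (λ _ → refl) ++ʳᵘⁿ refl ∷ʳᵘⁿ (inert (AllP.replicate⁺ j refl) ++ʳᵘⁿ []ʳᵘⁿ) ++ʳᵘⁿ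
    inert-map (mc false) (λ _ → refl) u ++ʳᵘⁿ refl ∷ʳᵘⁿ inert-map (mc false) (λ _ → refl) a) refl
op-sweeps input ρ (mem j (b ∷ q) u c a) = sweeps
  (inert-tabulate _ (λ _ → refl) ++ʳᵘⁿ refl ∷ʳᵘⁿ (inert (AllP.replicate⁺ j refl) ++ʳᵘⁿ (refl ∷ʳᵘⁿ inert-map inp (λ _ → refl) q)) ++ʳᵘⁿ
    inert-map (mc false) (λ _ → refl) u ++ʳᵘⁿ refl ∷ʳᵘⁿ inert-map (mc false) (λ _ → refl) a) refl
  -- The first unread cell has become the last of the cells already read.
  (trans (ListP.++-identityʳ _) (cong (λ z → els (marks ρ) ++ sp ∷ z ++ array u c a) (replicate-shift j)))
  where
  replicate-shift : ∀ j {xs} → replicate j sp ++ sp ∷ xs ≡ replicate (suc j) sp ++ xs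
  replicate-shift zero    = refl
  replicate-shift (suc j) = cong (sp ∷_) (replicate-shift j)
op-sweeps rewind ρ (mem j q [] c a) = silent
  (inert-tabulate _ (λ _ → refl) ++ʳᵘⁿ refl ∷ʳᵘⁿ inert-control refl (λ _ → refl) (mem j q [] c a) ++ʳᵘⁿ
    refl ∷ʳᵘⁿ inert-map (mc false) (λ _ → refl) a) refl
op-sweeps rewind ρ (mem j q (b ∷ u) c a) = sweeps
  (inert-tabulate _ (λ _ → refl) ++ʳᵘⁿ refl ∷ʳᵘⁿ inert-control refl (λ _ → refl) (mem j q (b ∷ u) c a) ++ʳᵘⁿ
    refl ∷ʳᵘⁿ inert-map (mc false) (λ _ → refl) u ++ʳᵘⁿ refl ∷ʳᵘⁿ inert-map (mc false) (λ _ → refl) a) refl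
  (trans (ListP.++-identityʳ _) (cong (λ z → els (marks ρ) ++ sp ∷ control (mem j q (b ∷ u) c a) ++ mc true b ∷ z)
    (sym (ListP.map-++ (mc false) u (c ∷ a)))))
op-sweeps adv ρ (mem j q u c []) = sweeps
  (inert-tabulate _ (λ _ → refl) ++ʳᵘⁿ refl ∷ʳᵘⁿ inert-control refl (λ _ → refl) (mem j q u c []) ++ʳᵘⁿ
    inert-map (mc false) (λ _ → refl) u ++ʳᵘⁿ refl ∷ʳᵘⁿ []ʳᵘⁿ) refl
  (trans (ListP.++-assoc (els (marks ρ)) _ _) (cong (λ z → els (marks ρ) ++ sp ∷ z)
    (trans (ListP.++-assoc (control (mem j q u c [])) _ _) (cong (control (mem j q u c []) ++_)
      (cong (_++ mc true false ∷ []) (sym (ListP.map-++ (mc false) u (c ∷ []))))))))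
op-sweeps adv ρ (mem j q u c (b ∷ a)) = sweeps
  (inert-tabulate _ (λ _ → refl) ++ʳᵘⁿ refl ∷ʳᵘⁿ inert-control refl (λ _ → refl) (mem j q u c (b ∷ a)) ++ʳᵘⁿ
    inert-map (mc false) (λ _ → refl) u ++ʳᵘⁿ refl ∷ʳᵘⁿ refl ∷ʳᵘⁿ inert-map (mc false) (λ _ → refl) a) refl
  (trans (ListP.++-identityʳ _) (cong (λ z → els (marks ρ) ++ sp ∷ control (mem j q u c (b ∷ a)) ++ z)
    (trans (sym (ListP.++-assoc (map (mc false) u) _ _)) (cong (_++ mc true b ∷ map (mc false) a) (sym (ListP.map-++ (mc false) u (c ∷ [])))))))
op-sweeps read ρ μ = silent
  (inert-tabulate _ (λ _ → refl) ++ʳᵘⁿ refl ∷ʳᵘⁿ inert-control refl (λ _ → refl) μ ++ʳᵘⁿ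
    inert-map (mc false) (λ _ → refl) (Mem.bef μ) ++ʳᵘⁿ refl ∷ʳᵘⁿ inert-map (mc false) (λ _ → refl) (Mem.aft μ)) refl
op-sweeps (write v) ρ μ = silent
  (inert-tabulate _ (λ _ → refl) ++ʳᵘⁿ refl ∷ʳᵘⁿ inert-control refl (λ _ → refl) μ ++ʳᵘⁿ
    inert-map (mc false) (λ _ → refl) (Mem.bef μ) ++ʳᵘⁿ refl ∷ʳᵘⁿ inert-map (mc false) (λ _ → refl) (Mem.aft μ)) refl

isSuc : ℕ → Bool
isSuc zero    = false
isSuc (suc _) = true

rendered : ∀ {n} → (Fin n → List Bool) → Mem → List Pay
rendered f μ = els f ++ store μ

isZero : ∀ {n} → Fin n → Bool
isZero zero    = true
isZero (suc _) = false

push-sweeps : ∀ {n} (f : Fin n → List Bool) μ → Sweeps pushSweep (rendered f μ) (isSuc n) (rendered (λ a → isZero a ∷ f a) μ)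
push-sweeps {zero}  f μ = silent (inert-store refl (λ _ → refl) (λ _ _ → refl) μ) refl
push-sweeps {suc n} f μ = silent
  (refl ∷ʳᵘⁿ (rest n (f ∘ suc) ++ʳᵘⁿ inert-store refl (λ _ → refl) (λ _ _ → refl) μ)) refl
  where
  rest : ∀ n (f : Fin n → List Bool) → Run pushStep true (els f) true (els (λ a → false ∷ f a))
  rest zero    f = []ʳᵘⁿ
  rest (suc n) f = refl ∷ʳᵘⁿ rest n (f ∘ suc)

pop-sweeps : ∀ {n} (g : Fin n → Bool) (f : Fin n → List Bool) μ → Sweeps popSweep (rendered (λ a → g a ∷ f a) μ) true (rendered f μ)
pop-sweeps g f μ = silent (rest g f ++ʳᵘⁿ inert-store refl (λ _ → refl) (λ _ _ → refl) μ) refl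
  where
  rest : ∀ {n} (g : Fin n → Bool) (f : Fin n → List Bool) → Run popStep tt (els (λ a → g a ∷ f a)) tt (els f)
  rest {zero}  g f = []ʳᵘⁿ
  rest {suc n} g f = refl ∷ʳᵘⁿ rest (g ∘ suc) (f ∘ suc)

next : ∀ {n} → Fin n → Maybe (Fin n)
next {suc zero}    zero    = nothing
next {suc (suc n)} zero    = just (suc zero)
next               (suc a) = Data.Maybe.map suc (next a)

atMaybe : ∀ {n} → Maybe (Fin n) → Fin n → Bool
atMaybe nothing  _ = false
atMaybe (just x) a = eqFin x a

afterIf : ∀ {A : Set} → Maybe A → Phase
afterIf nothing  = carry
afterIf (just _) = after

-- A pebble on the last element has nowhere to go and vanishes; the transducer then ends in `carry`,
-- which signals the end of the loop.
shift-els : ∀ {n} (x : Fin n) (f : Fin n → List Bool) →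
  Run shiftStep before (els (λ a → eqFin x a ∷ f a)) (afterIf (next x)) (els (λ a → atMaybe (next x) a ∷ f a))
shift-els {suc zero}    zero    f = refl ∷ʳᵘⁿ []ʳᵘⁿ
shift-els {suc (suc n)} zero    f = refl ∷ʳᵘⁿ refl ∷ʳᵘⁿ inert-tabulate _ (λ _ → refl)
shift-els {suc n}       (suc x) f with next x | shift-els x (f ∘ suc)
... | nothing | r = refl ∷ʳᵘⁿ r
... | just y  | r = refl ∷ʳᵘⁿ r

shift-sweeps : ∀ {n} (x : Fin n) (f : Fin n → List Bool) μ →
  Sweeps shiftSweep (rendered (λ a → eqFin x a ∷ f a) μ) (isAfter (afterIf (next x))) (rendered (λ a → atMaybe (next x) a ∷ f a) μ)
shift-sweeps x f μ = silent (shift-els x f ++ʳᵘⁿ still (next x)) refl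
  where
  still : ∀ {A : Set} (y : Maybe A) → Run shiftStep (afterIf y) (store μ) (afterIf y) (store μ)
  still nothing  = inert-store refl (λ _ → refl) (λ _ _ → refl) μ
  still (just _) = inert-store refl (λ _ → refl) (λ _ _ → refl) μ

-- The machine only knows how to pass to the next element, so `allFin` has to be presented as a
-- chain of such moves.
data Chain {n} : List (Fin n) → Set where
  last : ∀ {a} → next a ≡ nothing → Chain (a ∷ [])
  link : ∀ {a b as} → next a ≡ just b → Chain (b ∷ as) → Chain (a ∷ b ∷ as)

Chain-allFin : ∀ n → Chain (allFin (suc n))
Chain-allFin zero    = last refl
Chain-allFin (suc n) = subst Chain (cong (zero ∷_) (ListP.map-tabulate id suc)) (cons (Chain-allFin n))
  where
  sucs : ∀ {n} {as : List (Fin n)} → Chain as → Chain (map suc as)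
  sucs (last e)   = last (cong (Data.Maybe.map suc) e)
  sucs (link e c) = link (cong (Data.Maybe.map suc) e) (sucs c)
  cons : ∀ {n} → Chain (allFin (suc n)) → Chain (zero ∷ map suc (allFin (suc n)))
  cons c = link refl (sucs c)

-- Translation of programs, and the size of the tape

frag : ∀ {m} → Prog m → Frag
frag (op o)       = sweepFrag (opSweep o)
frag (ret b)      = retFrag b
frag (ite A B C)  = iteFrag (frag A) (frag B) (frag C)
frag (for P)      = Loop.loopFrag pushSweep shiftSweep popSweep popSweep (frag P)
frag (choose A B) = chooseFrag (frag A) (frag B)
frag halt         = haltFrag

space : ℕ → Mem → ℕ
space n μ = n + length (store μ)

length-rendered : ∀ {n} (f : Fin n → List Bool) μ → length (rendered f μ) ≡ space n μ
length-rendered f μ = trans (ListP.length-++ (els f)) (cong (_+ length (store μ)) (ListP.length-tabulate _))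

IsCons : List Pay → Set
IsCons ps = Σ Pay λ p → Σ (List Pay) λ ps' → ps ≡ p ∷ ps'

rendered-cons : ∀ {n} (f : Fin n → List Bool) μ → IsCons (rendered f μ)
rendered-cons {zero}  f μ = _ , _ , refl
rendered-cons {suc n} f μ = _ , _ , refl

rendered-cong : ∀ {n} {f g : Fin n → List Bool} → (∀ a → f a ≡ g a) → ∀ μ → rendered f μ ≡ rendered g μ
rendered-cong h μ = cong (_++ store μ) (ListP.tabulate-cong (λ a → cong el (h a)))

rendered-good : ∀ {V n} (f : Fin n → List Bool) μ → (∀ a → length (f a) ≤ V) → All (Good V) (rendered f μ)
rendered-good f (mem j q u c a) h = AllP.++⁺ (AllP.tabulate⁺ h)
  (tt ∷ AllP.++⁺ (AllP.++⁺ (AllP.replicate⁺ j tt) (AllP.map⁺ (All.universal (λ _ → tt) q)))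
    (AllP.++⁺ (AllP.map⁺ (All.universal (λ _ → tt) u)) (tt ∷ AllP.map⁺ (All.universal (λ _ → tt) a))))

marks-short : ∀ {n m V} (ρ : Vec (Fin n) m) → m ≤ V → ∀ a → length (marks ρ a) ≤ V
marks-short ρ h a = ≤-trans (≤-reflexive (length-marks ρ a)) h

length-store : ∀ j q u c a → length (store (mem j q u c a)) ≡ suc (j + length q + (length u + suc (length a)))
length-store j q u c a = cong suc (trans (ListP.length-++ (control (mem j q u c a)))
  (cong₂ _+_ (trans (ListP.length-++ (replicate j sp)) (cong₂ _+_ (ListP.length-replicate j) (ListP.length-map inp q)))
    (trans (ListP.length-++ (map (mc false) u)) (cong₂ (λ x y → x + suc y) (ListP.length-map _ u) (ListP.length-map _ a)))))

-- Only advancing past the end of the array lengthens the tape, and then by one cell.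
exec-size : ∀ {n m} (o : Op m) (ρ : Vec (Fin n) m) μ → space n (proj₂ (exec o ρ μ)) ≤ suc (space n μ)
exec-size {n} o ρ μ = ≤-trans (+-monoʳ-≤ n (grow o μ)) (≤-reflexive (+-suc n _))
  where
  same : ∀ {k l} → k ≡ l → k ≤ suc l
  same refl = n≤1+n _
  grow : ∀ o μ → length (store (proj₂ (exec o ρ μ))) ≤ suc (length (store μ))
  grow (cmp _ _ _) μ = n≤1+n _
  grow input (mem j [] u c a) = n≤1+n _
  grow input (mem j (b ∷ q) u c a) = same (trans (length-store (suc j) q u c a)
    (trans (cong (λ z → suc (z + (length u + suc (length a)))) (sym (+-suc j (length q)))) (sym (length-store j (b ∷ q) u c a))))
  grow rewind (mem j q [] c a) = n≤1+n _
  grow rewind (mem j q (b ∷ u) c a) = same (trans (length-store j q [] b (u ++ c ∷ a))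
    (trans (cong (λ z → suc (j + length q + suc z)) (ListP.length-++ u)) (sym (length-store j q (b ∷ u) c a))))
  grow adv (mem j q u c []) = ≤-reflexive (trans (length-store j q (u ++ c ∷ []) false [])
    (trans (cong (λ z → suc (j + length q + (z + 1))) (ListP.length-++ u))
      (trans (cong (λ z → suc z) (trans (cong (j + length q +_) (+-comm _ 1)) (+-suc (j + length q) _))) (cong suc (sym (length-store j q u c []))))))
  grow adv (mem j q u c (b ∷ a)) = same (trans (length-store j q (u ++ c ∷ []) b a)
    (trans (cong (λ z → suc (j + length q + z)) (trans (cong (_+ suc (length a)) (ListP.length-++ u)) (+-assoc (length u) 1 _)))
      (sym (length-store j q u c (b ∷ a)))))
  grow read μ = n≤1+n _
  grow (write v) (mem j q u c a) = same (trans (length-store j q u v a) (sym (length-store j q u c a)))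

-- Correctness and running time of compiled programs

module Compilation (V : ℕ) {Q : Set} (cQ : Code Q) (rule : ⊤ ⊎ Q → Sy → Act (⊤ ⊎ Q)) (B : ℕ) where
  open Execution V cQ rule public

  -- The time of one sweep on a tape that ends up with at most `B` cells.
  τ : ℕ
  τ = 2 + 2 * B

  Cfg : G → List Pay → Config M
  Cfg g ps = cfg g ps (zero ∷ [])

  module _ {n} (f : Fin n → List Bool) (μ : Mem) (good : ∀ a → length (f a) ≤ V) where

    stop-tree : ∀ {g t} → (∀ s → rule g s ≡ stop) → Tree {M} (Cfg g (rendered f μ)) 1 t
    stop-tree {g} {t} r = lem (rendered-cons f μ) (rendered-good f μ good)
      where
      lem : ∀ {ps} → IsCons ps → All (Good V) ps → Tree {M} (Cfg g ps) 1 t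
      lem (p , ps , refl) (gp ∷ _) = tree-stop {g} {cell true p} gp (r _)

    stay-tree : ∀ {g q k t} → (∀ s → rule g s ≡ go q s stay) →
      Tree {M} (Cfg q (rendered f μ)) k t → Tree {M} (Cfg g (rendered f μ)) k (suc t)
    stay-tree {g} {q} {k} {t} r = lem (rendered-cons f μ) (rendered-good f μ good)
      where
      lem : ∀ {ps} → IsCons ps → All (Good V) ps → Tree {M} (Cfg q ps) k t → Tree {M} (Cfg g ps) k (suc t)
      lem (p , ps , refl) (gp ∷ _) h = tree-go {g} {cell true p} {q} {cell true p} {stay} gp (r _) h

    split-tree : ∀ {g p q k₁ k₂ t} → (∀ s → rule g s ≡ split p q) →
      Tree {M} (Cfg p (rendered f μ)) k₁ t → Tree {M} (Cfg q (rendered f μ)) k₂ t → Tree {M} (Cfg g (rendered f μ)) (k₁ + k₂) (suc t)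
    split-tree {g} {p} {q} {k₁} {k₂} {t} r = lem (rendered-cons f μ) (rendered-good f μ good)
      where
      lem : ∀ {ps} → IsCons ps → All (Good V) ps →
        Tree {M} (Cfg p ps) k₁ t → Tree {M} (Cfg q ps) k₂ t → Tree {M} (Cfg g ps) (k₁ + k₂) (suc t)
      lem (y , ps , refl) (gp ∷ _) h₁ h₂ = tree-split {g} {cell true y} {p} {q} gp (r _) h₁ h₂

    sweep-tree : ∀ (sw : Sweep) {e x} → Embeds (sweepFrag sw) e x → ∀ f' μ' {b} → Sweeps sw (rendered f μ) b (rendered f' μ') →
      (∀ a → length (f' a) ≤ V) → space n μ' ≤ B → ∀ {k t} →
      Tree {M} (Cfg (x b) (rendered f' μ')) k t → Tree {M} (Cfg (e (Frag.entry (sweepFrag sw))) (rendered f μ)) k (τ + t)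
    sweep-tree sw {e} {x} emb f' μ' {b} s good' bound {k} {t} h = lem (rendered-cons f μ) (rendered-good f μ good) s
      where
      lem : ∀ {ps} → IsCons ps → All (Good V) ps → Sweeps sw ps b (rendered f' μ') →
        Tree {M} (Cfg (e (Frag.entry (sweepFrag sw))) ps) k (τ + t)
      lem (p , ps , refl) g s = Tree-mono (+-monoˡ-≤ t (+-monoʳ-≤ 2 (*-monoʳ-≤ 2 (≤-trans (≤-reflexive (length-rendered f' μ')) bound))))
        (sweep-correct sw emb s one g (rendered-good f' μ' good') h)

  module _ (A B C : Frag) {e x} (emb : Embeds (iteFrag A B C) e x) where

    ite-test : Embeds A (λ q → e (inj₁ q)) (λ b → e (inj₂ (if b then inj₁ (Frag.entry B) else inj₂ (Frag.entry C))))
    ite-test q s = trans (emb (inj₁ q) s) (mapAct-fuse (λ { (inj₁ _) → refl ; (inj₂ _) → refl }) (Frag.rule A q s))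

    ite-then : Embeds B (λ q → e (inj₂ (inj₁ q))) x
    ite-then q s = trans (emb (inj₂ (inj₁ q)) s) (mapAct-fuse (λ { (inj₁ _) → refl ; (inj₂ _) → refl }) (Frag.rule B q s))

    ite-else : Embeds C (λ q → e (inj₂ (inj₂ q))) x
    ite-else q s = trans (emb (inj₂ (inj₂ q)) s) (mapAct-fuse (λ { (inj₁ _) → refl ; (inj₂ _) → refl }) (Frag.rule C q s))

  module _ (A B : Frag) {e x} (emb : Embeds (chooseFrag A B) e x) where

    choose-left : Embeds A (λ q → e (inj₂ (inj₁ q))) x
    choose-left q s = trans (emb (inj₂ (inj₁ q)) s) (mapAct-fuse (λ { (inj₁ _) → refl ; (inj₂ _) → refl }) (Frag.rule A q s))

    choose-right : Embeds B (λ q → e (inj₂ (inj₂ q))) x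
    choose-right q s = trans (emb (inj₂ (inj₂ q)) s) (mapAct-fuse (λ { (inj₁ _) → refl ; (inj₂ _) → refl }) (Frag.rule B q s))

  module LoopEmbeds (init adv done break : Sweep) (P : Frag) {e x} (emb : Embeds (Loop.loopFrag init adv done break P) e x) where
    open Loop init adv done break P

    X : LoopState ⊎ Bool → G
    X = [ e , x ]

    fuse : ∀ {Q₀ : Set} {i : Q₀ → LoopState} {exit : Bool → LoopState ⊎ Bool} (a : Act (Q₀ ⊎ Bool)) →
      mapAct X (mapAct [ (λ q → inj₁ (i q)) , exit ] a) ≡ mapAct [ (λ q → e (i q)) , (λ b → X (exit b)) ] a
    fuse = mapAct-fuse (λ { (inj₁ _) → refl ; (inj₂ _) → refl })

    embI : Embeds (sweepFrag init) (λ q → e (inI q)) (λ b → X (exitI b))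
    embI q s = trans (emb (inI q) s) (fuse (I.rule q s))

    embP : Embeds P (λ q → e (inP q)) (λ b → X (exitP b))
    embP q s = trans (emb (inP q) s) (fuse (P.rule q s))

    embA : Embeds (sweepFrag adv) (λ q → e (inA q)) (λ b → X (exitA b))
    embA q s = trans (emb (inA q) s) (fuse (A.rule q s))

    embD : Embeds (sweepFrag done) (λ q → e (inD q)) (λ b → X (exitD b))
    embD q s = trans (emb (inD q) s) (fuse (D.rule q s))

    embB : Embeds (sweepFrag break) (λ q → e (inB q)) (λ b → X (exitB b))
    embB q s = trans (emb (inB q) s) (fuse (B.rule q s))

  -- Here `w` is the work still to be done. A unit of work adds at most one cell, so space plus
  -- remaining work never increases, and a single bound `B` holds for the whole run.
  record Fits (n : ℕ) (μ : Mem) (w : ℕ) : Set where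
    constructor fits-in
    field bound : space n μ + w ≤ B

  Fits-≤ : ∀ {n μ w w'} → w' ≤ w → Fits n μ w → Fits n μ w'
  Fits-≤ {n} {μ} p (fits-in h) = fits-in (≤-trans (+-monoʳ-≤ (space n μ) p) h)

  Fits-size : ∀ {n μ w} → Fits n μ w → space n μ ≤ B
  Fits-size (fits-in h) = ≤-trans (m≤m+n _ _) h

  Fits-exec : ∀ {n m} (o : Op m) (ρ : Vec (Fin n) m) {μ r} → Fits n μ (suc r) → Fits n (proj₂ (exec o ρ μ)) r
  Fits-exec {n} o ρ {μ} {r} (fits-in h) =
    fits-in (≤-trans (+-monoˡ-≤ r (exec-size o ρ μ)) (≤-trans (≤-reflexive (sym (+-suc (space n μ) r))) h))

  enough : ∀ {c k w w'} → w ≤ w' → Tree {M} c k (w * τ) → Tree {M} c k (w' * τ)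
  enough p = Tree-mono (*-monoˡ-≤ τ p)

  -- Stated in the form of `sem`: if each exit continues with a tree of `κ` within the remaining
  -- budget `r`, then the entry has a tree of `sem P κ`. Sequencing is then a plain use of the
  -- induction hypothesis, also below a fork.
  correct : ∀ {n m} (P : Prog m) {e x} → Embeds (frag P) e x → m + depth P ≤ V →
    ∀ (ρ : Vec (Fin n) m) μ κ r → Fits n μ (cost P n + r) →
    (∀ b μ' → Fits n μ' r → Tree {M} (Cfg (x b) (render ρ μ')) (κ b μ') (r * τ)) →
    Tree {M} (Cfg (e (Frag.entry (frag P))) (render ρ μ)) (sem P κ ρ μ) ((cost P n + r) * τ)
  correct {n} (op o) emb d ρ μ κ r fits h =
    sweep-tree (marks ρ) μ (marks-short ρ (m+n≤o⇒m≤o _ d)) (opSweep o) emb (marks ρ) (proj₂ (exec o ρ μ)) (op-sweeps o ρ μ) (marks-short ρ (m+n≤o⇒m≤o _ d))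
      (Fits-size (Fits-exec o ρ fits)) (h _ _ (Fits-exec o ρ fits))
  correct {n} (ret b) emb d ρ μ κ r fits h = Tree-mono (+-monoˡ-≤ (r * τ) {1} {τ} (s≤s z≤n))
    (stay-tree (marks ρ) μ (marks-short ρ (m+n≤o⇒m≤o _ d)) (λ s → emb tt s) (h b μ (Fits-≤ (n≤1+n r) fits)))
  correct {n} halt emb d ρ μ κ r fits h = stop-tree (marks ρ) μ (marks-short ρ (m+n≤o⇒m≤o _ d)) (λ s → emb tt s)
  correct {n} {m} (ite A B C) {e} {x} emb d ρ μ κ r fits h =
    enough (≤-reflexive assoc) (correct A (ite-test (frag A) (frag B) (frag C) emb) (≤-trans (+-monoʳ-≤ m (m≤m+n (depth A) _)) d) ρ μ _
      (cost B n + cost C n + r) (Fits-≤ (≤-reflexive assoc) fits) branch)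
    where
    assoc : cost A n + (cost B n + cost C n + r) ≡ cost A n + (cost B n + cost C n) + r
    assoc = sym (+-assoc (cost A n) _ r)
    b≤ : cost B n + r ≤ cost B n + cost C n + r
    b≤ = +-monoˡ-≤ r (m≤m+n _ _)
    c≤ : cost C n + r ≤ cost B n + cost C n + r
    c≤ = +-monoˡ-≤ r (m≤n+m _ (cost B n))
    branch : ∀ b μ' → Fits n μ' (cost B n + cost C n + r) →
      Tree {M} (Cfg (e (inj₂ (if b then inj₁ (Frag.entry (frag B)) else inj₂ (Frag.entry (frag C))))) (render ρ μ'))
        ((if b then sem B κ ρ else sem C κ ρ) μ') ((cost B n + cost C n + r) * τ)
    branch true  μ' f = enough b≤ (correct B (ite-then (frag A) (frag B) (frag C) emb)
      (≤-trans (+-monoʳ-≤ m (≤-trans (m≤m+n (depth B) (depth C)) (m≤n+m _ (depth A)))) d) ρ μ' κ r (Fits-≤ b≤ f) h)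
    branch false μ' f = enough c≤ (correct C (ite-else (frag A) (frag B) (frag C) emb)
      (≤-trans (+-monoʳ-≤ m (≤-trans (m≤n+m (depth C) (depth B)) (m≤n+m _ (depth A)))) d) ρ μ' κ r (Fits-≤ c≤ f) h)
  -- The fork is a single step, but it is charged as a whole sweep.
  correct {n} {m} (choose A B) emb d ρ μ κ r fits h = Tree-mono (s≤s (m≤n+m _ (τ ∸ 1)))
    (split-tree (marks ρ) μ (marks-short ρ (m+n≤o⇒m≤o _ d)) (λ s → emb (inj₁ tt) s)
      (enough a≤ (correct A (choose-left (frag A) (frag B) emb) (≤-trans (+-monoʳ-≤ m (m≤m+n (depth A) _)) d) ρ μ κ r (Fits-≤ (m≤n⇒m≤1+n a≤) fits) h))
      (enough b≤ (correct B (choose-right (frag A) (frag B) emb) (≤-trans (+-monoʳ-≤ m (m≤n+m (depth B) (depth A))) d) ρ μ κ r (Fits-≤ (m≤n⇒m≤1+n b≤) fits) h)))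
    where
    a≤ : cost A n + r ≤ cost A n + cost B n + r
    a≤ = +-monoˡ-≤ r (m≤m+n _ _)
    b≤ : cost B n + r ≤ cost A n + cost B n + r
    b≤ = +-monoˡ-≤ r (m≤n+m _ (cost A n))
  -- In an empty universe no cell carries a pebble: the push changes nothing, answers `false`, and
  -- the loop is left at once.
  correct {zero} (for P) {e} {x} emb d ρ μ κ r fits h =
    enough {w = suc r} (n≤1+n _) (sweep-tree (marks ρ) μ (λ ()) pushSweep embI (marks ρ) μ (push-sweeps (marks ρ) μ) (λ ()) (Fits-size fits)
      (h false μ (Fits-≤ (≤-trans (n≤1+n r) (n≤1+n _)) fits)))
    where open LoopEmbeds pushSweep shiftSweep popSweep popSweep (frag P) emb
  correct {suc n} {m} (for P) {e} {x} emb d ρ μ κ r fits h =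
    sweep-tree (marks ρ) μ (marks-short ρ (m+n≤o⇒m≤o m d)) pushSweep embI (marks (zero ∷ ρ)) μ
      (subst (λ z → Sweeps pushSweep (rendered (marks ρ) μ) true z) (rendered-cong (λ a → cong (_∷ marks ρ a) (zeros a)) μ) (push-sweeps (marks ρ) μ))
      (marks-short (zero ∷ ρ) m<V) (Fits-size fits)
      (enough (≤-reflexive (cong (λ l → suc l * (c + 1) + 1 + r) count))
        (loop (Chain-allFin n) μ (Fits-≤ (≤-trans (≤-reflexive (cong (λ l → suc l * (c + 1) + 1 + r) count)) (n≤1+n _)) fits)))
    where
    open LoopEmbeds pushSweep shiftSweep popSweep popSweep (frag P) emb
    open Loop pushSweep shiftSweep popSweep popSweep (frag P)
    c = cost P (suc n)
    count : length (tabulate {n = n} (λ a → id (Fin.suc a))) ≡ n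
    count = ListP.length-tabulate {n = n} (λ a → Fin.suc a)
    f : Fin (suc n) → (Bool → Mem → ℕ) → Mem → ℕ
    f a κ' = sem P κ' (a ∷ ρ)
    m<V : suc m ≤ V
    m<V = ≤-trans (≤-trans (m≤m+n (suc m) (depth P)) (≤-reflexive (sym (+-suc m (depth P))))) d
    m≤V : m ≤ V
    m≤V = ≤-trans (n≤1+n m) m<V
    zeros : ∀ {n} (a : Fin (suc n)) → isZero a ≡ eqFin zero a
    zeros zero    = refl
    zeros (suc _) = refl
    loop : ∀ {a as} → Chain (a ∷ as) → ∀ μ → Fits (suc n) μ (suc (length as) * (c + 1) + 1 + r) →
      Tree {M} (Cfg (e (inP P.entry)) (render (a ∷ ρ) μ)) (iter f (a ∷ as) κ μ) ((suc (length as) * (c + 1) + 1 + r) * τ)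
    loop {a} {as} ch μ fits = enough (≤-reflexive total)
      (correct P embP (≤-trans (≤-reflexive (sym (+-suc m (depth P)))) d) (a ∷ ρ) μ _ r' (Fits-≤ (≤-reflexive total) fits) (resume ch))
      where
      r' = suc (length as * (c + 1) + 1 + r)
      total : c + r' ≡ suc (length as) * (c + 1) + 1 + r
      total = trans (sym (+-assoc c 1 _)) (trans (cong (c + 1 +_) (+-assoc (length as * (c + 1)) 1 r))
        (trans (sym (+-assoc (c + 1) _ (1 + r))) (sym (+-assoc (c + 1 + length as * (c + 1)) 1 r))))
      r≤ : ∀ {w} → suc r ≤ w + 1 + r
      r≤ {w} = +-monoˡ-≤ r (m≤n+m 1 w)
      resume : Chain (a ∷ as) → ∀ b μ' → Fits (suc n) μ' r' →
        Tree {M} (Cfg (X (exitP b)) (render (a ∷ ρ) μ')) ((if b then κ true else iter f as κ) μ') (r' * τ)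
      resume ch true μ' fits = enough (≤-trans (r≤ {length as * (c + 1)}) (n≤1+n _))
        (sweep-tree (marks (a ∷ ρ)) μ' (marks-short (a ∷ ρ) m<V) popSweep embB (marks ρ) μ' (pop-sweeps (eqFin a) (marks ρ) μ')
          (marks-short ρ m≤V) (Fits-size fits) (h true μ' (Fits-≤ (≤-trans (n≤1+n r) (≤-trans (r≤ {length as * (c + 1)}) (n≤1+n _))) fits)))
      -- The pebble has left the universe; the top layer of marks is empty, and the second sweep
      -- removes it.
      resume (last eqn) false μ' fits =
        sweep-tree (marks (a ∷ ρ)) μ' (marks-short (a ∷ ρ) m<V) shiftSweep embA (λ b → false ∷ marks ρ b) μ'
          (subst (λ z → Sweeps shiftSweep (render (a ∷ ρ) μ') (isAfter (afterIf z)) (rendered (λ b → atMaybe z b ∷ marks ρ b) μ')) eqn (shift-sweeps a (marks ρ) μ'))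
          (λ b → s≤V (marks-short ρ ≤-refl b)) (Fits-size fits)
          (sweep-tree (λ b → false ∷ marks ρ b) μ' (λ b → s≤V (marks-short ρ ≤-refl b)) popSweep embD (marks ρ) μ' (pop-sweeps (λ _ → false) (marks ρ) μ')
            (marks-short ρ m≤V) (Fits-size fits) (h false μ' (Fits-≤ (≤-trans (n≤1+n r) (n≤1+n _)) fits)))
        where
        s≤V : ∀ {k} → k ≤ m → suc k ≤ V
        s≤V p = ≤-trans (s≤s p) m<V
      resume (link {b = a'} eqn ch) false μ' fits =
        sweep-tree (marks (a ∷ ρ)) μ' (marks-short (a ∷ ρ) m<V) shiftSweep embA (marks (a' ∷ ρ)) μ'
          (subst (λ z → Sweeps shiftSweep (render (a ∷ ρ) μ') (isAfter (afterIf z)) (rendered (λ b → atMaybe z b ∷ marks ρ b) μ')) eqn (shift-sweeps a (marks ρ) μ'))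
          (marks-short (a' ∷ ρ) m<V) (Fits-size fits)
          (loop ch μ' (Fits-≤ (n≤1+n _) fits))

-- Polynomially bounded functions

PolyBounded : (ℕ → ℕ) → Set
PolyBounded g = ∃ λ c → ∃ λ d → ∀ m → g m ≤ c * suc m ^ d

pb-const : ∀ k → PolyBounded (λ _ → k)
pb-const k = k , 0 , λ m → ≤-reflexive (sym (*-identityʳ k))

pb-id : PolyBounded (λ m → m)
pb-id = 1 , 1 , λ m → ≤-trans (n≤1+n m) (≤-reflexive (sym (trans (*-identityˡ _) (*-identityʳ (suc m)))))

pb-+ : ∀ {f g} → PolyBounded f → PolyBounded g → PolyBounded (λ m → f m + g m)
pb-+ (c , d , p) (c' , d' , p') = c + c' , d + d' , λ m → ≤-trans (+-mono-≤
  (≤-trans (p m) (*-monoʳ-≤ c (^-monoʳ-≤ (suc m) (m≤m+n d d'))))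
  (≤-trans (p' m) (*-monoʳ-≤ c' (^-monoʳ-≤ (suc m) (m≤n+m d' d)))))
  (≤-reflexive (sym (*-distribʳ-+ (suc m ^ (d + d')) c c')))

pb-* : ∀ {f g} → PolyBounded f → PolyBounded g → PolyBounded (λ m → f m * g m)
pb-* (c , d , p) (c' , d' , p') = c * c' , d + d' , λ m → ≤-trans (*-mono-≤ (p m) (p' m))
  (≤-reflexive (trans ([m*n]*[o*p]≡[m*o]*[n*p] c (suc m ^ d) c' (suc m ^ d')) (cong (c * c' *_) (sym (^-distribˡ-+-* (suc m) d d')))))

-- For m ≥ 1 the power (m+1)^d is at most 2^d m^d, whence the factor; the additive constant of
-- `polyBound` covers m = 0.
pb-polyBound : ∀ {f} → PolyBounded f → ∃ λ c → ∃ λ d → ∀ m → f m ≤ polyBound c d m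
pb-polyBound (c , d , p) = c * 2 ^ d , d , λ m → ≤-trans (p m) (bound m)
  where
  power : ∀ m d → suc (suc m) ^ d ≤ 2 ^ d * suc m ^ d
  power m zero    = ≤-refl
  power m (suc d) = ≤-trans (*-mono-≤ (s≤s (≤-trans (m≤n+m (suc m) m) (≤-reflexive (cong (m +_) (sym (+-identityʳ (suc m))))))) (power m d))
    (≤-reflexive ([m*n]*[o*p]≡[m*o]*[n*p] 2 (suc m) (2 ^ d) (suc m ^ d)))
  bound : ∀ m → c * suc m ^ d ≤ polyBound (c * 2 ^ d) d m
  bound zero    = ≤-trans (*-monoʳ-≤ c (^-monoˡ-≤ d (s≤s (z≤n {1})))) (m≤n+m _ _)
  bound (suc m) = ≤-trans (*-monoʳ-≤ c (power m d)) (≤-trans (≤-reflexive (sym (*-assoc c (2 ^ d) (suc m ^ d)))) (m≤m+n _ _))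

cost-mono : ∀ {m} (P : Prog m) {k l} → k ≤ l → cost P k ≤ cost P l
cost-mono (op o)       h = ≤-refl
cost-mono (ret b)      h = ≤-refl
cost-mono (ite A B C)  h = +-mono-≤ (cost-mono A h) (+-mono-≤ (cost-mono B h) (cost-mono C h))
cost-mono (for P)      h = s≤s (+-monoˡ-≤ 1 (*-mono-≤ h (+-monoˡ-≤ 1 (cost-mono P h))))
cost-mono (choose A B) h = s≤s (+-mono-≤ (cost-mono A h) (cost-mono B h))
cost-mono halt         h = ≤-refl

pb-cost : ∀ {m} (P : Prog m) → PolyBounded (cost P)
pb-cost (op o)       = pb-const 1
pb-cost (ret b)      = pb-const 1
pb-cost (ite A B C)  = pb-+ (pb-cost A) (pb-+ (pb-cost B) (pb-cost C))
pb-cost (for P)      = pb-+ (pb-const 1) (pb-+ (pb-* pb-id (pb-+ (pb-cost P) (pb-const 1))) (pb-const 1))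
pb-cost (choose A B) = pb-+ (pb-const 1) (pb-+ (pb-cost A) (pb-cost B))
pb-cost halt         = pb-const 1

-- Preparation of the tape

ones : List Bool → ℕ
ones []          = 0
ones (false ∷ x) = 0
ones (true ∷ x)  = suc (ones x)

-- Together with `ones` this reads any string as 1ⁿ0y. If there is no 0, then y is empty; some
-- reading is needed, as the machine has to halt on all strings.
payload : List Bool → List Bool
payload []          = []
payload (false ∷ x) = x
payload (true ∷ x)  = payload x

initial : List Bool → Mem
initial x = mem 0 (payload x) [] false []

convertStep : Bool → Pay → Bool × Pay
convertStep false (raw true)  = false , el []
convertStep false (raw false) = true , sp
-- Only the empty input leads here: the first transition of the machine puts a separator on its
-- blank cell.
convertStep false sp          = true , sp
convertStep true  (raw b)     = true , inp b
convertStep s     p           = s , p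

convertEnd : Bool → Maybe Pay × Bool
-- No 0 has been seen, so the separator after the universe is still missing.
convertEnd false = just sp , true
convertEnd true  = nothing , true

convertSweep appendSweep : Sweep
convertSweep = record { cS = Bool-code ; s₀ = false ; step = convertStep ; fin = convertEnd }
appendSweep  = record { cS = ⊤-code ; s₀ = tt ; step = _,_ ; fin = λ _ → just (mc true false) , true }

source : List Bool → List Pay
source []      = sp ∷ []
source (b ∷ x) = raw b ∷ map raw x

converted : List Bool → List Pay
converted x = els {ones x} (λ _ → []) ++ sp ∷ map inp (payload x)

convert-sweeps : ∀ x → Sweeps convertSweep (source x) true (converted x)
convert-sweeps []      = sweeps (refl ∷ʳᵘⁿ []ʳᵘⁿ) refl refl
convert-sweeps (b ∷ x) = convert (b ∷ x)
  where
  ending : ∀ y → Run convertStep true (map raw y) true (map inp y)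
  ending []      = []ʳᵘⁿ
  ending (b ∷ y) = refl ∷ʳᵘⁿ ending y
  convert : ∀ x → Sweeps convertSweep (map raw x) true (converted x)
  convert []          = sweeps []ʳᵘⁿ refl refl
  convert (false ∷ x) = sweeps (refl ∷ʳᵘⁿ ending x) refl (ListP.++-identityʳ _)
  convert (true ∷ x)  with convert x
  ... | sweeps r e p  = sweeps (refl ∷ʳᵘⁿ r) e (cong (el [] ∷_) p)

startTape : List Bool → List Pay
startTape x = render {ones x} [] (initial x)

append-sweeps : ∀ x → Sweeps appendSweep (converted x) true (startTape x)
append-sweeps x = sweeps (inert (All.universal (λ _ → refl) (converted x))) refl (ListP.++-assoc (els {ones x} (λ _ → [])) _ _)

ones-payload : ∀ x → ones x + length (payload x) ≤ length x
ones-payload []          = z≤n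
ones-payload (false ∷ x) = n≤1+n _
ones-payload (true ∷ x)  = s≤s (ones-payload x)

-- The machine of a closed program

module Realization (P : Prog 0) where

  F₀ F₁ F₂ : Frag
  F₀ = iteFrag (frag P) haltFrag haltFrag
  F₁ = iteFrag (sweepFrag appendSweep) F₀ haltFrag
  F₂ = iteFrag (sweepFrag convertSweep) F₁ haltFrag

  State₂ : Set
  State₂ = Frag.Q F₂

  rule : ⊤ ⊎ State₂ → Sy → Act (⊤ ⊎ State₂)
  rule (inj₁ _) blk        = go (inj₂ (Frag.entry F₂)) (cell true sp) stay
  rule (inj₁ _) (cell _ p) = go (inj₂ (Frag.entry F₂)) (cell true p) stay
  rule (inj₂ q) s          = mapAct [ inj₂ , (λ _ → inj₁ tt) ] (Frag.rule F₂ q s)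

  V : ℕ
  V = depth P

  -- The prepared tape has at most N + 2 cells, because a separator and a first array cell may have
  -- been added; the cost bounds all later growth.
  bound : ℕ → ℕ
  bound N = N + 2 + cost P N

  -- One step flags the first cell, two sweeps prepare the tape, and then each unit of cost is a
  -- sweep on at most `bound N` cells.
  time : ℕ → ℕ
  time N = 1 + ((2 + 2 * (N + 1)) + ((2 + 2 * (N + 2)) + cost P N * (2 + 2 * bound N)))

  pb-time : PolyBounded time
  pb-time = pb-+ (pb-const 1) (pb-+ (pb-+ (pb-const 2) (pb-* (pb-const 2) (pb-+ pb-id (pb-const 1))))
    (pb-+ (pb-+ (pb-const 2) (pb-* (pb-const 2) (pb-+ pb-id (pb-const 2))))
      (pb-* (pb-cost P) (pb-+ (pb-const 2) (pb-* (pb-const 2) (pb-+ (pb-+ pb-id (pb-const 2)) (pb-cost P)))))))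

  open Machine V (Frag.cQ F₂) rule using (M; cG; encCell)

  value : List Bool → ℕ
  value x = sem {ones x} P (λ _ _ → 1) [] (initial x)

  tree : ∀ x → Tree {M} (initConfig M x) (value x) (time (length x))
  tree x = begin x
    where
    N = length x
    open Compilation V (Frag.cQ F₂) rule (bound N) hiding (M; cG; encCell)

    embA : Embeds (sweepFrag appendSweep) _ _
    embA = ite-test (sweepFrag appendSweep) F₀ haltFrag (ite-then (sweepFrag convertSweep) F₁ haltFrag (λ q s → refl))
    embF₀ : Embeds F₀ (λ q → inj₂ (inj₂ (inj₁ (inj₂ (inj₁ q))))) (λ _ → inj₁ tt)
    embF₀ = ite-then (sweepFrag appendSweep) F₀ haltFrag (ite-then (sweepFrag convertSweep) F₁ haltFrag (λ q s → refl))

    fits : Fits (ones x) (initial x) (cost P (ones x) + 0)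
    fits = fits-in (+-mono-≤ sz (≤-trans (≤-reflexive (+-identityʳ _)) (cost-mono P (≤-trans (m≤m+n _ _) (ones-payload x)))))
      where
      sz : space (ones x) (initial x) ≤ N + 2
      sz = ≤-trans (≤-reflexive (trans (cong (ones x +_) (trans (length-store 0 (payload x) [] false []) (sym (+-suc (length (payload x)) 1))))
        (sym (+-assoc (ones x) (length (payload x)) 2)))) (+-monoˡ-≤ 2 (ones-payload x))

    good₁ : All (Good V) (converted x)
    good₁ = AllP.++⁺ (AllP.tabulate⁺ {n = ones x} (λ _ → z≤n)) (tt ∷ AllP.map⁺ (All.universal (λ _ → tt) (payload x)))

    length₁ : length (converted x) ≤ N + 1
    length₁ = ≤-trans (≤-reflexive (trans (ListP.length-++ (els {ones x} (λ _ → [])))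
      (trans (cong₂ _+_ (ListP.length-tabulate {n = ones x} _) (trans (cong suc (ListP.length-map inp (payload x))) (+-comm 1 _)))
        (sym (+-assoc (ones x) _ 1))))) (+-monoˡ-≤ 1 (ones-payload x))

    program : Tree {M} (Cfg (inj₂ (inj₂ (inj₁ (inj₂ (inj₁ (Frag.entry F₀)))))) (startTape x)) (value x) (cost P N * τ)
    program = Tree-mono (*-monoˡ-≤ τ (≤-trans (≤-reflexive (+-identityʳ _)) (cost-mono P (≤-trans (m≤m+n _ _) (ones-payload x)))))
      (correct P (ite-test (frag P) haltFrag haltFrag embF₀) ≤-refl ([] {A = Fin (ones x)}) (initial x) (λ _ _ → 1) 0 fits
        (λ { true μ' _ → stop-tree (λ _ → []) μ' (λ _ → z≤n) (λ s → ite-then (frag P) haltFrag haltFrag embF₀ tt s)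
           ; false μ' _ → stop-tree (λ _ → []) μ' (λ _ → z≤n) (λ s → ite-else (frag P) haltFrag haltFrag embF₀ tt s) }))

    appended : ∀ {ps} → ps ≡ converted x → All (Good V) ps →
      Tree {M} (Cfg (inj₂ (inj₂ (inj₁ (Frag.entry F₁)))) ps) (value x) ((2 + 2 * (N + 2)) + cost P N * τ)
    appended {[]} e g = ⊥-elim (absurd (ones x) e)
      where
      absurd : ∀ n → ¬ [] ≡ els {n} (λ _ → []) ++ sp ∷ map inp (payload x)
      absurd zero ()
      absurd (suc n) ()
    appended {p ∷ ps} e g = Tree-mono (+-monoˡ-≤ _ (+-monoʳ-≤ 2 (*-monoʳ-≤ 2 len)))
      (sweep-correct appendSweep embA (subst (λ z → Sweeps appendSweep z true (startTape x)) (sym e) (append-sweeps x)) one g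
        (rendered-good {V} {ones x} (λ _ → []) (initial x) (λ _ → z≤n)) program)
      where
      len : length (startTape x) ≤ N + 2
      len = ≤-trans (≤-reflexive (trans (cong length (sym (Sweeps.result (append-sweeps x)))) (trans (ListP.length-++ (converted x)) refl)))
        (≤-trans (+-monoˡ-≤ 1 length₁) (≤-reflexive (+-assoc N 1 1)))

    convert : ∀ {p ps} → source x ≡ p ∷ ps → Good V p → All (Good V) ps →
      Tree {M} (at (inj₂ (Frag.entry F₂)) [] (cell true p) (cells ps))  (value x) ((2 + 2 * (N + 1)) + ((2 + 2 * (N + 2)) + cost P N * τ))
    convert {p} {ps} e g gs = Tree-mono (+-monoˡ-≤ _ (+-monoʳ-≤ 2 (*-monoʳ-≤ 2 length₁)))
      (subst (λ r → Tree {M} (at (inj₂ (Frag.entry F₂)) [] (cell true p) r) (value x) _) (ListP.++-identityʳ (cells ps))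
        (sweep-correct convertSweep (ite-test (sweepFrag convertSweep) F₁ haltFrag (λ q s → refl))
          (subst (λ z → Sweeps convertSweep z true (converted x)) e (convert-sweeps x)) none (g ∷ gs) good₁ (appended refl good₁)))

    inputs : ∀ y → map (inputSym {M}) y ≡ cells (map raw y)
    inputs []          = refl
    inputs (false ∷ y) = cong (_ ∷_) (inputs y)
    inputs (true ∷ y)  = cong (_ ∷_) (inputs y)

    first : ∀ b → inputSym {M} b ≡ encCell false (raw b)
    first false = refl
    first true  = refl

    begin : ∀ y → {{y ≡ x}} → Tree {M} (initConfig M y) (value x) (time N)
    begin [] {{e}} = tree-go {inj₁ tt} {blk} {inj₂ (Frag.entry F₂)} {cell true sp} {stay} {[]} {[]} tt refl
      (convert (cong source (sym e)) tt [])
    begin (b ∷ y) {{e}} = subst₂ (λ s r → Tree {M} (conf zero [] s r) (value x) (time N)) (sym (first b)) (sym (inputs y))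
      (tree-go {inj₁ tt} {cell false (raw b)} {inj₂ (Frag.entry F₂)} {cell true (raw b)} {stay} {[]} {cells (map raw y)} tt refl
        (convert (cong source (sym e)) tt (AllP.map⁺ (All.universal (λ _ → tt) y))))

realize : (P : Prog 0) → Σ NTM λ M → Σ ℕ λ c → Σ ℕ λ d → RunsInTime M c d ×
  (∀ x → tot M c d x ≡ sem {ones x} P (λ _ _ → 1) [] (initial x) ∸ 1)
realize P = let open Realization P in let (c , d , p) = pb-polyBound pb-time in
  Machine.M V (Frag.cQ F₂) rule , c , d ,
  (λ x → Tree⇒HaltsWithin (Tree-mono (p (length x)) (tree x))) ,
  (λ x → cong (_∸ 1) (Tree⇒paths (Tree-mono (p (length x)) (tree x))))

-- Continuations up to pointwise equality

Cont : Set
Cont = Bool → Mem → ℕ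

_≗ᶜ_ : Cont → Cont → Set
κ ≗ᶜ κ' = ∀ b μ → κ b μ ≡ κ' b μ

branch-cong : ∀ {κ₁ κ₂ κ₁' κ₂' : Mem → ℕ} → (∀ μ → κ₁ μ ≡ κ₁' μ) → (∀ μ → κ₂ μ ≡ κ₂' μ) →
  (λ b → if b then κ₁ else κ₂) ≗ᶜ (λ b → if b then κ₁' else κ₂')
branch-cong h h' true  = h
branch-cong h h' false = h'

-- Iteration over lists

module _ {A : Set} where

  Body : Set
  Body = A → Cont → Mem → ℕ

  Extensional : Body → Set
  Extensional f = ∀ a {κ κ'} → κ ≗ᶜ κ' → ∀ μ → f a κ μ ≡ f a κ' μ

  iter-ext : ∀ {f : Body} → Extensional f → ∀ as {κ κ'} → κ ≗ᶜ κ' → ∀ μ → iter f as κ μ ≡ iter f as κ' μ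
  iter-ext e []       h μ = h false μ
  iter-ext e (a ∷ as) h μ = e a (branch-cong (h true) (iter-ext e as h)) μ

  iter-cong : ∀ {f g : Body} → Extensional f → (∀ a κ μ → f a κ μ ≡ g a κ μ) → ∀ as κ μ → iter f as κ μ ≡ iter g as κ μ
  iter-cong e h []       κ μ = refl
  iter-cong e h (a ∷ as) κ μ = trans (e a (branch-cong (λ _ → refl) (iter-cong e h as κ)) μ) (h a _ μ)

  iter-++ : ∀ {f : Body} → Extensional f → ∀ as bs κ μ →
    iter f (as ++ bs) κ μ ≡ iter f as (λ b → if b then κ true else iter f bs κ) μ
  iter-++ e []       bs κ μ = refl
  iter-++ e (a ∷ as) bs κ μ = e a (branch-cong (λ _ → refl) (iter-++ e as bs κ)) μ

iter-map : ∀ {A B : Set} {f : Body {B}} → Extensional f → ∀ (h : A → B) as κ μ → iter f (map h as) κ μ ≡ iter (λ a → f (h a)) as κ μ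
iter-map e h []       κ μ = refl
iter-map e h (a ∷ as) κ μ = e (h a) (branch-cong (λ _ → refl) (iter-map e h as κ)) μ

iter-concatMap : ∀ {A B : Set} {f : Body {B}} → Extensional f → ∀ (g : A → List B) as κ μ →
  iter f (concatMap g as) κ μ ≡ iter (λ a → iter f (g a)) as κ μ
iter-concatMap e g []       κ μ = refl
iter-concatMap e g (a ∷ as) κ μ = trans (iter-++ e (g a) _ κ μ) (iter-ext e (g a) (branch-cong (λ _ → refl) (iter-concatMap e g as κ)) μ)

sem-ext : ∀ {n m} (P : Prog m) {κ κ'} (ρ : Vec (Fin n) m) → κ ≗ᶜ κ' → ∀ μ → sem P κ ρ μ ≡ sem P κ' ρ μ
sem-ext (op o)       ρ h μ = h _ _
sem-ext (ret b)      ρ h μ = h b μ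
sem-ext (ite A B C)  ρ h μ = sem-ext A ρ (branch-cong (sem-ext B ρ h) (sem-ext C ρ h)) μ
sem-ext (for P)      ρ h μ = iter-ext (λ a → sem-ext P (a ∷ ρ)) (allFin _) h μ
sem-ext (choose A B) ρ h μ = cong₂ _+_ (sem-ext A ρ h μ) (sem-ext B ρ h μ)
sem-ext halt         ρ h μ = refl

seq : ∀ {m} → Prog m → Prog m → Prog m
seq A B = ite A B B

anyOf : ∀ {m} → List (Prog m) → Prog m
anyOf []       = ret false
anyOf (P ∷ Ps) = ite P (ret true) (anyOf Ps)

sem-anyOf : ∀ {n m} {A : Set} (P : A → Prog m) as κ (ρ : Vec (Fin n) m) μ →
  sem (anyOf (map P as)) κ ρ μ ≡ iter (λ a κ' → sem (P a) κ' ρ) as κ μ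
sem-anyOf P []       κ ρ μ = refl
sem-anyOf P (a ∷ as) κ ρ μ = sem-ext (P a) ρ (branch-cong (λ _ → refl) (sem-anyOf P as κ ρ)) μ

-- Nested loops over tuples, in the order of allTuples: a context of k variables pushed one by one

infixr 5 _⊕_ _⊕ᵛ_

_⊕_ : ℕ → ℕ → ℕ
zero  ⊕ m = m
suc k ⊕ m = k ⊕ suc m

_⊕ᵛ_ : ∀ {A : Set} {k m} → Vec A k → Vec A m → Vec A (k ⊕ m)
[]      ⊕ᵛ ρ = ρ
(a ∷ t) ⊕ᵛ ρ = t ⊕ᵛ (a ∷ ρ)

wk : ∀ k {m} → Fin m → Fin (k ⊕ m)
wk zero    i = i
wk (suc k) i = wk k (suc i)

-- The component pushed first lies deepest in the context; this reads the tuple back in its original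
-- order.
tupleVars : ∀ k {m} → Vec (Fin (k ⊕ m)) k
tupleVars zero    = []
tupleVars (suc k) = wk k zero ∷ tupleVars k

lookup-wk : ∀ {A : Set} {k m} (t : Vec A k) (ρ : Vec A m) i → lookup (t ⊕ᵛ ρ) (wk k i) ≡ lookup ρ i
lookup-wk []      ρ i = refl
lookup-wk (a ∷ t) ρ i = lookup-wk t (a ∷ ρ) (suc i)

lookups-wk : ∀ {n k m l} (t : Vec (Fin n) k) (ρ : Vec (Fin n) m) (xs : Vec (Fin m) l) →
  lookups (t ⊕ᵛ ρ) (Vec.map (wk k) xs) ≡ lookups ρ xs
lookups-wk t ρ []       = refl
lookups-wk t ρ (x ∷ xs) = cong₂ _∷_ (lookup-wk t ρ x) (lookups-wk t ρ xs)

lookups-tupleVars : ∀ {n k m} (t : Vec (Fin n) k) (ρ : Vec (Fin n) m) → lookups (t ⊕ᵛ ρ) (tupleVars k) ≡ t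
lookups-tupleVars []      ρ = refl
lookups-tupleVars (a ∷ t) ρ = cong₂ _∷_ (lookup-wk t (a ∷ ρ) zero) (lookups-tupleVars t (a ∷ ρ))

nest : ∀ k {m} → Prog (k ⊕ m) → Prog m
nest zero    P = P
nest (suc k) P = for (nest k P)

sem-nest : ∀ {n} k {m} (P : Prog (k ⊕ m)) κ (ρ : Vec (Fin n) m) μ →
  sem (nest k P) κ ρ μ ≡ iter (λ t κ' → sem P κ' (t ⊕ᵛ ρ)) (allTuples n k) κ μ
sem-nest zero    P κ ρ μ = sem-ext P ρ (λ { true μ → refl ; false μ → refl }) μ
sem-nest (suc k) P κ ρ μ = trans
  (iter-cong (λ a → sem-ext (nest k P) (a ∷ ρ))
    (λ a κ' μ' → trans (sem-nest k P κ' (a ∷ ρ) μ') (sym (iter-map (λ t → sem-ext P (t ⊕ᵛ ρ)) (a ∷_) (allTuples _ k) κ' μ')))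
    (allFin _) κ μ)
  (sym (iter-concatMap (λ t → sem-ext P (t ⊕ᵛ ρ)) (λ a → map (a ∷_) (allTuples _ k)) (allFin _) κ μ))

∈-allTuples : ∀ {n k} (t : Vec (Fin n) k) → t ∈ allTuples n k
∈-allTuples []      = here refl
∈-allTuples (a ∷ t) = MemP.∈-concatMap⁺ _ (Any.map (λ { refl → MemP.∈-map⁺ (a ∷_) (∈-allTuples t) }) (MemP.∈-allFin a))

-- Deterministic executions

Runs : (Cont → Mem → ℕ) → Mem → (Bool → Mem → Set) → Set
Runs F μ Post = Σ Bool λ b → Σ Mem λ μ' → (∀ κ → F κ μ ≡ κ b μ') × Post b μ'

-- A Hoare triple for programs that do not branch: there is one end for all continuations, and
-- `Post` speaks about the answer and the memory at this end.
record Does {n m} (P : Prog m) (ρ : Vec (Fin n) m) (μ : Mem) (Post : Bool → Mem → Set) : Set where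
  constructor does-by
  field runs : Runs (λ κ → sem P κ ρ) μ Post
open Does public

does-imp : ∀ {n m} {P : Prog m} {ρ : Vec (Fin n) m} {μ} {Post Post' : Bool → Mem → Set} →
  (∀ b μ' → Post b μ' → Post' b μ') → Does P ρ μ Post → Does P ρ μ Post'
does-imp h (does-by (b , μ' , e , p)) = does-by (b , μ' , e , h b μ' p)

does-ret : ∀ {n m} b {ρ : Vec (Fin n) m} {μ} {Post : Bool → Mem → Set} → Post b μ → Does (ret b) ρ μ Post
does-ret b p = does-by (b , _ , (λ _ → refl) , p)

does-op : ∀ {n m} (o : Op m) {ρ : Vec (Fin n) m} {μ} {Post : Bool → Mem → Set} →
  Post (proj₁ (exec o ρ μ)) (proj₂ (exec o ρ μ)) → Does (op o) ρ μ Post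
does-op o p = does-by (_ , _ , (λ _ → refl) , p)

does-ite : ∀ {n m} {A B C : Prog m} {ρ : Vec (Fin n) m} {μ Mid Post} → Does A ρ μ Mid →
  (∀ μ' → Mid true μ' → Does B ρ μ' Post) → (∀ μ' → Mid false μ' → Does C ρ μ' Post) → Does (ite A B C) ρ μ Post
does-ite (does-by (true  , μ' , e , p)) h h' with h μ' p
... | does-by (b , μ'' , e' , q) = does-by (b , μ'' , (λ κ → trans (e _) (e' κ)) , q)
does-ite (does-by (false , μ' , e , p)) h h' with h' μ' p
... | does-by (b , μ'' , e' , q) = does-by (b , μ'' , (λ κ → trans (e _) (e' κ)) , q)

does-seq : ∀ {n m} {A B : Prog m} {ρ : Vec (Fin n) m} {μ Mid Post} → Does A ρ μ (λ _ → Mid) →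
  (∀ μ' → Mid μ' → Does B ρ μ' Post) → Does (seq A B) ρ μ Post
does-seq d h = does-ite d h h

-- The invariant Inv speaks about the elements still to be visited, Q holds after a break.
module _ {A : Set} {f : Body {A}} where

  runs-iter : (Inv : List A → Mem → Set) (Q : Mem → Set) →
    (∀ a as μ → Inv (a ∷ as) μ → Runs (f a) μ (λ b μ' → if b then Q μ' else Inv as μ')) →
    ∀ as μ → Inv as μ → Runs (iter f as) μ (λ b μ' → if b then Q μ' else Inv [] μ')
  runs-iter Inv Q h []       μ i = false , μ , (λ _ → refl) , i
  runs-iter Inv Q h (a ∷ as) μ i with h a as μ i
  ... | true  , μ' , eqn , p = true , μ' , (λ κ → eqn (λ b → if b then κ true else iter f as κ)) , p
  ... | false , μ' , eqn , p with runs-iter Inv Q h as μ' p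
  ...   | b , μ'' , eqn' , p' = b , μ'' , (λ κ → trans (eqn (λ b → if b then κ true else iter f as κ)) (eqn' κ)) , p'

  runs-any : (I : Mem → Set) (g : A → Bool) →
    (∀ a μ → I μ → Runs (f a) μ (λ b μ' → b ≡ g a × I μ')) →
    ∀ as μ → I μ → Runs (iter f as) μ (λ b μ' → b ≡ any g as × I μ')
  runs-any I g h []       μ i = false , μ , (λ _ → refl) , refl , i
  runs-any I g h (a ∷ as) μ i with g a | h a μ i
  ... | true  | true  , μ' , eqn , refl , p = true , μ' , (λ κ → eqn (λ b → if b then κ true else iter f as κ)) , refl , p
  ... | false | false , μ' , eqn , refl , p with runs-any I g h as μ' p
  ...   | b , μ'' , eqn' , p' = b , μ'' , (λ κ → trans (eqn (λ b → if b then κ true else iter f as κ)) (eqn' κ)) , p'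

-- Random access to arrays of bits. An array is addressed by tuples; T arrays with tags in Fin T are interleaved.

headPos : Mem → ℕ
headPos μ = length (Mem.bef μ)

abstract
  bit : Mem → ℕ → Bool
  bit μ = nth (Mem.bef μ ++ Mem.cur μ ∷ Mem.aft μ)

record Same (μ μ' : Mem) : Set where
  constructor same
  field
    bits  : ∀ i → bit μ' i ≡ bit μ i
    queue : Mem.inq μ' ≡ Mem.inq μ

same-refl : ∀ {μ} → Same μ μ
same-refl = same (λ _ → refl) refl

same-trans : ∀ {μ μ' μ''} → Same μ μ' → Same μ' μ'' → Same μ μ''
same-trans (same b i) (same b' i') = same (λ k → trans (b' k) (b k)) (trans i' i)

abstract
  toStart-same : ∀ μ → Same μ (toStart μ)
  toStart-same (mem j q []      c a) = same-refl
  toStart-same (mem j q (b ∷ u) c a) = same (λ _ → refl) refl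

  readInput-bits : ∀ μ i → bit (proj₂ (readInput μ)) i ≡ bit μ i
  readInput-bits (mem j []      u c a) i = refl
  readInput-bits (mem j (b ∷ q) u c a) i = refl

  -- Positions beyond the array read as `false`, and so do newly created cells. The array thus
  -- behaves as if it were infinite.
  advance-same : ∀ μ → Same μ (advance μ)
  advance-same (mem j q u c []) = same
    (λ i → trans (cong (λ z → nth z i) (ListP.++-assoc u (c ∷ []) (false ∷ []))) (pad u i)) refl
    where
    nil : ∀ i → nth (false ∷ []) i ≡ false
    nil zero    = refl
    nil (suc i) = refl
    pad : ∀ u i → nth (u ++ c ∷ false ∷ []) i ≡ nth (u ++ c ∷ []) i
    pad []      zero    = refl
    pad []      (suc i) = nil i
    pad (b ∷ u) zero    = refl
    pad (b ∷ u) (suc i) = pad u i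
  advance-same (mem j q u c (b ∷ a)) = same (λ i → cong (λ z → nth z i) (ListP.++-assoc u (c ∷ []) (b ∷ a))) refl

  cur-bit : ∀ μ → Mem.cur μ ≡ bit μ (headPos μ)
  cur-bit (mem j q u c a) = lem u
    where
    lem : ∀ u → c ≡ nth (u ++ c ∷ a) (length u)
    lem []      = refl
    lem (_ ∷ u) = lem u

  put-other : ∀ v μ i → i ≢ headPos μ → bit (put v μ) i ≡ bit μ i
  put-other v (mem j q u c a) i h = lem u i h
    where
    lem : ∀ u i → i ≢ length u → nth (u ++ v ∷ a) i ≡ nth (u ++ c ∷ a) i
    lem []      zero    h = ⊥-elim (h refl)
    lem []      (suc i) h = refl
    lem (_ ∷ u) zero    h = refl
    lem (_ ∷ u) (suc i) h = lem u i (h ∘ cong suc)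

advances : ℕ → Mem → Mem
advances zero    μ = μ
advances (suc k) μ = advances k (advance μ)

advances-+ : ∀ k l μ → advances l (advances k μ) ≡ advances (k + l) μ
advances-+ zero    l μ = refl
advances-+ (suc k) l μ = advances-+ k l (advance μ)

toStart-pos : ∀ μ → headPos (toStart μ) ≡ 0
toStart-pos (mem j q []      c a) = refl
toStart-pos (mem j q (b ∷ u) c a) = refl

advance-pos : ∀ μ → headPos (advance μ) ≡ suc (headPos μ)
advance-pos (mem j q u c [])      = trans (ListP.length-++ u) (+-comm _ 1)
advance-pos (mem j q u c (b ∷ a)) = trans (ListP.length-++ u) (+-comm _ 1)

advances-same : ∀ k μ → Same μ (advances k μ)
advances-same zero    μ = same-refl
advances-same (suc k) μ = same-trans (advance-same μ) (advances-same k (advance μ))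

advances-pos : ∀ k μ → headPos (advances k μ) ≡ k + headPos μ
advances-pos zero    μ = refl
advances-pos (suc k) μ = trans (advances-pos k (advance μ)) (trans (cong (k +_) (advance-pos μ)) (+-suc k _))

_≟ᵗ_ : ∀ {n k} (t u : Vec (Fin n) k) → Dec (t ≡ u)
_≟ᵗ_ = VecP.≡-dec FinP._≟_

eqTuple : ∀ {n k} → Vec (Fin n) k → Vec (Fin n) k → Bool
eqTuple t u = does (t ≟ᵗ u)

eqFin-does : ∀ {n} (x y : Fin n) → eqFin x y ≡ does (x FinP.≟ y)
eqFin-does zero    zero    = refl
eqFin-does zero    (suc y) = refl
eqFin-does (suc x) zero    = refl
eqFin-does (suc x) (suc y) = eqFin-does x y

allEqual : ∀ {m k} → Vec (Fin m) k → Vec (Fin m) k → Prog m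
allEqual []       []       = ret true
allEqual (x ∷ xs) (y ∷ ys) = ite (op (cmp true x y)) (allEqual xs ys) (ret false)

sem-allEqual : ∀ {n m k} (xs ys : Vec (Fin m) k) κ (ρ : Vec (Fin n) m) μ →
  sem (allEqual xs ys) κ ρ μ ≡ κ (eqTuple (lookups ρ xs) (lookups ρ ys)) μ
sem-allEqual []       []       κ ρ μ = refl
sem-allEqual (x ∷ xs) (y ∷ ys) κ ρ μ rewrite eqFin-does (lookup ρ x) (lookup ρ y) with lookup ρ x FinP.≟ lookup ρ y
... | no _  = refl
... | yes _ = sem-allEqual xs ys κ ρ μ

index : ∀ {n k} → List (Vec (Fin n) k) → Vec (Fin n) k → ℕ
index []       x = 0
index (t ∷ ts) x = if eqTuple t x then 0 else suc (index ts x)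

index-injective : ∀ {n k} (ts : List (Vec (Fin n) k)) {x y} → x ∈ ts → y ∈ ts → index ts x ≡ index ts y → x ≡ y
index-injective (t ∷ ts) {x} {y} i j e with t ≟ᵗ x | t ≟ᵗ y
... | yes p | yes q = trans (sym p) q
... | yes p | no q with () ← e
... | no p  | yes q with () ← e
... | no p  | no q  = index-injective ts (tail p i) (tail q j) (suc-injective e)
  where
  tail : ∀ {z} → ¬ t ≡ z → z ∈ t ∷ ts → z ∈ ts
  tail h = ∈-tail (h ∘ sym)

module Access (T : ℕ) where

  skip : ∀ {m} → ℕ → Prog m
  skip zero    = ret false
  skip (suc k) = seq (op adv) (skip k)

  sem-skip : ∀ {n m} k κ (ρ : Vec (Fin n) m) μ → sem (skip k) κ ρ μ ≡ κ false (advances k μ)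
  sem-skip zero    κ ρ μ = refl
  sem-skip (suc k) κ ρ μ = sem-skip k κ ρ (advance μ)

  probe : ∀ {m} k → Vec (Fin m) k → Prog (k ⊕ m)
  probe k xs = ite (allEqual (tupleVars k) (Vec.map (wk k) xs)) (ret true) (skip T)

  sem-probe : ∀ {n m k} (xs : Vec (Fin m) k) t κ (ρ : Vec (Fin n) m) μ →
    sem (probe k xs) κ (t ⊕ᵛ ρ) μ ≡ (if eqTuple t (lookups ρ xs) then κ true μ else κ false (advances T μ))
  sem-probe {k = k} xs t κ ρ μ = trans (sem-allEqual (tupleVars k) _ _ (t ⊕ᵛ ρ) μ)
    (trans (cong₂ (λ x y → (if eqTuple x y then κ true else sem (skip T) κ (t ⊕ᵛ ρ)) μ) (lookups-tupleVars t ρ) (lookups-wk t ρ xs))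
      (lem (eqTuple t (lookups ρ xs))))
    where
    lem : ∀ b → (if b then κ true else sem (skip T) κ (t ⊕ᵛ ρ)) μ ≡ (if b then κ true μ else κ false (advances T μ))
    lem true  = refl
    lem false = sem-skip T κ (t ⊕ᵛ ρ) μ

  -- There is no address register: the loop over all tuples breaks at the sought one, after the head
  -- has advanced `T` cells for each tuple before it.
  access : ∀ {m k} → Fin T → Vec (Fin m) k → Prog m
  access {k = k} tag xs = seq (op rewind) (seq (nest k (probe k xs)) (skip (toℕ tag)))

  address : ∀ {n k} → Fin T → Vec (Fin n) k → ℕ
  address {n} {k} tag t = index (allTuples n k) t * T + toℕ tag

  find : ∀ {n m k} (xs : Vec (Fin m) k) (ρ : Vec (Fin n) m) ts → lookups ρ xs ∈ ts → ∀ κ μ →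
    iter (λ t κ' → sem (probe k xs) κ' (t ⊕ᵛ ρ)) ts κ μ ≡ κ true (advances (index ts (lookups ρ xs) * T) μ)
  find xs ρ (t ∷ ts) i κ μ = trans (sem-probe xs t _ ρ μ) (lem (t ≟ᵗ lookups ρ xs))
    where
    lem : (d : Dec (t ≡ lookups ρ xs)) → (if does d then κ true μ else iter (λ t κ' → sem (probe _ xs) κ' (t ⊕ᵛ ρ)) ts κ (advances T μ))
      ≡ κ true (advances ((if does d then 0 else suc (index ts (lookups ρ xs))) * T) μ)
    lem (yes p) = refl
    lem (no p)  = trans (find xs ρ ts (∈-tail (p ∘ sym) i) κ (advances T μ)) (cong (κ true) (advances-+ T _ μ))

  goto : ℕ → Mem → Mem
  goto a μ = advances a (toStart μ)

  sem-access : ∀ {n m k} tag (xs : Vec (Fin m) k) κ (ρ : Vec (Fin n) m) μ →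
    sem (access tag xs) κ ρ μ ≡ κ false (goto (address tag (lookups ρ xs)) μ)
  sem-access {k = k} tag xs κ ρ μ = trans (sem-nest k (probe k xs) _ ρ (toStart μ))
    (trans (find xs ρ (allTuples _ k) (∈-allTuples _) _ (toStart μ))
      (trans (sem-skip (toℕ tag) κ ρ _) (cong (κ false) (advances-+ (index (allTuples _ k) (lookups ρ xs) * T) (toℕ tag) (toStart μ)))))

  goto-same : ∀ a μ → Same μ (goto a μ)
  goto-same a μ = same-trans (toStart-same μ) (advances-same a (toStart μ))

  goto-pos : ∀ a μ → headPos (goto a μ) ≡ a
  goto-pos a μ = trans (advances-pos a (toStart μ)) (trans (cong (a +_) (toStart-pos μ)) (+-identityʳ a))

  record Written (a : ℕ) (v : Bool) (μ μ' : Mem) : Set where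
    constructor written
    field
      here-bit : bit μ' a ≡ v
      others   : ∀ i → i ≢ a → bit μ' i ≡ bit μ i
      queue    : Mem.inq μ' ≡ Mem.inq μ

  abstract
    rd : ∀ {m k} → Fin T → Vec (Fin m) k → Prog m
    rd tag xs = seq (access tag xs) (op read)

    wr : ∀ {m k} → Fin T → Vec (Fin m) k → Bool → Prog m
    wr tag xs v = seq (access tag xs) (op (write v))

    does-rd : ∀ {n m k} tag (xs : Vec (Fin m) k) {ρ : Vec (Fin n) m} {μ} →
      Does (rd tag xs) ρ μ (λ b μ' → b ≡ bit μ (address tag (lookups ρ xs)) × Same μ μ')
    does-rd tag xs {ρ} {μ} = does-by (_ , _ , (λ κ → sem-access tag xs _ ρ μ) ,
      trans (cur-bit (goto a μ)) (trans (cong (bit (goto a μ)) (goto-pos a μ)) (Same.bits (goto-same a μ) a)) , goto-same a μ)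
      where
      a : ℕ
      a = address tag (lookups ρ xs)

    does-wr : ∀ {n m k} tag (xs : Vec (Fin m) k) v {ρ : Vec (Fin n) m} {μ} →
      Does (wr tag xs v) ρ μ (λ b μ' → b ≡ false × Written (address tag (lookups ρ xs)) v μ μ')
    does-wr tag xs v {ρ} {μ} = does-by (_ , _ , (λ κ → sem-access tag xs _ ρ μ) , refl , written
      (trans (cong (bit μ') (sym (goto-pos a μ))) (sym (cur-bit μ')))
      (λ i h → trans (put-other v (goto a μ) i (λ e → h (trans e (goto-pos a μ)))) (Same.bits (goto-same a μ) i))
      (Same.queue (goto-same a μ)))
      where
      a : ℕ
      a = address tag (lookups ρ xs)
      μ' : Mem
      μ' = put v (goto a μ)

  digits : ∀ p q {a b} → a < T → b < T → p * T + a ≡ q * T + b → p ≡ q × a ≡ b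
  digits zero    zero    _ _ e = refl , e
  digits zero    (suc q) {a} {b} h _ e = ⊥-elim (<⇒≱ h (≤-trans (≤-trans (m≤m+n T (q * T)) (m≤m+n _ b)) (≤-reflexive (sym e))))
  digits (suc p) zero    {a} {b} _ h e = ⊥-elim (<⇒≱ h (≤-trans (≤-trans (m≤m+n T (p * T)) (m≤m+n _ a)) (≤-reflexive e)))
  digits (suc p) (suc q) {a} {b} h h' e with digits p q h h' (+-cancelˡ-≡ T _ _ (trans (sym (+-assoc T _ a)) (trans e (+-assoc T _ b))))
  ... | refl , e' = refl , e'

  -- The remainder modulo `T` reveals the array, even when the two arrays have different arities.
  address-tag : ∀ {n k l} {tag tag'} {t : Vec (Fin n) k} {u : Vec (Fin n) l} → address tag t ≡ address tag' u → tag ≡ tag'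
  address-tag {n} {k} {l} {tag} {tag'} {t} {u} e =
    FinP.toℕ-injective (proj₂ (digits (index (allTuples n k) t) (index (allTuples n l) u) (FinP.toℕ<n tag) (FinP.toℕ<n tag') e))

  address-tuple : ∀ {n k} {tag tag'} {t u : Vec (Fin n) k} → address tag t ≡ address tag' u → t ≡ u
  address-tuple {n} {k} {tag} {tag'} {t} {u} e = index-injective (allTuples n k) (∈-allTuples t) (∈-allTuples u)
    (proj₁ (digits (index (allTuples n k) t) (index (allTuples n k) u) (FinP.toℕ<n tag) (FinP.toℕ<n tag') e))

-- Booleans

∨-true : ∀ {a b} → a ∨ b ≡ true → a ≡ true ⊎ b ≡ true
∨-true {true}  _ = inj₁ refl
∨-true {false} e = inj₂ e

∨-trueˡ : ∀ {a} b → a ≡ true → a ∨ b ≡ true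
∨-trueˡ b refl = refl

∨-trueʳ : ∀ a {b} → b ≡ true → a ∨ b ≡ true
∨-trueʳ true  _ = refl
∨-trueʳ false e = e

∧-true : ∀ {a b} → a ∧ b ≡ true → a ≡ true × b ≡ true
∧-true {true} e = refl , e

∧-both : ∀ {a b} → a ≡ true → b ≡ true → a ∧ b ≡ true
∧-both refl refl = refl

not-true : ∀ {a} → not a ≡ true → a ≡ false
not-true {false} _ = refl

true≢false : ∀ {a} {B : Set} → a ≡ true → a ≡ false → B
true≢false refl ()

false-unless : ∀ {a} → ¬ a ≡ true → a ≡ false
false-unless {true}  h = ⊥-elim (h refl)
false-unless {false} _ = refl

module _ {A : Set} where

  any-intro : ∀ (f : A → Bool) {a} as → a ∈ as → f a ≡ true → any f as ≡ true
  any-intro f (_ ∷ as) (here refl) e = ∨-trueˡ _ e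
  any-intro f (x ∷ as) (there i)   e = ∨-trueʳ (f x) (any-intro f as i e)

  any-elim : ∀ (f : A → Bool) as → any f as ≡ true → ∃ λ a → a ∈ as × f a ≡ true
  any-elim f (x ∷ as) e with ∨-true {f x} e
  ... | inj₁ p = x , here refl , p
  ... | inj₂ p with any-elim f as p
  ...   | a , i , q = a , there i , q

  all-intro : ∀ (f : A → Bool) as → (∀ a → a ∈ as → f a ≡ true) → all f as ≡ true
  all-intro f []       h = refl
  all-intro f (x ∷ as) h = ∧-both (h x (here refl)) (all-intro f as (λ a i → h a (there i)))

  all-elim : ∀ (f : A → Bool) as → all f as ≡ true → ∀ a → a ∈ as → f a ≡ true
  all-elim f (x ∷ as) e a (here refl) = proj₁ (∧-true {f x} e)
  all-elim f (x ∷ as) e a (there i)   = all-elim f as (proj₂ (∧-true {f x} e)) a i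

  any-cong : ∀ {f g : A → Bool} as → (∀ a → f a ≡ g a) → any f as ≡ any g as
  any-cong []       h = refl
  any-cong (a ∷ as) h = cong₂ _∨_ (h a) (any-cong as h)

  all-cong : ∀ {f g : A → Bool} as → (∀ a → f a ≡ g a) → all f as ≡ all g as
  all-cong []       h = refl
  all-cong (a ∷ as) h = cong₂ _∧_ (h a) (all-cong as h)

-- Variables, literals and 2CNF formulas. A set C of clauses is a Boolean matrix: C a b stands for a ∨ b.

-- The innermost symbol comes last, so that branching follows the nesting of the second-order sums.
ordered : (Δ : SOCtx) → List (Fin (length Δ))
ordered []      = []
ordered (k ∷ Δ) = map suc (ordered Δ) ++ zero ∷ []

∈-ordered : ∀ Δ X → X ∈ ordered Δ
∈-ordered (k ∷ Δ) zero    = MemP.∈-++⁺ʳ (map suc (ordered Δ)) (here refl)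
∈-ordered (k ∷ Δ) (suc X) = MemP.∈-++⁺ˡ (MemP.∈-map⁺ suc (∈-ordered Δ X))

Var : ℕ → SOCtx → Set
Var n Δ = Σ (Fin (length Δ)) λ X → Vec (Fin n) (soArity Δ X)

vars : ∀ n Δ → List (Var n Δ)
vars n Δ = concatMap (λ X → map (X ,_) (allTuples n (soArity Δ X))) (ordered Δ)

∈-vars : ∀ {n} Δ (v : Var n Δ) → v ∈ vars n Δ
∈-vars Δ (X , t) = MemP.∈-concatMap⁺ _ (Any.map (λ { refl → MemP.∈-map⁺ (X ,_) (∈-allTuples t) }) (∈-ordered Δ X))

module TwoSAT (n : ℕ) (Δ : SOCtx) where

  V' : Set
  V' = Var n Δ

  _≟ᵛ_ : (v w : V') → Dec (v ≡ w)
  _≟ᵛ_ = ΣP.≡-dec FinP._≟_ _≟ᵗ_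

  Lit : Set
  Lit = Bool × V'

  val : SOEnv n Δ → Lit → Bool
  val V (true  , X , t) = V X t
  val V (false , X , t) = not (V X t)

  Clauses : Set
  Clauses = Lit → Lit → Bool

  sym∨ : Clauses → Clauses
  sym∨ C a b = C a b ∨ C b a

  Sat : Clauses → SOEnv n Δ → Set
  Sat C V = ∀ a b → C a b ≡ true → val V a ∨ val V b ≡ true

  SatOn : List V' → Clauses → SOEnv n Δ → Set
  SatOn vs C V = ∀ a b → proj₂ a ∈ vs → proj₂ b ∈ vs → C a b ≡ true → val V a ∨ val V b ≡ true

  -- The clauses yield a ∨ v (b ∨ ¬ v), possibly by weakening a unit clause; their resolvent is a ∨ b.
  PosWith NegWith : V' → Clauses → Lit → Bool
  PosWith v C a = sym∨ C a (true , v) ∨ C (true , v) (true , v)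
  NegWith v C b = sym∨ C (false , v) b ∨ C (false , v) (false , v)

  _⊆ᶜ_ : Clauses → Clauses → Set
  C ⊆ᶜ C' = ∀ a b → C a b ≡ true → C' a b ≡ true

  Contradiction : Clauses → V' → Set
  Contradiction C v = C (true , v) (true , v) ≡ true × C (false , v) (false , v) ≡ true

  sym∨-mono : ∀ {C C'} → C ⊆ᶜ C' → sym∨ C ⊆ᶜ sym∨ C'
  sym∨-mono {C} {C'} h a b e with ∨-true {C a b} e
  ... | inj₁ p = ∨-trueˡ _ (h a b p)
  ... | inj₂ p = ∨-trueʳ (C' a b) (h b a p)

  -- Resolvents are stored into the matrix while it is being read, so each test sees some
  -- intermediate set of clauses; monotonicity relates it to the initial one.
  PosWith-mono : ∀ {C C'} v → C ⊆ᶜ C' → ∀ a → PosWith v C a ≡ true → PosWith v C' a ≡ true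
  PosWith-mono {C} {C'} v h a e with ∨-true {sym∨ C a (true , v)} e
  ... | inj₁ p = ∨-trueˡ _ (sym∨-mono {C} {C'} h a _ p)
  ... | inj₂ p = ∨-trueʳ (sym∨ C' a (true , v)) (h _ _ p)

  NegWith-mono : ∀ {C C'} v → C ⊆ᶜ C' → ∀ a → NegWith v C a ≡ true → NegWith v C' a ≡ true
  NegWith-mono {C} {C'} v h a e with ∨-true {sym∨ C (false , v) a} e
  ... | inj₁ p = ∨-trueˡ _ (sym∨-mono {C} {C'} h _ a p)
  ... | inj₂ p = ∨-trueʳ (sym∨ C' (false , v) a) (h _ _ p)

  sym∨-sat : ∀ {C V} → Sat C V → ∀ a b → sym∨ C a b ≡ true → val V a ∨ val V b ≡ true
  sym∨-sat {C} {V} h a b e with ∨-true {C a b} e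
  ... | inj₁ p = h a b p
  ... | inj₂ p = trans (∨-comm (val V a) (val V b)) (h b a p)

  resolution-sound : ∀ {C V} v a b → Sat C V → PosWith v C a ≡ true → NegWith v C b ≡ true → val V a ∨ val V b ≡ true
  resolution-sound {C} {V} v@(X , t) a b h p q = lem (val V a) (val V b) (V X t)
      (pos' (∨-true {sym∨ C a (true , v)} p)) (neg' (∨-true {sym∨ C (false , v) b} q))
    where
    pos' : sym∨ C a (true , v) ≡ true ⊎ C (true , v) (true , v) ≡ true → val V a ∨ V X t ≡ true
    pos' (inj₁ p) = sym∨-sat {C} {V} h a (true , v) p
    pos' (inj₂ p) = ∨-trueʳ (val V a) (trans (sym (∨-idem (V X t))) (h _ _ p))
    neg' : sym∨ C (false , v) b ≡ true ⊎ C (false , v) (false , v) ≡ true → not (V X t) ∨ val V b ≡ true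
    neg' (inj₁ p) = sym∨-sat {C} {V} h (false , v) b p
    neg' (inj₂ p) = ∨-trueˡ _ (trans (sym (∨-idem (not (V X t)))) (h _ _ p))
    lem : ∀ x y z → x ∨ z ≡ true → not z ∨ y ≡ true → x ∨ y ≡ true
    lem true  y z     _ _ = refl
    lem false y true  _ e = e
    lem false y false () _

  update : SOEnv n Δ → V' → Bool → SOEnv n Δ
  update V v b X t = if does ((X , t) ≟ᵛ v) then b else V X t

  update-same : ∀ V v b → update V v b (proj₁ v) (proj₂ v) ≡ b
  update-same V v b with v ≟ᵛ v
  ... | yes _ = refl
  ... | no h  = ⊥-elim (h refl)

  update-other : ∀ V v b X t → (X , t) ≢ v → update V v b X t ≡ V X t
  update-other V v b X t h with (X , t) ≟ᵛ v
  ... | yes p = ⊥-elim (h p)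
  ... | no _  = refl

  literals : List V' → List Lit
  literals = concatMap (λ v → (true , v) ∷ (false , v) ∷ [])

  ∈-literals : ∀ {vs} l → proj₂ l ∈ vs → l ∈ literals vs
  ∈-literals (true  , v) i = MemP.∈-concatMap⁺ _ (Any.map (λ { refl → here refl }) i)
  ∈-literals (false , v) i = MemP.∈-concatMap⁺ _ (Any.map (λ { refl → there (here refl) }) i)

  literals-∈ : ∀ {vs} l → l ∈ literals vs → proj₂ l ∈ vs
  literals-∈ l i = Any.map (λ { (here refl) → refl ; (there (here refl)) → refl }) (MemP.∈-concatMap⁻ _ i)

  -- One step of variable elimination. The value of v is forced to true by a unit clause or by a clause v ∨ b with b false.
  module _ {C C' : Clauses} {v : V'} {vs : List V'} {V : SOEnv n Δ}
    (C⊆C' : C ⊆ᶜ C') (resolved : ∀ a b → PosWith v C a ≡ true → NegWith v C b ≡ true → C' a b ≡ true)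
    (consistent : ¬ Contradiction C v) (sat : SatOn vs C' V) where

    private
      v⁺ v⁻ : Lit
      v⁺ = true , v
      v⁻ = false , v

      forced : Lit → Bool
      forced b = sym∨ C v⁺ b ∧ not (val V b)

      new : Bool
      new = C v⁺ v⁺ ∨ any forced (literals vs)

      sym∨-comm : ∀ a b → sym∨ C a b ≡ true → sym∨ C b a ≡ true
      sym∨-comm a b e = trans (∨-comm (C b a) (C a b)) e

      why : new ≡ true → C v⁺ v⁺ ≡ true ⊎ ∃ λ b → proj₂ b ∈ vs × sym∨ C v⁺ b ≡ true × val V b ≡ false
      why e with ∨-true {C v⁺ v⁺} e
      ... | inj₁ p = inj₁ p
      ... | inj₂ p with any-elim forced (literals vs) p
      ...   | b , i , q = inj₂ (b , literals-∈ b i , proj₁ (∧-true {sym∨ C v⁺ b} q) , not-true (proj₂ (∧-true {sym∨ C v⁺ b} q)))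

      twice : ∀ b → val V b ∨ val V b ≡ true → val V b ≡ true
      twice b e = trans (sym (∨-idem (val V b))) e

      with-pos : ∀ b → proj₂ b ∈ vs → sym∨ C v⁺ b ≡ true → new ∨ val V b ≡ true
      with-pos b i e = lem (val V b) refl
        where
        lem : ∀ x → val V b ≡ x → new ∨ x ≡ true
        lem true  _ = ∨-trueʳ new refl
        lem false p = ∨-trueˡ _ (∨-trueʳ (C v⁺ v⁺) (any-intro forced (literals vs) (∈-literals b i) (∧-both e (cong not p))))

      with-neg : ∀ b → proj₂ b ∈ vs → sym∨ C v⁻ b ≡ true → not new ∨ val V b ≡ true
      with-neg b i e = lem new refl
        where
        neg-b : NegWith v C b ≡ true
        neg-b = ∨-trueˡ _ e
        found : C v⁺ v⁺ ≡ true ⊎ (∃ λ b → proj₂ b ∈ vs × sym∨ C v⁺ b ≡ true × val V b ≡ false) → val V b ≡ true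
        found (inj₁ p) = twice b (sat b b i i (resolved b b (∨-trueʳ (sym∨ C b v⁺) p) neg-b))
        -- The clause v ∨ b₀ that forced the value resolves with ¬ v ∨ b to b₀ ∨ b; as b₀ is false,
        -- b is true.
        found (inj₂ (b₀ , j , p , q)) with ∨-true {val V b₀} (sat b₀ b j i (resolved b₀ b (∨-trueˡ _ (sym∨-comm v⁺ b₀ p)) neg-b))
        ... | inj₁ r = true≢false r q
        ... | inj₂ r = r
        lem : ∀ x → new ≡ x → not x ∨ val V b ≡ true
        lem false _ = refl
        lem true  p = found (why p)

      -- The unit clause ¬ v resolves with v ∨ b₀ to b₀, so a false b₀ cannot force v to be true; a
      -- unit clause v would be a contradiction.
      unit-neg : C v⁻ v⁻ ≡ true → new ≡ false
      unit-neg e = false-unless (λ p → found (why p))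
        where
        found : C v⁺ v⁺ ≡ true ⊎ (∃ λ b → proj₂ b ∈ vs × sym∨ C v⁺ b ≡ true × val V b ≡ false) → ⊥
        found (inj₁ p) = consistent (p , e)
        found (inj₂ (b₀ , j , p , q)) = true≢false
          (twice b₀ (sat b₀ b₀ j j (resolved b₀ b₀ (∨-trueˡ _ (sym∨-comm v⁺ b₀ p)) (∨-trueʳ (sym∨ C v⁻ b₀) e)))) q

      W : SOEnv n Δ
      W = update V v new

      val-old : ∀ l → proj₂ l ≢ v → val W l ≡ val V l
      val-old (true  , X , t) h = update-other V v new X t h
      val-old (false , X , t) h = cong not (update-other V v new X t h)

      signed : Bool → Bool
      signed s = if s then new else not new

      val-new : ∀ s → val W (s , v) ≡ signed s
      val-new true  = update-same V v new
      val-new false = cong not (update-same V v new)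

      both : ∀ s s' → C (s , v) (s' , v) ≡ true → signed s ∨ signed s' ≡ true
      both true  true  e = ∨-trueˡ _ (∨-trueˡ _ e)
      both true  false e = ∨-inverseʳ new
      both false true  e = ∨-inverseˡ new
      both false false e = ∨-trueˡ _ (cong not (unit-neg e))

      one : ∀ s b → proj₂ b ∈ vs → sym∨ C (s , v) b ≡ true → signed s ∨ val V b ≡ true
      one true  = with-pos
      one false = with-neg

      others : ∀ {w} → w ≢ v → w ∈ v ∷ vs → w ∈ vs
      others h i = ∈-tail h i

      check : ∀ a b → Dec (proj₂ a ≡ v) → Dec (proj₂ b ≡ v) → proj₂ a ∈ v ∷ vs → proj₂ b ∈ v ∷ vs → C a b ≡ true → val W a ∨ val W b ≡ true
      check (s , _) (s' , _) (yes refl) (yes refl) i j e = trans (cong₂ _∨_ (val-new s) (val-new s')) (both s s' e)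
      check (s , _) b (yes refl) (no q) i j e = trans (cong₂ _∨_ (val-new s) (val-old b q)) (one s b (others q j) (∨-trueˡ _ e))
      check a (s , _) (no p) (yes refl) i j e = trans (cong₂ _∨_ (val-old a p) (val-new s))
        (trans (∨-comm (val V a) (signed s)) (one s a (others p i) (∨-trueʳ (C (s , v) a) e)))
      check a b (no p) (no q) i j e = trans (cong₂ _∨_ (val-old a p) (val-old b q)) (sat a b (others p i) (others q j) (C⊆C' a b e))

    eliminate : ∃ λ V' → SatOn (v ∷ vs) C V'
    eliminate = W , λ a b i j e → check a b (proj₂ a ≟ᵛ v) (proj₂ b ≟ᵛ v) i j e

-- Counting assignments

module Counting (n : ℕ) (Δ : SOCtx) where
  open TwoSAT n Δ using (update; _≟ᵛ_)

  _≈_ : SOEnv n Δ → SOEnv n Δ → Set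
  V ≈ W = ∀ X t → V X t ≡ W X t

  Ext : (SOEnv n Δ → ℕ) → Set
  Ext g = ∀ {V W} → V ≈ W → g V ≡ g W

  -- The full branching tree of the search with `g` at its leaves. It mediates between the paths of
  -- the machine and the nested sums of the semantics.
  count : (SOEnv n Δ → ℕ) → List (Var n Δ) → SOEnv n Δ → ℕ
  count g []       V = g V
  count g (v ∷ vs) V = count g vs (update V v false) + count g vs (update V v true)

  update-≈ : ∀ {V W} v b → V ≈ W → update V v b ≈ update W v b
  update-≈ v b h X t = cong (λ z → if does ((X , t) ≟ᵛ v) then b else z) (h X t)

  count-ext : ∀ {g} → Ext g → ∀ vs → Ext (count g vs)
  count-ext e []       h = e h
  count-ext e (v ∷ vs) h = cong₂ _+_ (count-ext e vs (update-≈ v false h)) (count-ext e vs (update-≈ v true h))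

  count-++ : ∀ g us vs V → count g (us ++ vs) V ≡ count (count g vs) us V
  count-++ g []       vs V = refl
  count-++ g (u ∷ us) vs V = cong₂ _+_ (count-++ g us vs _) (count-++ g us vs _)

-- Nested sums over subsets

module _ {τ : Vocab} (𝒜 : Structure τ) where

  private
    n = size 𝒜

  sumSubsets-cong : ∀ {k} (ts : List (Vec (Fin n) k)) {g h : (Vec (Fin n) k → Bool) → ℕ} → (∀ B → g B ≡ h B) →
    sumSubsets 𝒜 ts g ≡ sumSubsets 𝒜 ts h
  sumSubsets-cong []       e = e _
  sumSubsets-cong (t ∷ ts) e = cong₂ _+_ (sumSubsets-cong ts (λ B → e _)) (sumSubsets-cong ts (λ B → e _))

  +-swap : ∀ a b c d → (a + b) + (c + d) ≡ (a + c) + (b + d)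
  +-swap a b c d = trans (+-assoc a b (c + d)) (trans (cong (a +_) (trans (sym (+-assoc b c d)) (trans (cong (_+ d) (+-comm b c)) (+-assoc c b d))))
    (sym (+-assoc a c (b + d))))

  sumSubsets-+ : ∀ {k} (ts : List (Vec (Fin n) k)) (g h : (Vec (Fin n) k → Bool) → ℕ) →
    sumSubsets 𝒜 ts (λ B → g B + h B) ≡ sumSubsets 𝒜 ts g + sumSubsets 𝒜 ts h
  sumSubsets-+ []       g h = refl
  sumSubsets-+ (t ∷ ts) g h = trans (cong₂ _+_ (sumSubsets-+ ts _ _) (sumSubsets-+ ts _ _)) (+-swap (sumSubsets 𝒜 ts _) _ _ _)

  sumSubsets-0 : ∀ {k} (ts : List (Vec (Fin n) k)) → sumSubsets 𝒜 ts (λ _ → 0) ≡ 0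
  sumSubsets-0 []       = refl
  sumSubsets-0 (t ∷ ts) = cong₂ _+_ (sumSubsets-0 ts) (sumSubsets-0 ts)

  -- Applied at every leaf of a sentence to all second-order symbols in scope. Its linearity is what
  -- moves these sums across + and across sums over elements.
  sumAll : ∀ Δ → (SOEnv n Δ → ℕ) → ℕ
  sumAll []      g = g (emptySO 𝒜)
  sumAll (k ∷ Δ) g = sumAll Δ (λ V → sumSubsets 𝒜 (allTuples n k) (λ B → g (extendSO B V)))

  sumAll-cong : ∀ Δ {g h} → (∀ V → g V ≡ h V) → sumAll Δ g ≡ sumAll Δ h
  sumAll-cong []      e = e _
  sumAll-cong (k ∷ Δ) e = sumAll-cong Δ (λ V → sumSubsets-cong (allTuples n k) (λ B → e _))

  sumAll-+ : ∀ Δ g h → sumAll Δ (λ V → g V + h V) ≡ sumAll Δ g + sumAll Δ h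
  sumAll-+ []      g h = refl
  sumAll-+ (k ∷ Δ) g h = trans (sumAll-cong Δ (λ V → sumSubsets-+ (allTuples n k) _ _)) (sumAll-+ Δ _ _)

  sumAll-0 : ∀ Δ → sumAll Δ (λ _ → 0) ≡ 0
  sumAll-0 []      = refl
  sumAll-0 (k ∷ Δ) = trans (sumAll-cong Δ (λ V → sumSubsets-0 (allTuples n k))) (sumAll-0 Δ)

-- From sums over subsets to branching on single variables

allTuples-unique : ∀ n k → Unique (allTuples n k)
allTuples-unique n zero    = [] ∷ []
allTuples-unique n (suc k) = UniqueP.concat⁺
  (AllP.map⁺ (All.universal (λ i → UniqueP.map⁺ (proj₂ ∘ VecP.∷-injective) (allTuples-unique n k)) (allFin n)))
  (AllPairsP.map⁺ (AllPairs.map disjoint (UniqueP.allFin⁺ n)))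
  where
  disjoint : ∀ {i j} → i ≢ j → ∀ {t} → ¬ (t ∈ map (i ∷_) (allTuples n k) × t ∈ map (j ∷_) (allTuples n k))
  disjoint h (p , q) with MemP.∈-map⁻ _ p | MemP.∈-map⁻ _ q
  ... | _ , _ , refl | _ , _ , e = h (proj₁ (VecP.∷-injective e))

ordered-unique : ∀ Δ → Unique (ordered Δ)
ordered-unique []      = []
ordered-unique (k ∷ Δ) = UniqueP.++⁺ (UniqueP.map⁺ FinP.suc-injective (ordered-unique Δ)) ([] ∷ []) disjoint
  where
  disjoint : ∀ {X} → ¬ (X ∈ map suc (ordered Δ) × X ∈ zero ∷ [])
  disjoint (p , here refl) with MemP.∈-map⁻ suc p
  ... | _ , _ , ()

vars-unique : ∀ n Δ → Unique (vars n Δ)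
vars-unique n Δ = UniqueP.concat⁺
  (AllP.map⁺ (All.universal (λ X → UniqueP.map⁺ (λ { refl → refl }) (allTuples-unique n (soArity Δ X))) (ordered Δ)))
  (AllPairsP.map⁺ (AllPairs.map disjoint (ordered-unique Δ)))
  where
  disjoint : ∀ {X Y} → X ≢ Y → ∀ {v} → ¬ (v ∈ map (X ,_) (allTuples n (soArity Δ X)) × v ∈ map (Y ,_) (allTuples n (soArity Δ Y)))
  disjoint h (p , q) with MemP.∈-map⁻ _ p | MemP.∈-map⁻ _ q
  ... | _ , _ , refl | _ , _ , e = h (cong proj₁ e)

does-≡ : ∀ {A B : Set} (a : Dec A) (b : Dec B) → (A → B) → (B → A) → does a ≡ does b
does-≡ (yes a) (yes b) f g = refl
does-≡ (yes a) (no b)  f g = ⊥-elim (b (f a))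
does-≡ (no a)  (yes b) f g = ⊥-elim (a (g b))
does-≡ (no a)  (no b)  f g = refl

module _ {τ : Vocab} (𝒜 : Structure τ) where

  private
    n = size 𝒜

  module _ {k} (g : (Vec (Fin n) k → Bool) → ℕ) (ext : ∀ {B B'} → (∀ u → B u ≡ B' u) → g B ≡ g B') where

    Bs : Set
    Bs = Vec (Fin n) k → Bool

    set : Bs → Vec (Fin n) k → Bool → Bs
    set B t v u = if does (u ≟ᵗ t) then v else B u

    countTuples : List (Vec (Fin n) k) → Bs → ℕ
    countTuples []       B = g B
    countTuples (t ∷ ts) B = countTuples ts (set B t false) + countTuples ts (set B t true)

    open import Data.List.Membership.DecPropositional (_≟ᵗ_ {n} {k}) using (_∈?_)

    -- In `sumSubsets` the choice for the first tuple is applied last, in `countTuples` it is made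
    -- first. Taking B on the tuples still to come and B₀ elsewhere reconciles the two, as no tuple
    -- occurs twice.
    over : List (Vec (Fin n) k) → Bs → Bs → Bs
    over ts B B₀ u = if does (u ∈? ts) then B u else B₀ u

    over-set : ∀ {t ts} → ¬ t ∈ ts → ∀ B B₀ v u → over (t ∷ ts) (set B t v) B₀ u ≡ over ts B (set B₀ t v) u
    over-set {t} {ts} h B B₀ v u with u ∈? (t ∷ ts) | u ∈? ts | u ≟ᵗ t
    ... | yes p        | yes q | yes refl = ⊥-elim (h q)
    ... | yes p        | yes q | no r     = refl
    ... | yes p        | no q  | yes r    = refl
    ... | yes (here p) | no q  | no r     = ⊥-elim (r p)
    ... | yes (there p) | no q | no r     = ⊥-elim (q p)
    ... | no p         | yes q | _        = ⊥-elim (p (there q))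
    ... | no p         | no q  | yes r    = ⊥-elim (p (here r))
    ... | no p         | no q  | no r     = refl

    sumSubsets-over : ∀ ts → Unique ts → ∀ B₀ → sumSubsets 𝒜 ts (λ B → g (over ts B B₀)) ≡ countTuples ts B₀
    sumSubsets-over []       _        B₀ = ext (λ _ → refl)
    sumSubsets-over (t ∷ ts) (t∉ ∷ u) B₀ = cong₂ _+_ (half false) (half true)
      where
      half : ∀ v → sumSubsets 𝒜 ts (λ B → g (over (t ∷ ts) (set B t v) B₀)) ≡ countTuples ts (set B₀ t v)
      half v = trans (sumSubsets-cong 𝒜 ts (λ B → ext (over-set (λ i → All.lookup t∉ i refl) B B₀ v))) (sumSubsets-over ts u (set B₀ t v))

    sumSubsets-count : ∀ B₀ → sumSubsets 𝒜 (allTuples n k) g ≡ countTuples (allTuples n k) B₀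
    sumSubsets-count B₀ = trans (sumSubsets-cong 𝒜 (allTuples n k) (λ B → ext (full B))) (sumSubsets-over _ (allTuples-unique n k) B₀)
      where
      full : ∀ B u → B u ≡ over (allTuples n k) B B₀ u
      full B u with u ∈? allTuples n k
      ... | yes _ = refl
      ... | no h  = ⊥-elim (h (∈-allTuples u))

  module _ {k : ℕ} {Δ : SOCtx} where

    private
      module S = Counting n Δ
      module L = Counting n (k ∷ Δ)
      module SE = TwoSAT n Δ
      module LE = TwoSAT n (k ∷ Δ)

    uncons : ∀ (V : SOEnv n (k ∷ Δ)) → extendSO (V zero) (λ X → V (suc X)) L.≈ V
    uncons V zero    t = refl
    uncons V (suc X) t = refl

    lift : Var n Δ → Var n (k ∷ Δ)
    lift (X , t) = suc X , t

    update-lift : ∀ B (V : SOEnv n Δ) v b → LE.update (extendSO B V) (lift v) b L.≈ extendSO B (SE.update V v b)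
    update-lift B V v b zero    t with (LE._≟ᵛ_ (zero , t) (lift v))
    ... | no _ = refl
    update-lift B V v b (suc X) t = cong (λ c → if c then b else V X t)
      (does-≡ (LE._≟ᵛ_ (suc X , t) (lift v)) (SE._≟ᵛ_ (X , t) v) (λ { refl → refl }) (λ { refl → refl }))

    update-zero : ∀ B (V : SOEnv n Δ) t b → LE.update (extendSO B V) (zero , t) b L.≈
      extendSO {k = k} (λ u → if does (u ≟ᵗ t) then b else B u) V
    update-zero B V t b zero    u = cong (λ c → if c then b else B u)
      (does-≡ (LE._≟ᵛ_ (zero , u) (zero , t)) (u ≟ᵗ t) (λ { refl → refl }) (λ { refl → refl }))
    update-zero B V t b (suc X) u with (LE._≟ᵛ_ (suc X , u) (zero , t))
    ... | no _ = refl

    module _ {g : SOEnv n (k ∷ Δ) → ℕ} (ext : L.Ext g) where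

      count-lift : ∀ vs B V → L.count g (map lift vs) (extendSO B V) ≡ S.count (λ W → g (extendSO B W)) vs V
      count-lift []       B V = refl
      count-lift (v ∷ vs) B V = cong₂ _+_ (half false) (half true)
        where
        half : ∀ b → L.count g (map lift vs) (LE.update (extendSO B V) (lift v) b) ≡ S.count (λ W → g (extendSO B W)) vs (SE.update V v b)
        half b = trans (L.count-ext ext (map lift vs) (update-lift B V v b)) (count-lift vs B (SE.update V v b))

      ext-B : ∀ V {B B' : Vec (Fin n) k → Bool} → (∀ u → B u ≡ B' u) → g (extendSO B V) ≡ g (extendSO B' V)
      ext-B V h = ext (λ { zero → h ; (suc X) u → refl })

      count-zero : ∀ ts B V → L.count g (map (zero ,_) ts) (extendSO B V) ≡ countTuples (λ B → g (extendSO B V)) (ext-B V) ts B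
      count-zero []       B V = refl
      count-zero (t ∷ ts) B V = cong₂ _+_ (half false) (half true)
        where
        half : ∀ b → L.count g (map (zero ,_) ts) (LE.update (extendSO B V) (zero , t) b) ≡
          countTuples (λ B → g (extendSO B V)) (ext-B V) ts (set (λ B → g (extendSO B V)) (ext-B V) B t b)
        half b = trans (L.count-ext ext (map (zero ,_) ts) (update-zero B V t b)) (count-zero ts _ V)

    extend-≈ : ∀ (B : Vec (Fin n) k → Bool) {V W : SOEnv n Δ} → V S.≈ W → extendSO {k = k} B V L.≈ extendSO B W
    extend-≈ B h zero    t = refl
    extend-≈ B h (suc X) t = h X t

    vars-cons : vars n (k ∷ Δ) ≡ map lift (vars n Δ) ++ map (zero ,_) (allTuples n k)
    vars-cons = trans (ListP.concatMap-++ block (map suc (ordered Δ)) (zero ∷ []))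
      (cong₂ _++_ (trans (ListP.concatMap-map block suc (ordered Δ))
        (trans (ListP.concatMap-cong (λ X → ListP.map-∘ (allTuples n (soArity Δ X))) (ordered Δ))
          (sym (ListP.map-concatMap lift (λ X → map (X ,_) (allTuples n (soArity Δ X))) (ordered Δ)))))
        (ListP.++-identityʳ _))
      where
      block : (X : Fin (suc (length Δ))) → List (Var n (k ∷ Δ))
      block X = map (X ,_) (allTuples n (soArity (k ∷ Δ) X))

  -- The variables of the innermost symbol form the last block of `vars`, so peeling off this symbol
  -- separates the inner sum over B from the outer ones.
  count-sumAll : ∀ Δ {g : SOEnv n Δ → ℕ} → Counting.Ext n Δ g → ∀ V → Counting.count n Δ g (vars n Δ) V ≡ sumAll 𝒜 Δ g
  count-sumAll []      ext V = ext (λ ())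
  count-sumAll (k ∷ Δ) {g} ext V = trans (cong (λ vs → L.count g vs V) vars-cons) (trans (L.count-++ g (map lift (vars n Δ)) _ V)
    (trans (L.count-ext (L.count-ext ext zs) (map lift (vars n Δ)) (λ X t → sym (uncons V X t)))
      (trans (count-lift (L.count-ext ext zs) (vars n Δ) (V zero) (λ X → V (suc X)))
        (trans (count-sumAll Δ (λ h → L.count-ext ext zs (extend-≈ (V zero) h)) (λ X → V (suc X)))
          (sumAll-cong 𝒜 Δ (λ W → trans (count-zero ext (allTuples n k) (V zero) W)
            (sym (sumSubsets-count (λ B → g (extendSO B W)) (ext-B ext W) (V zero)))))))))
    where
    module L = Counting n (k ∷ Δ)
    zs : List (Var n (k ∷ Δ))
    zs = map (zero ,_) (allTuples n k)

-- Loops that establish a property of every element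

record Preorder (Step : Mem → Mem → Set) : Set where
  field
    reflexive  : ∀ {μ} → Step μ μ
    transitive : ∀ {μ μ' μ''} → Step μ μ' → Step μ' μ'' → Step μ μ''

module _ {A : Set} {f : Body {A}} {Step : Mem → Mem → Set} (pre : Preorder Step)
  (D : A → Mem → Set) (stable : ∀ {a μ μ'} → Step μ μ' → D a μ → D a μ') (Q : Set) where
  open Preorder pre

  -- What one iteration achieves survives the later ones, as `D` is stable under `Step`; a break
  -- delivers the certificate `Q` instead.
  runs-forall : ∀ as μ₀ →
    (∀ a μ → a ∈ as → Step μ₀ μ → Runs (f a) μ (λ b μ' → Step μ μ' × (if b then Q else D a μ'))) →
    Runs (iter f as) μ₀ (λ b μ' → Step μ₀ μ' × (if b then Q else (∀ a → a ∈ as → D a μ')))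
  runs-forall []       μ₀ h = false , μ₀ , (λ _ → refl) , reflexive , λ a ()
  runs-forall (a ∷ as) μ₀ h with h a μ₀ (here refl) reflexive
  ... | true  , μ' , e , s , q = true , μ' , (λ κ → e (λ b → if b then κ true else iter f as κ)) , s , q
  ... | false , μ' , e , s , d with runs-forall as μ' (λ a' μ i s' → h a' μ (there i) (transitive s s'))
  ...   | true  , μ'' , e' , s' , q  = true , μ'' , (λ κ → trans (e (λ b → if b then κ true else iter f as κ)) (e' κ)) , transitive s s' , q
  ...   | false , μ'' , e' , s' , ds = false , μ'' , (λ κ → trans (e (λ b → if b then κ true else iter f as κ)) (e' κ)) , transitive s s' ,
    λ { a' (here refl) → stable s' d ; a' (there i) → ds a' i }

does-nest : ∀ {n} k {m} {P : Prog (k ⊕ m)} {ρ : Vec (Fin n) m} {μ Post} →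
  Runs (iter (λ t κ → sem P κ (t ⊕ᵛ ρ)) (allTuples n k)) μ Post → Does (nest k P) ρ μ Post
does-nest k {P = P} {ρ} {μ} (b , μ' , e , p) = does-by (b , μ' , (λ κ → trans (sem-nest k P κ ρ μ) (e κ)) , p)

does-anyOf : ∀ {n m} {A : Set} {P : A → Prog m} {as} {ρ : Vec (Fin n) m} {μ Post} →
  Runs (iter (λ a κ → sem (P a) κ ρ) as) μ Post → Does (anyOf (map P as)) ρ μ Post
does-anyOf {P = P} {as} {ρ} {μ} (b , μ' , e , p) = does-by (b , μ' , (λ κ → trans (sem-anyOf P as κ ρ μ) (e κ)) , p)

lookups-lookups : ∀ {n m m' k} (ρ : Vec (Fin n) m') (σ : Vec (Fin m') m) (xs : Vec (Fin m) k) →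
  lookups ρ (lookups σ xs) ≡ lookups (lookups ρ σ) xs
lookups-lookups ρ σ []       = refl
lookups-lookups ρ σ (x ∷ xs) = cong₂ _∷_ (sym (VecP.lookup-map x (lookup ρ) σ)) (lookups-lookups ρ σ xs)

lookups-++ : ∀ {n m k l} (ρ : Vec (Fin n) m) (xs : Vec (Fin m) k) (ys : Vec (Fin m) l) →
  lookups ρ (xs Vec.++ ys) ≡ lookups ρ xs Vec.++ lookups ρ ys
lookups-++ ρ xs ys = VecP.map-++ (lookup ρ) xs ys

extendVars : ∀ k {m m'} → Vec (Fin m') m → Vec (Fin (k ⊕ m')) (k + m)
extendVars k σ = tupleVars k Vec.++ Vec.map (wk k) σ

lookups-extendVars : ∀ {n k m m'} (t : Vec (Fin n) k) (ρ : Vec (Fin n) m') (σ : Vec (Fin m') m) →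
  lookups (t ⊕ᵛ ρ) (extendVars k σ) ≡ t Vec.++ lookups ρ σ
lookups-extendVars {k = k} t ρ σ = trans (lookups-++ (t ⊕ᵛ ρ) (tupleVars k) _) (cong₂ Vec._++_ (lookups-tupleVars t ρ) (lookups-wk t ρ σ))

-- Programs for a block: as X and va X hold a partial assignment of the second-order variable X,
-- cl holds the set of 2-clauses.

data BlockName (Δ : SOCtx) : Set where
  asN vaN : Fin (length Δ) → BlockName Δ
  clN     : Bool → Fin (length Δ) → Bool → Fin (length Δ) → BlockName Δ

RelOK : ∀ {τ T} → (Fin (length τ) → Fin T) → Structure τ → Mem → Set
RelOK {τ} {T} relTag 𝒜 μ = ∀ i t → bit μ (Access.address T (relTag i) t) ≡ rel 𝒜 i t

module Block (τ : Vocab) (T : ℕ) (Δ : SOCtx) (tag : Fin (length τ) ⊎ BlockName Δ → Fin T) where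
  open Access T

  Name : Set
  Name = Fin (length τ) ⊎ BlockName Δ

  -- The context of the program also contains the variables of auxiliary loops; `σ` locates the
  -- variables of the formula in it.
  evaluate : ∀ {m m'} → Vec (Fin m') m → FO τ m → Prog m'
  evaluate σ (eq x y)                    = op (cmp true (lookup σ x) (lookup σ y))
  evaluate σ (atom zero (x ∷ y ∷ []))    = op (cmp false (lookup σ x) (lookup σ y))
  evaluate σ (atom (suc i) xs)           = rd (tag (inj₁ i)) (lookups σ xs)
  evaluate σ (neg φ)                     = ite (evaluate σ φ) (ret false) (ret true)
  evaluate σ (or φ ψ)                    = ite (evaluate σ φ) (ret true) (evaluate σ ψ)
  evaluate σ (ex φ)                      = for (evaluate (zero ∷ Vec.map suc σ) φ)
  evaluate σ tt                          = ret true
  evaluate σ ff                          = ret false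

  SVar : ℕ → Set
  SVar m = Σ (Fin (length Δ)) λ X → Vec (Fin m) (soArity Δ X)

  SLit : ℕ → Set
  SLit m = Bool × SVar m

  weaken : ∀ k {m} → SVar m → SVar (k ⊕ m)
  weaken k (X , xs) = X , Vec.map (wk k) xs

  weakenL : ∀ k {m} → SLit m → SLit (k ⊕ m)
  weakenL k (s , v) = s , weaken k v

  tupleVar : ∀ X {m} → SVar (soArity Δ X ⊕ m)
  tupleVar X = X , tupleVars (soArity Δ X)

  rdC addC clearC rdSym : ∀ {m} → SLit m → SLit m → Prog m
  rdC    (s , X , xs) (s' , X' , xs') = rd (tag (inj₂ (clN s X s' X'))) (xs Vec.++ xs')
  addC   (s , X , xs) (s' , X' , xs') = wr (tag (inj₂ (clN s X s' X'))) (xs Vec.++ xs') true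
  clearC (s , X , xs) (s' , X' , xs') = wr (tag (inj₂ (clN s X s' X'))) (xs Vec.++ xs') false
  rdSym l l' = ite (rdC l l') (ret true) (rdC l' l)

  forVars : ∀ {m} → ((X : Fin (length Δ)) → Prog (soArity Δ X ⊕ m)) → Prog m
  forVars P = anyOf (map (λ X → nest (soArity Δ X) (P X)) (ordered Δ))

  forLits : ∀ {m} → ((s : Bool) (X : Fin (length Δ)) → Prog (soArity Δ X ⊕ m)) → Prog m
  forLits P = forVars (λ X → ite (P true X) (ret true) (P false X))

  slit : ∀ {m m'} → Vec (Fin m') m → Literal m Δ → SLit m'
  slit σ (pos X xs) = true , X , lookups σ xs
  slit σ (neg X xs) = false , X , lookups σ xs

  -- A true first-order part makes the clause void, a false one is dropped. One remaining literal is
  -- stored as l ∨ l. The empty clause has no place in the matrix and is reported by the answer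
  -- `true`. A third literal is excluded by `two-literals`.
  addClause : ∀ {m m'} → Vec (Fin m') m → List (Component τ m Δ) → List (SLit m') → Prog m'
  addClause σ []           []           = ret true
  addClause σ []           (l ∷ [])     = addC l l
  addClause σ []           (l ∷ l' ∷ _) = addC l l'
  addClause σ (lit x ∷ cs) ls           = addClause σ cs (slit σ x ∷ ls)
  addClause σ (fo φ ∷ cs)  ls           = ite (evaluate σ φ) (ret false) (addClause σ cs ls)

  components : ∀ {m} → Clause τ m Δ → List (Component τ m Δ)
  components C = Clause.φ₁ C ∷ Clause.φ₂ C ∷ Clause.φ₃ C ∷ []

  clearP : ∀ {m} → Prog m
  clearP = forLits (λ s X → forLits (λ s' Y → clearC (weakenL (soArity Δ Y) (s , tupleVar X)) (s' , tupleVar Y)))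

  clausesP : ∀ {m m'} b → Vec (Fin m') m → List (Clause τ (b + m) Δ) → Prog m'
  clausesP b σ Cs = nest b (anyOf (map (λ C → addClause (extendVars b σ) (components C) []) Cs))

  -- The values fixed so far enter the 2CNF formula as unit clauses, so extendability is plain
  -- satisfiability.
  unitP : ∀ {m} → SVar m → Prog m
  unitP (X , xs) = ite (rd (tag (inj₂ (asN X))) xs)
    (ite (rd (tag (inj₂ (vaN X))) xs) (addC (true , X , xs) (true , X , xs)) (addC (false , X , xs) (false , X , xs)))
    (ret false)

  unitsP : ∀ {m} → Prog m
  unitsP = forVars (λ X → unitP (tupleVar X))

  resolveP : ∀ {m} → SVar m → SLit m → SLit m → Prog m
  resolveP v a b =
    ite (ite (rdSym a (true , v)) (ret true) (rdC (true , v) (true , v)))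
      (ite (ite (rdSym (false , v) b) (ret true) (rdC (false , v) (false , v))) (addC a b) (ret false))
      (ret false)

  -- All literals take part, those of variables already eliminated included; the surplus resolvents
  -- are consequences of the clauses too.
  eliminateP : ∀ {m} → SVar m → Prog m
  eliminateP v = forLits (λ s Y → forLits (λ s' Z →
    resolveP (weaken (soArity Δ Z) (weaken (soArity Δ Y) v)) (weakenL (soArity Δ Z) (s , tupleVar Y)) (s' , tupleVar Z)))

  eliminationP : ∀ {m} → Prog m
  eliminationP = forVars (λ X → eliminateP (tupleVar X))

  -- Two opposite unit clauses are the form in which an empty resolvent shows up in a matrix of
  -- 2-clauses.
  contradictionP : ∀ {m} → Prog m
  contradictionP = forVars (λ X → ite (rdC (true , tupleVar X) (true , tupleVar X)) (rdC (false , tupleVar X) (false , tupleVar X)) (ret false))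

  satP : ∀ {m m'} b → Vec (Fin m') m → List (Clause τ (b + m) Δ) → Prog m'
  satP b σ Cs = seq clearP (ite (clausesP b σ Cs) (ret false)
    (seq unitsP (seq eliminationP (ite contradictionP (ret false) (ret true)))))

  abstract
    checkP : ∀ {m m'} → Vec (Fin m') m → Σ₂2SAT τ m Δ → Prog m'
    checkP σ φ = nest (Σ₂2SAT.a φ) (satP (Σ₂2SAT.b φ) (extendVars (Σ₂2SAT.a φ) σ) (Σ₂2SAT.clauses φ))

  branchP : ∀ {m m'} → SVar m' → Vec (Fin m') m → Σ₂2SAT τ m Δ → Prog m'
  branchP (X , xs) σ φ = seq (wr (tag (inj₂ (asN X))) xs true) (seq (setTo false)
    (ite (checkP σ φ)
      (seq (setTo true) (ite (checkP σ φ) (choose (setTo false) (ret false)) (setTo false)))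
      (setTo true)))
    where
    setTo : Bool → Prog _
    setTo = wr (tag (inj₂ (vaN X))) xs

  branchesP : ∀ {m m'} → Vec (Fin m') m → Σ₂2SAT τ m Δ → Prog m'
  branchesP σ φ = forVars (λ X → branchP (tupleVar X) (Vec.map (wk (soArity Δ X)) σ) φ)

  -- With the reset, the invariant between two blocks has to speak about the input relations only.
  resetP : ∀ {m} → Prog m
  resetP = forVars (λ X → wr (tag (inj₂ (asN X))) (tupleVars (soArity Δ X)) false)

  blockP : ∀ {m m'} → Vec (Fin m') m → Σ₂2SAT τ m Δ → Prog m'
  blockP σ φ = seq resetP (ite (checkP σ φ) (choose (seq (branchesP σ φ) halt) (ret false)) (ret false))

  -- Correctness of the satisfiability test

  module Correct (tag-injective : ∀ {x y} → tag x ≡ tag y → x ≡ y) (𝒜 : Structure τ) where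

    n : ℕ
    n = size 𝒜

    open TwoSAT n Δ public

    addr : (nm : Name) → ∀ {k} → Vec (Fin n) k → ℕ
    addr nm t = address (tag nm) t

    asg vl : Mem → V' → Bool
    asg μ (X , t) = bit μ (addr (inj₂ (asN X)) t)
    vl  μ (X , t) = bit μ (addr (inj₂ (vaN X)) t)

    den : ∀ {m} → Vec (Fin n) m → SVar m → V'
    den ρ (X , xs) = X , lookups ρ xs

    denL : ∀ {m} → Vec (Fin n) m → SLit m → Lit
    denL ρ (s , v) = s , den ρ v

    abstract
      clAddr : Lit → Lit → ℕ
      clAddr (s , X , t) (s' , X' , t') = addr (inj₂ (clN s X s' X')) (t Vec.++ t')

      -- The tag determines signs and symbols, hence the arities, and these tell where the
      -- concatenated tuple has to be cut.
      clAddr-injective : ∀ a b a' b' → clAddr a b ≡ clAddr a' b' → a ≡ a' × b ≡ b'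
      clAddr-injective (s , X , t) (s' , X' , t') (r , Y , u) (r' , Y' , u') e with tag-injective (address-tag {t = t Vec.++ t'} {u Vec.++ u'} e)
      ... | refl with VecP.++-injective t u (address-tuple {t = t Vec.++ t'} {u Vec.++ u'} e)
      ...   | refl , refl = refl , refl

      clAddr-den : ∀ {m} (ρ : Vec (Fin n) m) s X xs s' X' xs' →
        addr (inj₂ (clN s X s' X')) (lookups ρ (xs Vec.++ xs')) ≡ clAddr (denL ρ (s , X , xs)) (denL ρ (s' , X' , xs'))
      clAddr-den ρ s X xs s' X' xs' = cong (addr (inj₂ (clN s X s' X'))) (lookups-++ ρ xs xs')

    cl : Mem → Clauses
    cl μ a b = bit μ (clAddr a b)

    addr-name : ∀ {x y k l} {t : Vec (Fin n) k} {u : Vec (Fin n) l} → addr x t ≡ addr y u → x ≡ y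
    addr-name {t = t} {u} e = tag-injective (address-tag {t = t} {u} e)

    -- What the test leaves intact: it may overwrite the matrix of clauses, but not the input or the
    -- partial assignment.
    record Frame (μ μ' : Mem) : Set where
      constructor frame
      field
        rels : ∀ i (t : Vec (Fin n) (arityτ τ i)) → bit μ' (addr (inj₁ i) t) ≡ bit μ (addr (inj₁ i) t)
        asgs : ∀ v → asg μ' v ≡ asg μ v
        vals : ∀ v → vl μ' v ≡ vl μ v

    Same⇒Frame : ∀ {μ μ'} → Same μ μ' → Frame μ μ'
    Same⇒Frame (same b _) = frame (λ i t → b _) (λ v → b _) (λ v → b _)

    Frame-refl : ∀ {μ} → Frame μ μ
    Frame-refl = frame (λ i t → refl) (λ v → refl) (λ v → refl)

    Frame-trans : ∀ {μ μ' μ''} → Frame μ μ' → Frame μ' μ'' → Frame μ μ''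
    Frame-trans (frame r a v) (frame r' a' v') = frame (λ i t → trans (r' i t) (r i t)) (λ w → trans (a' w) (a w)) (λ w → trans (v' w) (v w))

    Frame-preorder : Preorder Frame
    Frame-preorder = record { reflexive = Frame-refl ; transitive = Frame-trans }

    Rel : Mem → Set
    Rel μ = RelOK {τ} (λ i → tag (inj₁ i)) 𝒜 μ

    Frame-Rel : ∀ {μ μ'} → Frame μ μ' → Rel μ → Rel μ'
    Frame-Rel f r i t = trans (Frame.rels f i t) (r i t)

    compareFin-≤ᵇ : ∀ {k} (x y : Fin k) → compareFin false x y ≡ (toℕ x ≤ᵇ toℕ y)
    compareFin-≤ᵇ zero    zero    = refl
    compareFin-≤ᵇ zero    (suc y) = refl
    compareFin-≤ᵇ (suc x) zero    = refl
    compareFin-≤ᵇ (suc zero)    (suc zero)    = refl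
    compareFin-≤ᵇ (suc zero)    (suc (suc y)) = refl
    compareFin-≤ᵇ (suc (suc x)) (suc zero)    = refl
    compareFin-≤ᵇ (suc (suc x)) (suc (suc y)) = compareFin-≤ᵇ (suc x) (suc y)

    does-evaluate : ∀ {m m'} (σ : Vec (Fin m') m) (φ : FO τ m) {ρ : Vec (Fin n) m'} {μ} → Rel μ →
      Does (evaluate σ φ) ρ μ (λ b μ' → b ≡ satFO 𝒜 φ (lookups ρ σ) × Same μ μ')
    does-evaluate σ (eq x y) {ρ} r = does-op (cmp true (lookup σ x) (lookup σ y))
      (trans (eqFin-does (lookup ρ (lookup σ x)) (lookup ρ (lookup σ y))) (cong₂ (λ a b → does (a FinP.≟ b)) (sym (VecP.lookup-map x (lookup ρ) σ)) (sym (VecP.lookup-map y (lookup ρ) σ))) , same-refl)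
    does-evaluate σ (atom zero (x ∷ y ∷ [])) {ρ} r = does-op (cmp false (lookup σ x) (lookup σ y))
      (trans (compareFin-≤ᵇ (lookup ρ (lookup σ x)) (lookup ρ (lookup σ y)))
        (cong₂ (λ a b → toℕ a ≤ᵇ toℕ b) (sym (VecP.lookup-map x (lookup ρ) σ)) (sym (VecP.lookup-map y (lookup ρ) σ))) , same-refl)
    does-evaluate σ (atom (suc i) xs) {ρ} {μ} r = does-imp
      (λ b μ' (p , q) → trans p (trans (cong (λ t → bit μ (addr (inj₁ i) t)) (lookups-lookups ρ σ xs)) (r i _)) , q) (does-rd (tag (inj₁ i)) (lookups σ xs))
    does-evaluate σ (neg φ) r = does-ite (does-evaluate σ φ r)
      (λ μ' (p , s) → does-ret false (cong not p , s)) (λ μ' (p , s) → does-ret true (cong not p , s))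
    does-evaluate σ (or φ ψ) {ρ} r = does-ite (does-evaluate σ φ r)
      (λ μ' (p , s) → does-ret true (cong (_∨ satFO 𝒜 ψ (lookups ρ σ)) p , s))
      (λ μ' (p , s) → does-imp (λ b μ'' (p' , s') → trans p' (cong (_∨ satFO 𝒜 ψ (lookups ρ σ)) p) , same-trans s s')
        (does-evaluate σ ψ (Frame-Rel (Same⇒Frame s) r)))
    does-evaluate {m} {m'} σ (ex φ) {ρ} {μ} r = does-by (runs-any (Same μ) (λ a → satFO 𝒜 φ (a ∷ lookups ρ σ))
      (λ a μ' s → runs (does-imp (λ b μ'' (p , s') → trans p (cong (satFO 𝒜 φ) (env a)) , same-trans s s')
        (does-evaluate (zero ∷ Vec.map suc σ) φ (Frame-Rel (Same⇒Frame s) r)))) (allFin n) μ same-refl)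
      where
      env : ∀ a → lookups (a ∷ ρ) (zero ∷ Vec.map suc σ) ≡ a ∷ lookups ρ σ
      env a = cong (a ∷_) (sym (VecP.map-∘ (lookup (a ∷ ρ)) suc σ))
    does-evaluate σ tt r = does-ret true (refl , same-refl)
    does-evaluate σ ff r = does-ret false (refl , same-refl)

    den-weaken : ∀ {k m} (t : Vec (Fin n) k) (ρ : Vec (Fin n) m) v → den (t ⊕ᵛ ρ) (weaken k v) ≡ den ρ v
    den-weaken t ρ (X , xs) = cong (X ,_) (lookups-wk t ρ xs)

    den-tupleVar : ∀ X {m} (t : Vec (Fin n) (soArity Δ X)) (ρ : Vec (Fin n) m) → den (t ⊕ᵛ ρ) (tupleVar X) ≡ (X , t)
    den-tupleVar X t ρ = cong (X ,_) (lookups-tupleVars t ρ)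

    does-rdC : ∀ {m} (l l' : SLit m) {ρ : Vec (Fin n) m} {μ} → Does (rdC l l') ρ μ (λ b μ' → b ≡ cl μ (denL ρ l) (denL ρ l') × Same μ μ')
    does-rdC (s , X , xs) (s' , X' , xs') {ρ} {μ} = does-imp (λ b μ' (p , q) → trans p (cong (bit μ) (clAddr-den ρ s X xs s' X' xs')) , q)
      (does-rd (tag (inj₂ (clN s X s' X'))) (xs Vec.++ xs'))

    cl-same : ∀ {μ μ'} → Same μ μ' → ∀ a b → cl μ' a b ≡ cl μ a b
    cl-same s a b = Same.bits s _

    does-or : ∀ {m} {A B : Prog m} {ρ : Vec (Fin n) m} {μ} {x y : Mem → Bool} → (∀ {μ'} → Same μ μ' → y μ' ≡ y μ) →
      Does A ρ μ (λ b μ' → b ≡ x μ × Same μ μ') → (∀ {μ'} → Does B ρ μ' (λ b μ'' → b ≡ y μ' × Same μ' μ'')) →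
      Does (ite A (ret true) B) ρ μ (λ b μ' → b ≡ x μ ∨ y μ × Same μ μ')
    does-or {μ = μ} {y = y} h dA dB = does-ite dA (λ μ' (p , s) → does-ret true (cong (_∨ y μ) p , s))
      (λ μ' (p , s) → does-imp (λ b μ'' (p' , s') → trans p' (trans (h s) (cong (_∨ y μ) p)) , same-trans s s') dB)

    does-rdSym : ∀ {m} (l l' : SLit m) {ρ : Vec (Fin n) m} {μ} → Does (rdSym l l') ρ μ (λ b μ' → b ≡ sym∨ (cl μ) (denL ρ l) (denL ρ l') × Same μ μ')
    does-rdSym l l' {ρ} = does-or {x = λ μ → cl μ (denL ρ l) (denL ρ l')} {y = λ μ → cl μ (denL ρ l') (denL ρ l)} (λ s → cl-same s (denL ρ l') (denL ρ l)) (does-rdC l l') (does-rdC l' l)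

    record Wrote (v : Bool) (a b : Lit) (μ μ' : Mem) : Set where
      constructor wrote
      field
        framed : Frame μ μ'
        at-ab  : cl μ' a b ≡ v
        either : ∀ a' b' → cl μ' a' b' ≡ cl μ a' b' ⊎ (a' ≡ a × b' ≡ b)

    does-wrC : ∀ {m} v s X (xs : Vec (Fin m) (soArity Δ X)) s' X' (xs' : Vec (Fin m) (soArity Δ X')) {ρ : Vec (Fin n) m} {μ} →
      Does (wr (tag (inj₂ (clN s X s' X'))) (xs Vec.++ xs') v) ρ μ
        (λ b μ' → b ≡ false × Wrote v (denL ρ (s , X , xs)) (denL ρ (s' , X' , xs')) μ μ')
    does-wrC v s X xs s' X' xs' {ρ} {μ} = does-imp post (does-wr (tag (inj₂ (clN s X s' X'))) (xs Vec.++ xs') v)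
      where
      a = denL ρ (s , X , xs)
      b = denL ρ (s' , X' , xs')
      c = lookups ρ (xs Vec.++ xs')
      post : ∀ r μ' → r ≡ false × Written (address (tag (inj₂ (clN s X s' X'))) (lookups ρ (xs Vec.++ xs'))) v μ μ' → r ≡ false × Wrote v a b μ μ'
      post r μ' (p , w) = p , wrote
        (frame (λ i t → Written.others w _ λ e → absurd₁ (addr-name {t = t} {c} e))
          (λ u → Written.others w _ λ e → absurd₂ (addr-name {t = proj₂ u} {c} e))
          (λ u → Written.others w _ λ e → absurd₃ (addr-name {t = proj₂ u} {c} e)))
        (trans (cong (bit μ') (sym (clAddr-den ρ s X xs s' X' xs'))) (Written.here-bit w))
        (λ a' b' → split? a' b' (clAddr a' b' ≟ address (tag (inj₂ (clN s X s' X'))) (lookups ρ (xs Vec.++ xs'))))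
        where
        absurd₁ : ∀ {i} {nm : BlockName Δ} → _≡_ {A = Name} (inj₁ i) (inj₂ nm) → ⊥
        absurd₁ ()
        absurd₂ : ∀ {Y} → _≡_ {A = Name} (inj₂ (asN Y)) (inj₂ (clN s X s' X')) → ⊥
        absurd₂ ()
        absurd₃ : ∀ {Y} → _≡_ {A = Name} (inj₂ (vaN Y)) (inj₂ (clN s X s' X')) → ⊥
        absurd₃ ()
        split? : ∀ a' b' → Dec (clAddr a' b' ≡ address (tag (inj₂ (clN s X s' X'))) (lookups ρ (xs Vec.++ xs'))) →
          cl μ' a' b' ≡ cl μ a' b' ⊎ (a' ≡ a × b' ≡ b)
        split? a' b' (yes e) = inj₂ (clAddr-injective a' b' a b (trans e (clAddr-den ρ s X xs s' X' xs')))
        split? a' b' (no e)  = inj₁ (Written.others w _ e)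

    does-addC : ∀ {m} (l l' : SLit m) {ρ : Vec (Fin n) m} {μ} → Does (addC l l') ρ μ (λ b μ' → b ≡ false × Wrote true (denL ρ l) (denL ρ l') μ μ')
    does-addC (s , X , xs) (s' , X' , xs') = does-wrC true s X xs s' X' xs'

    does-clearC : ∀ {m} (l l' : SLit m) {ρ : Vec (Fin n) m} {μ} → Does (clearC l l') ρ μ (λ b μ' → b ≡ false × Wrote false (denL ρ l) (denL ρ l') μ μ')
    does-clearC (s , X , xs) (s' , X' , xs') = does-wrC false s X xs s' X' xs'

    -- `M` is the class of intended models: clauses accumulate, and none is added that loses such a
    -- model. For resolution `M` holds of all assignments, since resolvents follow from the clauses
    -- alone.
    record Grow (M : SOEnv n Δ → Set) (μ μ' : Mem) : Set where
      constructor grow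
      field
        framed : Frame μ μ'
        incr   : cl μ ⊆ᶜ cl μ'
        sound  : ∀ V → M V → Sat (cl μ) V → Sat (cl μ') V

    Same⇒Grow : ∀ {M μ μ'} → Same μ μ' → Grow M μ μ'
    Same⇒Grow s = grow (Same⇒Frame s) (λ a b e → trans (cl-same s a b) e) (λ V _ h a b e → h a b (trans (sym (cl-same s a b)) e))

    Grow-preorder : ∀ M → Preorder (Grow M)
    Grow-preorder M = record
      { reflexive = Same⇒Grow same-refl
      ; transitive = λ (grow f i s) (grow f' i' s') → grow (Frame-trans f f') (λ a b e → i' a b (i a b e)) (λ V m h → s' V m (s V m h)) }

    Grow-trans : ∀ {M μ μ' μ''} → Grow M μ μ' → Grow M μ' μ'' → Grow M μ μ''
    Grow-trans {M} = Preorder.transitive (Grow-preorder M)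

    Wrote⇒Grow : ∀ {M a b μ μ'} → (∀ V → M V → Sat (cl μ) V → val V a ∨ val V b ≡ true) → Wrote true a b μ μ' → Grow M μ μ'
    Wrote⇒Grow {M} {a} {b} {μ} {μ'} h (wrote f e either) = grow f incr sound
      where
      incr : cl μ ⊆ᶜ cl μ'
      incr a' b' p with either a' b'
      ... | inj₁ q             = trans q p
      ... | inj₂ (refl , refl) = e
      sound : ∀ V → M V → Sat (cl μ) V → Sat (cl μ') V
      sound V m s a' b' p with either a' b'
      ... | inj₁ q             = s a' b' (trans (sym q) p)
      ... | inj₂ (refl , refl) = h V m s

    sem-forVars : ∀ {m} (P : (X : Fin (length Δ)) → Prog (soArity Δ X ⊕ m)) κ (ρ : Vec (Fin n) m) μ →
      sem (forVars P) κ ρ μ ≡ iter (λ (X , t) κ → sem (P X) κ (t ⊕ᵛ ρ)) (vars n Δ) κ μ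
    sem-forVars P κ ρ μ = trans (sem-anyOf (λ X → nest (soArity Δ X) (P X)) (ordered Δ) κ ρ μ)
      (trans (iter-cong (λ X → sem-ext (nest (soArity Δ X) (P X)) ρ)
          (λ X κ μ → trans (sem-nest (soArity Δ X) (P X) κ ρ μ) (sym (iter-map body-ext (X ,_) (allTuples n (soArity Δ X)) κ μ)))
          (ordered Δ) κ μ)
        (sym (iter-concatMap body-ext (λ X → map (X ,_) (allTuples n (soArity Δ X))) (ordered Δ) κ μ)))
      where
      body : V' → Cont → Mem → ℕ
      body (X , t) κ = sem (P X) κ (t ⊕ᵛ ρ)
      body-ext : Extensional body
      body-ext (X , t) = sem-ext (P X) (t ⊕ᵛ ρ)

    does-forVars : ∀ {m} {P : (X : Fin (length Δ)) → Prog (soArity Δ X ⊕ m)} {ρ : Vec (Fin n) m} {μ Post} →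
      Runs (iter (λ (X , t) κ → sem (P X) κ (t ⊕ᵛ ρ)) (vars n Δ)) μ Post → Does (forVars P) ρ μ Post
    does-forVars {P = P} {ρ} {μ} (b , μ' , e , p) = does-by (b , μ' , (λ κ → trans (sem-forVars P κ ρ μ) (e κ)) , p)

    vars-forall : ∀ {m} {P : (X : Fin (length Δ)) → Prog (soArity Δ X ⊕ m)} {ρ : Vec (Fin n) m} {Step} → Preorder Step →
      (D : V' → Mem → Set) → (∀ {a μ μ'} → Step μ μ' → D a μ → D a μ') → ∀ {μ₀} →
      (∀ X t μ → Step μ₀ μ → Does (P X) (t ⊕ᵛ ρ) μ (λ b μ' → b ≡ false × Step μ μ' × D (X , t) μ')) →
      Does (forVars P) ρ μ₀ (λ b μ' → b ≡ false × Step μ₀ μ' × ∀ v → D v μ')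
    vars-forall {P = P} {ρ} pre D stable {μ₀} h = does-imp finish (does-forVars
      (runs-forall pre D stable ⊥ (vars n Δ) μ₀
        (λ (X , t) μ _ s → runs (does-imp (λ { false μ' (_ , s' , d) → s' , d }) (h X t μ s)))))
      where
      finish : ∀ b μ' → _ × (if b then ⊥ else (∀ v → v ∈ vars n Δ → D v μ')) → b ≡ false × _ × ∀ v → D v μ'
      finish false μ' (s , d) = refl , s , λ v → d v (∈-vars Δ v)

    lits-forall : ∀ {m} {P : (s : Bool) (X : Fin (length Δ)) → Prog (soArity Δ X ⊕ m)} {ρ : Vec (Fin n) m} {Step} → Preorder Step →
      (D : Lit → Mem → Set) → (∀ {a μ μ'} → Step μ μ' → D a μ → D a μ') → ∀ {μ₀} →
      (∀ s X t μ → Step μ₀ μ → Does (P s X) (t ⊕ᵛ ρ) μ (λ b μ' → b ≡ false × Step μ μ' × D (s , X , t) μ')) →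
      Does (forLits P) ρ μ₀ (λ b μ' → b ≡ false × Step μ₀ μ' × ∀ l → D l μ')
    lits-forall pre D stable h = does-imp (λ b μ' (e , s , d) → e , s , λ { (true , v) → proj₁ (d v) ; (false , v) → proj₂ (d v) })
      (vars-forall pre (λ v μ → D (true , v) μ × D (false , v) μ) (λ s (d , d') → stable s d , stable s d')
        (λ X t μ s → does-ite (h true X t μ s) (λ { μ' (() , _) })
          (λ μ' (_ , s' , d) → does-imp (λ b μ'' (e , s'' , d') → e , transitive s' s'' , stable s'' d , d') (h false X t μ' (transitive s s')))))
      where open Preorder pre

    does-clear : ∀ {m} {ρ : Vec (Fin n) m} {μ} → Does clearP ρ μ (λ b μ' → b ≡ false × Frame μ μ' × ∀ a b → cl μ' a b ≡ false)
    does-clear {ρ = ρ} = does-imp (λ b μ' (e , (f , _) , d) → e , f , d)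
      (lits-forall shrink-preorder (λ a μ → ∀ b → cl μ a b ≡ false) (λ s d b → shrunk s _ b (d b))
        (λ s X t μ _ → lits-forall shrink-preorder (λ b μ → cl μ (s , X , t) b ≡ false) (λ s' d → shrunk s' _ _ d)
          (λ s' Y u μ' _ → does-imp (λ b μ'' (e , w) → e , clears w ,
              subst₂ (λ x y → cl μ'' x y ≡ false)
                (cong (s ,_) (trans (den-weaken u (t ⊕ᵛ ρ) (tupleVar X)) (den-tupleVar X t ρ)))
                (cong (s' ,_) (den-tupleVar Y u (t ⊕ᵛ ρ))) (Wrote.at-ab w))
            (does-clearC (weakenL (soArity Δ Y) (s , tupleVar X)) (s' , tupleVar Y)))))
      where
      -- While clearing, the matrix only shrinks, so entries once cleared stay so.
      Shrink : Mem → Mem → Set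
      Shrink μ μ' = Frame μ μ' × cl μ' ⊆ᶜ cl μ
      shrunk : ∀ {μ μ'} → Shrink μ μ' → ∀ a b → cl μ a b ≡ false → cl μ' a b ≡ false
      shrunk (_ , h) a b e = false-unless (λ p → true≢false (h a b p) e)
      shrink-preorder : Preorder Shrink
      shrink-preorder = record
        { reflexive = Frame-refl , (λ _ _ e → e)
        ; transitive = λ (f , h) (f' , h') → Frame-trans f f' , (λ a b e → h a b (h' a b e)) }
      clears : ∀ {a b μ μ'} → Wrote false a b μ μ' → Shrink μ μ'
      clears {a} {b} {μ} {μ'} (wrote f e either) = f , sub
        where
        sub : cl μ' ⊆ᶜ cl μ
        sub a' b' p with either a' b'
        ... | inj₁ q             = trans (sym q) p
        ... | inj₂ (refl , refl) = true≢false p e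

    Sat-anti : ∀ {C C' V} → C ⊆ᶜ C' → Sat C' V → Sat C V
    Sat-anti h s a b e = s a b (h a b e)

    litCount : ∀ {m} → List (Component τ m Δ) → ℕ
    litCount []           = 0
    litCount (lit _ ∷ cs) = suc (litCount cs)
    litCount (fo _ ∷ cs)  = litCount cs

    Holds : ∀ {m m'} → Vec (Fin m') m → Vec (Fin n) m' → List (Component τ m Δ) → List (SLit m') → SOEnv n Δ → Set
    Holds σ ρ cs ls V = Any (λ l → val V (denL ρ l) ≡ true) ls ⊎ Any (λ c → satComp 𝒜 c (lookups ρ σ) V ≡ true) cs

    val-slit : ∀ {m m'} (σ : Vec (Fin m') m) (ρ : Vec (Fin n) m') x V → val V (denL ρ (slit σ x)) ≡ satLit 𝒜 x (lookups ρ σ) V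
    val-slit σ ρ (pos X xs) V = cong (V X) (lookups-lookups ρ σ xs)
    val-slit σ ρ (neg X xs) V = cong (λ t → not (V X t)) (lookups-lookups ρ σ xs)

    -- Moving a literal from `cs` to `ls` preserves the bound 2, so three collected literals are
    -- contradictory. The answer `true` means that nothing is left that could hold, whence there is
    -- no intended model.
    does-addClause : ∀ {M : SOEnv n Δ → Set} {m m'} (σ : Vec (Fin m') m) cs ls {ρ : Vec (Fin n) m'} {μ} →
      litCount cs + length ls ≤ 2 → Rel μ → (∀ V → M V → Holds σ ρ cs ls V) →
      Does (addClause σ cs ls) ρ μ (λ b μ' → Grow M μ μ' × (if b then (∀ V → ¬ M V) else (∀ V → Sat (cl μ') V → Holds σ ρ cs ls V)))
    does-addClause σ [] [] c r h = does-ret true (Same⇒Grow same-refl , λ V m → empty (h V m))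
      where
      empty : ∀ {A B : Set} {P : A → Set} {Q : B → Set} → ¬ (Any P [] ⊎ Any Q [])
      empty (inj₁ ())
      empty (inj₂ ())
    does-addClause {M} σ [] (l ∷ []) {ρ} {μ} c r h = does-imp
      (λ { false μ' (_ , w) → Wrote⇒Grow (λ V m _ → ∨-trueˡ (val V (denL ρ l)) (only (h V m))) w ,
             λ V s → inj₁ (here (trans (sym (∨-idem (val V (denL ρ l)))) (s _ _ (Wrote.at-ab w)))) })
      (does-addC l l)
      where
      only : ∀ {V} → Holds σ ρ [] (l ∷ []) V → val V (denL ρ l) ≡ true
      only (inj₁ (here e)) = e
    does-addClause {M} σ [] (l ∷ l' ∷ []) {ρ} {μ} c r h = does-imp
      (λ { false μ' (_ , w) → Wrote⇒Grow (λ V m _ → some V (h V m)) w , λ V s → which V (∨-true {val V (denL ρ l)} (s _ _ (Wrote.at-ab w))) })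
      (does-addC l l')
      where
      some : ∀ V → Holds σ ρ [] (l ∷ l' ∷ []) V → val V (denL ρ l) ∨ val V (denL ρ l') ≡ true
      some V (inj₁ (here e))         = ∨-trueˡ _ e
      some V (inj₁ (there (here e))) = ∨-trueʳ (val V (denL ρ l)) e
      which : ∀ V → val V (denL ρ l) ≡ true ⊎ val V (denL ρ l') ≡ true → Holds σ ρ [] (l ∷ l' ∷ []) V
      which V (inj₁ e) = inj₁ (here e)
      which V (inj₂ e) = inj₁ (there (here e))
    does-addClause σ [] (l ∷ l' ∷ _ ∷ _) (s≤s (s≤s ())) r h
    does-addClause {M} σ (lit x ∷ cs) ls {ρ} {μ} c r h = does-imp
      (λ { true μ' p → p ; false μ' (g , d) → g , λ V s → recover V (d V s) })
      (does-addClause σ cs (slit σ x ∷ ls) (≤-trans (≤-reflexive (+-suc (litCount cs) (length ls))) c) r (λ V m → forth V (h V m)))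
      where
      forth : ∀ V → Holds σ ρ (lit x ∷ cs) ls V → Holds σ ρ cs (slit σ x ∷ ls) V
      forth V (inj₁ i)         = inj₁ (there i)
      forth V (inj₂ (here e))  = inj₁ (here (trans (val-slit σ ρ x V) e))
      forth V (inj₂ (there i)) = inj₂ i
      recover : ∀ V → Holds σ ρ cs (slit σ x ∷ ls) V → Holds σ ρ (lit x ∷ cs) ls V
      recover V (inj₁ (here e))  = inj₂ (here (trans (sym (val-slit σ ρ x V)) e))
      recover V (inj₁ (there i)) = inj₁ i
      recover V (inj₂ i)         = inj₂ (there i)
    does-addClause {M} σ (fo φ ∷ cs) ls {ρ} {μ} c r h = does-ite (does-evaluate σ φ r)
      (λ μ' (e , s) → does-ret false (Same⇒Grow s , λ V _ → inj₂ (here (sym e))))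
      (λ μ' (e , s) → does-imp
        (λ { true μ'' (g , q) → Grow-trans (Same⇒Grow s) g , q
           ; false μ'' (g , d) → Grow-trans (Same⇒Grow s) g , λ V s' → recover V (d V s') })
        (does-addClause σ cs ls c (Frame-Rel (Same⇒Frame s) r) (λ V m → forth V e (h V m))))
      where
      forth : ∀ V → false ≡ satFO 𝒜 φ (lookups ρ σ) → Holds σ ρ (fo φ ∷ cs) ls V → Holds σ ρ cs ls V
      forth V e (inj₁ i)         = inj₁ i
      forth V e (inj₂ (here p))  = true≢false p (sym e)
      forth V e (inj₂ (there i)) = inj₂ i
      recover : ∀ V → Holds σ ρ cs ls V → Holds σ ρ (fo φ ∷ cs) ls V
      recover V (inj₁ i) = inj₁ i
      recover V (inj₂ i) = inj₂ (there i)

    -- The restriction to 2SAT clauses enters here, and only here.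
    two-literals : ∀ {m} (C : Clause τ m Δ) → litCount (components C) + 0 ≤ 2
    two-literals record { φ₁ = fo _  ; φ₂ = fo _  ; φ₃ = fo _ }  = z≤n
    two-literals record { φ₁ = fo _  ; φ₂ = fo _  ; φ₃ = lit _ } = s≤s z≤n
    two-literals record { φ₁ = fo _  ; φ₂ = lit _ ; φ₃ = fo _ }  = s≤s z≤n
    two-literals record { φ₁ = fo _  ; φ₂ = lit _ ; φ₃ = lit _ } = s≤s (s≤s z≤n)
    two-literals record { φ₁ = lit _ ; φ₂ = fo _  ; φ₃ = fo _ }  = s≤s z≤n
    two-literals record { φ₁ = lit _ ; φ₂ = fo _  ; φ₃ = lit _ } = s≤s (s≤s z≤n)
    two-literals record { φ₁ = lit _ ; φ₂ = lit _ ; φ₃ = fo _ }  = s≤s (s≤s z≤n)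
    two-literals record { φ₁ = lit _ ; φ₂ = lit _ ; φ₃ = lit _ ; someFO = inj₁ () }
    two-literals record { φ₁ = lit _ ; φ₂ = lit _ ; φ₃ = lit _ ; someFO = inj₂ (inj₁ ()) }
    two-literals record { φ₁ = lit _ ; φ₂ = lit _ ; φ₃ = lit _ ; someFO = inj₂ (inj₂ ()) }

    clause-Holds : ∀ {m m'} (σ : Vec (Fin m') m) ρ C V → satClause 𝒜 C (lookups ρ σ) V ≡ true → Holds σ ρ (components C) [] V
    clause-Holds σ ρ C V e with ∨-true {satComp 𝒜 (Clause.φ₁ C) (lookups ρ σ) V} e
    ... | inj₁ p = inj₂ (here p)
    ... | inj₂ p with ∨-true {satComp 𝒜 (Clause.φ₂ C) (lookups ρ σ) V} p
    ...   | inj₁ q = inj₂ (there (here q))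
    ...   | inj₂ q = inj₂ (there (there (here q)))

    Holds-clause : ∀ {m m'} (σ : Vec (Fin m') m) ρ C V → Holds σ ρ (components C) [] V → satClause 𝒜 C (lookups ρ σ) V ≡ true
    Holds-clause σ ρ C V (inj₂ (here p))                 = ∨-trueˡ _ p
    Holds-clause σ ρ C V (inj₂ (there (here p)))         = ∨-trueʳ (satComp 𝒜 (Clause.φ₁ C) (lookups ρ σ) V) (∨-trueˡ _ p)
    Holds-clause σ ρ C V (inj₂ (there (there (here p)))) =
      ∨-trueʳ (satComp 𝒜 (Clause.φ₁ C) (lookups ρ σ) V) (∨-trueʳ (satComp 𝒜 (Clause.φ₂ C) (lookups ρ σ) V) p)

    SatClauses : ∀ {m} b → List (Clause τ (b + m) Δ) → Vec (Fin n) m → SOEnv n Δ → Set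
    SatClauses b Cs ρ V = ∀ (ys : Vec (Fin n) b) C → C ∈ Cs → satClause 𝒜 C (ys Vec.++ ρ) V ≡ true

    Unsat∨ : (SOEnv n Δ → Set) → Bool → Set → Set
    Unsat∨ M b P = if b then (∀ V → ¬ M V) else P

    does-clauses : ∀ {M : SOEnv n Δ → Set} {m m'} b (σ : Vec (Fin m') m) Cs {ρ : Vec (Fin n) m'} {μ} → Rel μ →
      (∀ V → M V → SatClauses b Cs (lookups ρ σ) V) →
      Does (clausesP b σ Cs) ρ μ (λ r μ' → Grow M μ μ' × Unsat∨ M r (∀ V → Sat (cl μ') V → SatClauses b Cs (lookups ρ σ) V))
    does-clauses {M} b σ Cs {ρ} {μ} r h = does-imp post (does-nest b
      (runs-forall (Grow-preorder M) (λ ys μ → ∀ C → C ∈ Cs → D C ys μ) (λ {ys} g d C i → stable {C} {ys} g (d C i)) (∀ V → ¬ M V) (allTuples n b) μ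
        (λ ys μ₁ _ g → runs (does-anyOf {P = clauseP} {as = Cs} {ρ = ys ⊕ᵛ ρ} (runs-forall (Grow-preorder M) (λ C μ → D C ys μ)
          (λ {C} → stable {C} {ys}) (∀ V → ¬ M V) Cs μ₁ (λ C μ₂ i g' → runs (one ys C μ₂ i (Grow-trans g g'))))))))
      where
      clauseP : Clause τ _ Δ → Prog _
      clauseP C = addClause (extendVars b σ) (components C) []
      D : Clause τ _ Δ → Vec (Fin n) b → Mem → Set
      D C ys μ = ∀ V → Sat (cl μ) V → satClause 𝒜 C (ys Vec.++ lookups ρ σ) V ≡ true
      stable : ∀ {C ys μ μ'} → Grow M μ μ' → D C ys μ → D C ys μ'
      stable g d V s = d V (Sat-anti (Grow.incr g) s)
      env : ∀ ys → lookups (ys ⊕ᵛ ρ) (extendVars b σ) ≡ ys Vec.++ lookups ρ σ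
      env ys = lookups-extendVars ys ρ σ
      one : ∀ ys C μ₂ → C ∈ Cs → Grow M μ μ₂ →
        Does (clauseP C) (ys ⊕ᵛ ρ) μ₂ (λ r μ₃ → Grow M μ₂ μ₃ × (if r then (∀ V → ¬ M V) else D C ys μ₃))
      one ys C μ₂ i g = does-imp
        (λ { true μ₃ p → p
           ; false μ₃ (g' , d) → g' , λ V s → subst (λ z → satClause 𝒜 C z V ≡ true) (env ys) (Holds-clause (extendVars b σ) (ys ⊕ᵛ ρ) C V (d V s)) })
        (does-addClause (extendVars b σ) (components C) [] (two-literals C) (Frame-Rel (Grow.framed g) r)
          (λ V m → clause-Holds (extendVars b σ) (ys ⊕ᵛ ρ) C V (subst (λ z → satClause 𝒜 C z V ≡ true) (sym (env ys)) (h V m ys C i))))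
      post : ∀ r μ' → Grow M μ μ' × (if r then (∀ V → ¬ M V) else (∀ ys → ys ∈ allTuples n b → ∀ C → C ∈ Cs → D C ys μ')) →
        Grow M μ μ' × Unsat∨ M r (∀ V → Sat (cl μ') V → SatClauses b Cs (lookups ρ σ) V)
      post true  μ' p       = p
      post false μ' (g , d) = g , λ V s ys C i → d ys (∈-allTuples ys) C i V s

    Extends : (V' → Bool) → (V' → Bool) → SOEnv n Δ → Set
    Extends A W V = ∀ v → A v ≡ true → V (proj₁ v) (proj₂ v) ≡ W v

    does-unit : ∀ {M : SOEnv n Δ → Set} {m} (v : SVar m) {ρ : Vec (Fin n) m} {μ} →
      (∀ V → M V → Extends (asg μ) (vl μ) V) →
      Does (unitP v) ρ μ (λ b μ' → b ≡ false × Grow M μ μ' ×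
        (∀ V → Sat (cl μ') V → asg μ (den ρ v) ≡ true → V (proj₁ v) (lookups ρ (proj₂ v)) ≡ vl μ (den ρ v)))
    does-unit {M} (X , xs) {ρ} {μ} h = does-ite (does-rd (tag (inj₂ (asN X))) xs)
      (λ μ₁ (e , s) → does-ite (does-rd (tag (inj₂ (vaN X))) xs)
        (λ μ₂ (e' , s') → does-imp
          (λ b μ₃ (p , w) → p , Grow-trans (Same⇒Grow (same-trans s s')) (Wrote⇒Grow (λ V m _ → ∨-trueˡ _ (trans (h V m v (sym e)) (trans (sym (Same.bits s _)) (sym e')))) w) ,
            λ V sat _ → trans (trans (sym (∨-idem (V X t))) (sat _ _ (Wrote.at-ab w))) (trans e' (Same.bits s _)))
          (does-addC (true , X , xs) (true , X , xs)))
        (λ μ₂ (e' , s') → does-imp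
          (λ b μ₃ (p , w) → p , Grow-trans (Same⇒Grow (same-trans s s')) (Wrote⇒Grow (λ V m _ → ∨-trueˡ _ (cong not (trans (h V m v (sym e)) (trans (sym (Same.bits s _)) (sym e'))))) w) ,
            λ V sat _ → trans (not-true (trans (sym (∨-idem (not (V X t)))) (sat _ _ (Wrote.at-ab w)))) (trans e' (Same.bits s _)))
          (does-addC (false , X , xs) (false , X , xs))))
      (λ μ₁ (e , s) → does-ret false (refl , Same⇒Grow s , λ V _ p → true≢false p (sym e)))
      where
      t = lookups ρ xs
      v : V'
      v = X , t

    does-units : ∀ {M : SOEnv n Δ → Set} {m} {ρ : Vec (Fin n) m} {μ} → (∀ V → M V → Extends (asg μ) (vl μ) V) →
      Does unitsP ρ μ (λ b μ' → b ≡ false × Grow M μ μ' × (∀ V → Sat (cl μ') V → Extends (asg μ) (vl μ) V))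
    does-units {M} {ρ = ρ} {μ} h = does-imp (λ b μ' (e , g , d) → e , g , λ V s v → d v V s)
      (vars-forall (Grow-preorder M) D (λ g d V s → d V (Sat-anti (Grow.incr g) s))
        (λ X t μ₁ g → does-imp
          (λ b μ₂ (e , g' , d) → e , g' , λ V s a → subst (λ u → V X u ≡ vl μ (X , t)) (lookups-tupleVars t ρ)
            (trans (d V s (trans (Frame.asgs (Grow.framed g) _) (trans (cong (asg μ) (den-tupleVar X t ρ)) a)))
              (trans (Frame.vals (Grow.framed g) _) (cong (vl μ) (den-tupleVar X t ρ)))))
          (does-unit (tupleVar X) (λ V m v a → trans (h V m v (trans (sym (Frame.asgs (Grow.framed g) v)) a)) (sym (Frame.vals (Grow.framed g) v))))))
      where
      D : V' → Mem → Set
      D v μ' = ∀ V → Sat (cl μ') V → asg μ v ≡ true → V (proj₁ v) (proj₂ v) ≡ vl μ v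

    Always : SOEnv n Δ → Set
    Always _ = ⊤

    does-resolve : ∀ {m} (v : SVar m) (a b : SLit m) {ρ : Vec (Fin n) m} {μ} →
      Does (resolveP v a b) ρ μ (λ r μ' → r ≡ false × Grow Always μ μ' ×
        (PosWith (den ρ v) (cl μ) (denL ρ a) ≡ true → NegWith (den ρ v) (cl μ) (denL ρ b) ≡ true → cl μ' (denL ρ a) (denL ρ b) ≡ true))
    does-resolve v a b {ρ} {μ} = does-ite
      (does-or {x = λ μ → sym∨ (cl μ) (denL ρ a) (true , den ρ v)} {y = λ μ → cl μ (true , den ρ v) (true , den ρ v)}
        (λ s → cl-same s _ _) (does-rdSym a (true , v)) (does-rdC (true , v) (true , v)))
      (λ μ₁ (p , s) → does-ite
        (does-or {x = λ μ → sym∨ (cl μ) (false , den ρ v) (denL ρ b)} {y = λ μ → cl μ (false , den ρ v) (false , den ρ v)}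
          (λ s → cl-same s _ _) (does-rdSym (false , v) b) (does-rdC (false , v) (false , v)))
        (λ μ₂ (q , s') → does-imp
          (λ r μ₃ (e , w) → e , Grow-trans (Same⇒Grow (same-trans s s')) (Wrote⇒Grow (λ V _ sat → resolution-sound {V = V} (den ρ v) (denL ρ a) (denL ρ b) sat
              (PosWith-mono {cl μ} {cl μ₂} (den ρ v) (same⊆ (same-trans s s')) (denL ρ a) (sym p))
              (NegWith-mono {cl μ₁} {cl μ₂} (den ρ v) (same⊆ s') (denL ρ b) (sym q))) w) ,
            λ _ _ → Wrote.at-ab w)
          (does-addC a b))
        (λ μ₂ (q , s') → does-ret false (refl , Same⇒Grow (same-trans s s') ,
          λ _ q' → true≢false (NegWith-mono {cl μ} {cl μ₁} (den ρ v) (same⊆ s) (denL ρ b) q') (sym q))))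
      (λ μ₁ (p , s) → does-ret false (refl , Same⇒Grow s , λ p' _ → true≢false p' (sym p)))
      where
      same⊆ : ∀ {μ μ'} → Same μ μ' → cl μ ⊆ᶜ cl μ'
      same⊆ s a b e = trans (cl-same s a b) e

    does-eliminate : ∀ {m} (v : SVar m) {ρ : Vec (Fin n) m} {μ} →
      Does (eliminateP v) ρ μ (λ r μ' → r ≡ false × Grow Always μ μ' ×
        (∀ a b → PosWith (den ρ v) (cl μ) a ≡ true → NegWith (den ρ v) (cl μ) b ≡ true → cl μ' a b ≡ true))
    does-eliminate v {ρ} {μ} = lits-forall (Grow-preorder Always) (λ a μ' → ∀ b → D a b μ') (λ g d b → stable g (d b))
      (λ s Y t μ₁ g → lits-forall (Grow-preorder Always) (D (s , Y , t)) stable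
        (λ s' Z u μ₂ g' → does-imp
          (λ r μ₃ (e , g'' , d) → e , g'' , transfer
            (trans (den-weaken u (t ⊕ᵛ ρ) (weaken (soArity Δ Y) v)) (den-weaken t ρ v))
            (cong (s ,_) (trans (den-weaken u (t ⊕ᵛ ρ) (tupleVar Y)) (den-tupleVar Y t ρ)))
            (cong (s' ,_) (den-tupleVar Z u (t ⊕ᵛ ρ))) g g' d)
          (does-resolve (weaken (soArity Δ Z) (weaken (soArity Δ Y) v)) (weakenL (soArity Δ Z) (s , tupleVar Y)) (s' , tupleVar Z))))
      where
      w : V'
      w = den ρ v
      D : Lit → Lit → Mem → Set
      D a b μ' = PosWith w (cl μ) a ≡ true → NegWith w (cl μ) b ≡ true → cl μ' a b ≡ true
      stable : ∀ {a b μ₁ μ₂} → Grow Always μ₁ μ₂ → D a b μ₁ → D a b μ₂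
      stable g d p q = Grow.incr g _ _ (d p q)
      transfer : ∀ {x a b a' b' μ₁ μ₂ μ₃} → x ≡ w → a ≡ a' → b ≡ b' → Grow Always μ μ₁ → Grow Always μ₁ μ₂ →
        (PosWith x (cl μ₂) a ≡ true → NegWith x (cl μ₂) b ≡ true → cl μ₃ a b ≡ true) → D a' b' μ₃
      transfer {μ₂ = μ₂} refl refl refl g g' d p q =
        d (PosWith-mono {cl μ} {cl μ₂} w (Grow.incr (Grow-trans g g')) _ p) (NegWith-mono {cl μ} {cl μ₂} w (Grow.incr (Grow-trans g g')) _ q)

    Satisfiable : List V' → Mem → Set
    Satisfiable vs μ = ∃ λ V → SatOn vs (cl μ) V

    -- The loop invariant: a solution of the current clauses over the variables still to be eliminated yields a solution
    -- of the initial clauses over all variables.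
    does-elimination : ∀ {m} {ρ : Vec (Fin n) m} {μ} →
      Does eliminationP ρ μ (λ r μ' → r ≡ false × Grow Always μ μ' × ((∀ v → ¬ Contradiction (cl μ') v) → Satisfiable (vars n Δ) μ))
    does-elimination {ρ = ρ} {μ} = does-imp post (does-forVars (runs-iter Inv (λ _ → ⊥) body (vars n Δ) μ (Same⇒Grow same-refl , λ _ _ _ s → s)))
      where
      Inv : List V' → Mem → Set
      -- Consistency is tested once, on the final matrix. The invariant therefore assumes it of an
      -- arbitrary larger matrix C, from which it is inherited by the current one.
      Inv vs μ' = Grow Always μ μ' × (∀ C → cl μ' ⊆ᶜ C → (∀ v → ¬ Contradiction C v) → Satisfiable vs μ' → Satisfiable (vars n Δ) μ)
      body : ∀ v vs μ₁ → Inv (v ∷ vs) μ₁ → Runs (λ κ → sem (eliminateP (tupleVar (proj₁ v))) κ (proj₂ v ⊕ᵛ ρ)) μ₁ (λ b μ₂ → if b then ⊥ else Inv vs μ₂)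
      body (X , t) vs μ₁ (g , recover) = runs (does-imp
        (λ { false μ₂ (_ , g' , res) → Grow-trans g g' , λ C sub con (V , s) →
               recover C (λ a b e → sub a b (Grow.incr g' a b e)) con
                 (eliminate (Grow.incr g') (subst (λ v → ∀ a b → PosWith v (cl μ₁) a ≡ true → NegWith v (cl μ₁) b ≡ true → cl μ₂ a b ≡ true) (den-tupleVar X t ρ) res)
                   (λ (p , q) → con (X , t) (sub _ _ (Grow.incr g' _ _ p) , sub _ _ (Grow.incr g' _ _ q))) s) })
        (does-eliminate (tupleVar X)))
      post : ∀ r μ' → (if r then ⊥ else Inv [] μ') → r ≡ false × Grow Always μ μ' × ((∀ v → ¬ Contradiction (cl μ') v) → Satisfiable (vars n Δ) μ)
      -- With no variable left any assignment is a solution, and the values are then restored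
      -- backwards.
      post false μ' (g , recover) = refl , g , λ con → recover (cl μ') (λ _ _ e → e) con ((λ _ _ → false) , λ a b ())

    does-contradiction : ∀ {m} {ρ : Vec (Fin n) m} {μ} →
      Does contradictionP ρ μ (λ r μ' → Same μ μ' × (if r then (∃ λ v → Contradiction (cl μ) v) else (∀ v → ¬ Contradiction (cl μ) v)))
    does-contradiction {ρ = ρ} {μ} = does-imp post (does-forVars (runs-any (Same μ) clash
      (λ (X , t) μ₁ s → runs (does-ite (does-rdC (true , tupleVar X) (true , tupleVar X))
        (λ μ₂ (e , s') → does-imp (λ b μ₃ (e' , s'') → trans e' (trans (here-cl X t false (same-trans s s')) (cong (_∧ cl μ (false , X , t) (false , X , t)) (trans e (here-cl X t true s)))) , same-trans (same-trans s s') s'')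
          (does-rdC (false , tupleVar X) (false , tupleVar X)))
        (λ μ₂ (e , s') → does-ret false (cong (_∧ cl μ (false , X , t) (false , X , t)) (trans e (here-cl X t true s)) , same-trans s s'))))
      (vars n Δ) μ same-refl))
      where
      clash : V' → Bool
      clash v = cl μ (true , v) (true , v) ∧ cl μ (false , v) (false , v)
      here-cl : ∀ X t s {μ'} → Same μ μ' → cl μ' (denL (t ⊕ᵛ ρ) (s , tupleVar X)) (denL (t ⊕ᵛ ρ) (s , tupleVar X)) ≡ cl μ (s , X , t) (s , X , t)
      here-cl X t s sm = trans (cl-same sm _ _) (cong (λ u → cl μ (s , X , u) (s , X , u)) (lookups-tupleVars t ρ))
      post : ∀ r μ' → r ≡ any clash (vars n Δ) × Same μ μ' → Same μ μ' × (if r then (∃ λ v → Contradiction (cl μ) v) else (∀ v → ¬ Contradiction (cl μ) v))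
      post true  μ' (e , s) with any-elim clash (vars n Δ) (sym e)
      ... | v , _ , p = s , v , ∧-true {cl μ (true , v) (true , v)} p
      post false μ' (e , s) = s , λ v (p , q) → true≢false (any-intro clash (vars n Δ) (∈-vars Δ v) (∧-both p q)) (sym e)

    does-sat : ∀ {m m'} b (σ : Vec (Fin m') m) Cs {ρ : Vec (Fin n) m'} {μ} → Rel μ →
      let M = λ V → Extends (asg μ) (vl μ) V × SatClauses b Cs (lookups ρ σ) V in
      Does (satP b σ Cs) ρ μ (λ r μ' → Frame μ μ' × (if r then ∃ M else (∀ V → ¬ M V)))
    does-sat b σ Cs {ρ} {μ} r = does-seq {Mid = λ μ₁ → Frame μ μ₁ × ∀ a b → cl μ₁ a b ≡ false} (does-imp (λ _ _ → proj₂) does-clear) λ μ₁ (f₁ , empty) →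
      does-ite (does-clauses {M} b σ Cs (Frame-Rel f₁ r) (λ V → proj₂))
        (λ μ₂ (g₂ , unsat) → does-ret false (Frame-trans f₁ (Grow.framed g₂) , unsat))
        (λ μ₂ (g₂ , clauses) → let f₂ = Frame-trans f₁ (Grow.framed g₂) in
          does-seq {Mid = λ μ₃ → Grow M μ₂ μ₃ × (∀ V → Sat (cl μ₃) V → Extends (asg μ₂) (vl μ₂) V)}
            (does-imp (λ _ _ → proj₂) (does-units {M} (λ V (x , _) → shift f₂ V x))) λ μ₃ (g₃ , units) →
          does-seq {Mid = λ μ₄ → Grow Always μ₃ μ₄ × ((∀ v → ¬ Contradiction (cl μ₄) v) → Satisfiable (vars n Δ) μ₃)}
            (does-imp (λ _ _ → proj₂) does-elimination) λ μ₄ (g₄ , solve) →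
          let f₄ = Frame-trans f₂ (Frame-trans (Grow.framed g₃) (Grow.framed g₄)) in
          does-ite does-contradiction
            (λ μ₅ (s₅ , v , p , q) → does-ret false (Frame-trans f₄ (Same⇒Frame s₅) , λ V m →
              -- An intended model satisfies the cleared matrix vacuously and hence every later one,
              -- but not two opposite unit clauses.
              clash V v (Grow.sound g₄ V tt (Grow.sound g₃ V m (Grow.sound g₂ V m (λ a b e → true≢false e (empty a b))))) p q))
            (λ μ₅ (s₅ , none) → does-ret true (Frame-trans f₄ (Same⇒Frame s₅) , let (V , s) = solve none in
              V , model f₂ g₃ clauses units V (λ a b e → s a b (∈-vars Δ _) (∈-vars Δ _) e))))
      where
      M : SOEnv n Δ → Set
      M V = Extends (asg μ) (vl μ) V × SatClauses b Cs (lookups ρ σ) V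
      shift : ∀ {μ'} → Frame μ μ' → ∀ V → Extends (asg μ) (vl μ) V → Extends (asg μ') (vl μ') V
      shift f V x v a = trans (x v (trans (sym (Frame.asgs f v)) a)) (sym (Frame.vals f v))
      model : ∀ {μ₂ μ₃} → Frame μ μ₂ → Grow M μ₂ μ₃ → (∀ V → Sat (cl μ₂) V → SatClauses b Cs (lookups ρ σ) V) →
        (∀ V → Sat (cl μ₃) V → Extends (asg μ₂) (vl μ₂) V) → ∀ V → Sat (cl μ₃) V → M V
      model f g clauses units V s =
        (λ v a → trans (units V s v (trans (Frame.asgs f v) a)) (Frame.vals f v)) , clauses V (Sat-anti (Grow.incr g) s)
      clash : ∀ {C} V v → Sat C V → C (true , v) (true , v) ≡ true → C (false , v) (false , v) ≡ true → ⊥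
      clash V (X , t) s p q = true≢false (trans (sym (∨-idem (V X t))) (s _ _ p)) (not-true (trans (sym (∨-idem (not (V X t)))) (s _ _ q)))

    abstract
      does-check : ∀ {m m'} (σ : Vec (Fin m') m) φ {ρ : Vec (Fin n) m'} {μ} → Rel μ →
        let M = λ V → Extends (asg μ) (vl μ) V × satΣ₂ 𝒜 φ (lookups ρ σ) V ≡ true in
        Does (checkP σ φ) ρ μ (λ r μ' → Frame μ μ' × (if r then ∃ M else (∀ V → ¬ M V)))
      does-check σ φ {ρ} {μ} r = does-imp post (does-nest a
        (runs-forall Frame-preorder (λ xs _ → ∀ V → ¬ M xs V) (λ _ d → d) (∃ λ xs → ∃ (M xs)) (allTuples n a) μ
          (λ xs μ₁ _ f → runs (does-imp (λ { true μ₂ (f' , V , m) → f' , xs , V , recover xs f V m ; false μ₂ (f' , d) → f' , λ V m → d V (forth xs f V m) })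
            (does-sat b (extendVars a σ) clauses (Frame-Rel f r))))))
        where
        open Σ₂2SAT φ
        M : Vec (Fin n) a → SOEnv n Δ → Set
        M xs V = Extends (asg μ) (vl μ) V × SatClauses b clauses (xs Vec.++ lookups ρ σ) V
        forth : ∀ xs {μ₁} → Frame μ μ₁ → ∀ V → M xs V → Extends (asg μ₁) (vl μ₁) V × SatClauses b clauses (lookups (xs ⊕ᵛ ρ) (extendVars a σ)) V
        forth xs f V (x , s) = (λ v e → trans (x v (trans (sym (Frame.asgs f v)) e)) (sym (Frame.vals f v))) ,
          subst (λ z → SatClauses b clauses z V) (sym (lookups-extendVars xs ρ σ)) s
        recover : ∀ xs {μ₁} → Frame μ μ₁ → ∀ V → Extends (asg μ₁) (vl μ₁) V × SatClauses b clauses (lookups (xs ⊕ᵛ ρ) (extendVars a σ)) V → M xs V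
        recover xs f V (x , s) = (λ v e → trans (x v (trans (Frame.asgs f v) e)) (Frame.vals f v)) ,
          subst (λ z → SatClauses b clauses z V) (lookups-extendVars xs ρ σ) s
        sat-intro : ∀ xs V → SatClauses b clauses (xs Vec.++ lookups ρ σ) V → satΣ₂ 𝒜 φ (lookups ρ σ) V ≡ true
        sat-intro xs V s = any-intro _ (allTuples n a) (∈-allTuples xs) (all-intro _ (allTuples n b) (λ ys _ → all-intro _ clauses (λ C i → s ys C i)))
        sat-elim : ∀ V → satΣ₂ 𝒜 φ (lookups ρ σ) V ≡ true → ∃ λ xs → SatClauses b clauses (xs Vec.++ lookups ρ σ) V
        sat-elim V e with any-elim _ (allTuples n a) e
        ... | xs , _ , p = xs , λ ys C i → all-elim _ clauses (all-elim _ (allTuples n b) p ys (∈-allTuples ys)) C i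
        post : ∀ r μ' → Frame μ μ' × (if r then (∃ λ xs → ∃ (M xs)) else (∀ xs → xs ∈ allTuples n a → ∀ V → ¬ M xs V)) →
          Frame μ μ' × (if r then (∃ λ V → Extends (asg μ) (vl μ) V × satΣ₂ 𝒜 φ (lookups ρ σ) V ≡ true)
                             else (∀ V → ¬ (Extends (asg μ) (vl μ) V × satΣ₂ 𝒜 φ (lookups ρ σ) V ≡ true)))
        post true  μ' (f , xs , V , x , s) = f , V , x , sat-intro xs V s
        post false μ' (f , d) = f , λ V (x , e) → let (xs , s) = sat-elim V e in d xs (∈-allTuples xs) V (x , s)

-- The number of paths of the search for one formula

module BlockCount (τ : Vocab) (T : ℕ) (Δ : SOCtx) (tag : Fin (length τ) ⊎ BlockName Δ → Fin T)
  (tag-injective : ∀ {x y} → tag x ≡ tag y → x ≡ y) (𝒜 : Structure τ) where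
  open Access T
  open Block τ T Δ tag
  open Correct tag-injective 𝒜

  -- Counting by branching on the variables one by one, entering only branches that contain a solution

  satΣ₂-ext : ∀ {m} (φ : Σ₂2SAT τ m Δ) ρ {V W : SOEnv n Δ} → Counting._≈_ n Δ V W → satΣ₂ 𝒜 φ ρ V ≡ satΣ₂ 𝒜 φ ρ W
  satΣ₂-ext φ ρ {V} {W} h = any-cong (allTuples n (Σ₂2SAT.a φ)) (λ xs → all-cong (allTuples n (Σ₂2SAT.b φ)) (λ ys → all-cong (Σ₂2SAT.clauses φ) (λ C → clause C (ys Vec.++ (xs Vec.++ ρ)))))
    where
    comp : ∀ {m} (c : Component τ m Δ) ρ → satComp 𝒜 c ρ V ≡ satComp 𝒜 c ρ W
    comp (lit (pos X xs)) ρ = h X _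
    comp (lit (neg X xs)) ρ = cong not (h X _)
    comp (fo φ)           ρ = refl
    clause : ∀ {m} (C : Clause τ m Δ) ρ → satClause 𝒜 C ρ V ≡ satClause 𝒜 C ρ W
    clause C ρ = cong₂ _∨_ (comp (Clause.φ₁ C) ρ) (cong₂ _∨_ (comp (Clause.φ₂ C) ρ) (comp (Clause.φ₃ C) ρ))

  module _ (N : Fin (length Δ) → BlockName Δ) (N-injective : ∀ {X Y} → N X ≡ N Y → X ≡ Y) where

    bitOf : Mem → V' → Bool
    bitOf μ (X , t) = bit μ (addr (inj₂ (N X)) t)

    does-set : ∀ {m} b X (xs : Vec (Fin m) (soArity Δ X)) {ρ : Vec (Fin n) m} {μ} → Does (wr (tag (inj₂ (N X))) xs b) ρ μ
      (λ r μ' → r ≡ false × bitOf μ' (X , lookups ρ xs) ≡ b × (∀ v → v ≢ (X , lookups ρ xs) → bitOf μ' v ≡ bitOf μ v) ×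
        (∀ nm → nm ≢ inj₂ (N X) → ∀ {k} (t : Vec (Fin n) k) → bit μ' (addr nm t) ≡ bit μ (addr nm t)))
    does-set b X xs {ρ} = does-imp
      (λ r μ' (e , w) → e , Written.here-bit w , (λ v d → Written.others w _ (λ e → d (same-var v e))) ,
        (λ nm d t → Written.others w _ (λ e → d (addr-name {nm} {inj₂ (N X)} {t = t} {lookups ρ xs} e))))
      (does-wr (tag (inj₂ (N X))) xs b)
      where
      same-var : ∀ v → addr (inj₂ (N (proj₁ v))) (proj₂ v) ≡ addr (inj₂ (N X)) (lookups ρ xs) → v ≡ (X , lookups ρ xs)
      same-var (Y , u) e with N-injective (inj₂-injective (addr-name {inj₂ (N Y)} {inj₂ (N X)} {t = u} {lookups ρ xs} e))
      ... | refl = cong (X ,_) (address-tuple {t = u} {lookups ρ xs} e)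

  does-setAs : ∀ {m} b X (xs : Vec (Fin m) (soArity Δ X)) {ρ : Vec (Fin n) m} {μ} → Does (wr (tag (inj₂ (asN X))) xs b) ρ μ
    (λ r μ' → r ≡ false × (Rel μ → Rel μ') × asg μ' (X , lookups ρ xs) ≡ b ×
      (∀ v → v ≢ (X , lookups ρ xs) → asg μ' v ≡ asg μ v) × (∀ v → vl μ' v ≡ vl μ v))
  does-setAs b X xs = does-imp
    (λ r μ' (e , now , other , rest) → e , (λ h i t → trans (rest (inj₁ i) (λ ()) t) (h i t)) , now , other ,
      (λ (Y , u) → rest (inj₂ (vaN Y)) (λ ()) u))
    (does-set asN (λ { refl → refl }) b X xs)

  does-setVa : ∀ {m} b X (xs : Vec (Fin m) (soArity Δ X)) {ρ : Vec (Fin n) m} {μ} → Does (wr (tag (inj₂ (vaN X))) xs b) ρ μ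
    (λ r μ' → r ≡ false × (Rel μ → Rel μ') × vl μ' (X , lookups ρ xs) ≡ b ×
      (∀ v → v ≢ (X , lookups ρ xs) → vl μ' v ≡ vl μ v) × (∀ v → asg μ' v ≡ asg μ v))
  does-setVa b X xs = does-imp
    (λ r μ' (e , now , other , rest) → e , (λ h i t → trans (rest (inj₁ i) (λ ()) t) (h i t)) , now , other ,
      (λ (Y , u) → rest (inj₂ (asN Y)) (λ ()) u))
    (does-set vaN (λ { refl → refl }) b X xs)

  record At (vs : List V') (V : SOEnv n Δ) (μ : Mem) : Set where
    constructor at-state
    field
      relations : Rel μ
      free      : ∀ v → v ∈ vs → asg μ v ≡ false
      fixed     : ∀ v → ¬ v ∈ vs → asg μ v ≡ true × vl μ v ≡ V (proj₁ v) (proj₂ v)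

  Frame-At : ∀ {vs V μ μ'} → Frame μ μ' → At vs V μ → At vs V μ'
  Frame-At f (at-state r fr fx) = at-state (Frame-Rel f r) (λ v i → trans (Frame.asgs f v) (fr v i))
    (λ v i → trans (Frame.asgs f v) (proj₁ (fx v i)) , trans (Frame.vals f v) (proj₂ (fx v i)))

  module Branching {m} (φ : Σ₂2SAT τ m Δ) (env : Vec (Fin n) m) where
    open Counting n Δ

    indicator : SOEnv n Δ → ℕ
    indicator V = if satΣ₂ 𝒜 φ env V then 1 else 0

    indicator-ext : Ext indicator
    indicator-ext {V} {W} h = cong (λ b → if b then 1 else 0) (satΣ₂-ext φ env {V} {W} h)

    Possible : List V' → SOEnv n Δ → Set
    Possible vs V = ∃ λ W → (∀ v → ¬ v ∈ vs → W (proj₁ v) (proj₂ v) ≡ V (proj₁ v) (proj₂ v)) × satΣ₂ 𝒜 φ env W ≡ true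

    count-impossible : ∀ vs V → ¬ Possible vs V → count indicator vs V ≡ 0
    count-impossible []       V h = cong (λ b → if b then 1 else 0) (false-unless (λ e → h (V , (λ _ _ → refl) , e)))
    count-impossible (v ∷ vs) V h = cong₂ _+_ (half false) (half true)
      where
      half : ∀ b → count indicator vs (update V v b) ≡ 0
      half b = count-impossible vs (update V v b) (λ (W , agree , e) → h (W ,
        (λ w i → trans (agree w (λ j → i (there j))) (update-other V v b _ _ (λ { refl → i (here refl) }))) , e))

    choice : ∀ {v vs V} → Possible (v ∷ vs) V → ∃ λ b → Possible vs (update V v b)
    choice {v} {vs} {V} (W , agree , e) = W (proj₁ v) (proj₂ v) , W , agree' , e
      where
      agree' : ∀ w → ¬ w ∈ vs → W (proj₁ w) (proj₂ w) ≡ update V v (W (proj₁ v) (proj₂ v)) (proj₁ w) (proj₂ w)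
      agree' w i with w ≟ᵛ v
      ... | yes refl = refl
      ... | no d     = agree w (λ { (here p) → d p ; (there j) → i j })

    does-checkAt : ∀ {m'} (σ : Vec (Fin m') m) {ρ : Vec (Fin n) m'} {μ vs V} → lookups ρ σ ≡ env → At vs V μ →
      Does (checkP σ φ) ρ μ (λ r μ' → At vs V μ' × (if r then Possible vs V else (¬ Possible vs V)))
    does-checkAt σ {ρ} {μ} {vs} {V} refl a = does-imp
      (λ { true μ' (f , W , x , e) → Frame-At f a , W , agrees W x , e
         ; false μ' (f , h) → Frame-At f a , λ (W , agree , e) → h W (extends W agree , e) })
      (does-check σ φ (At.relations a))
      where
      agrees : ∀ W → Extends (asg μ) (vl μ) W → ∀ v → ¬ v ∈ vs → W (proj₁ v) (proj₂ v) ≡ V (proj₁ v) (proj₂ v)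
      agrees W x v i = trans (x v (proj₁ (At.fixed a v i))) (proj₂ (At.fixed a v i))
      extends : ∀ W → (∀ v → ¬ v ∈ vs → W (proj₁ v) (proj₂ v) ≡ V (proj₁ v) (proj₂ v)) → Extends (asg μ) (vl μ) W
      extends W agree v e = trans (agree v out) (sym (proj₂ (At.fixed a v out)))
        where
        out : ¬ v ∈ vs
        out i = true≢false e (At.free a v i)

    module _ {m'} {X : Fin (length Δ)} (xs : Vec (Fin m') (soArity Δ X)) {ρ : Vec (Fin n) m'} {vs : List V'}
      (v∉ : ¬ (X , lookups ρ xs) ∈ vs) where

      private
        v : V'
        v = X , lookups ρ xs

      does-setTo : ∀ b b' {V μ} → At vs (update V v b') μ →
        Does (wr (tag (inj₂ (vaN X))) xs b) ρ μ (λ r μ' → r ≡ false × At vs (update V v b) μ')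
      does-setTo b b' {V} {μ} (at-state r fr fx) = does-imp
        (λ q μ' (e , r' , now , other , as) → e , at-state (r' r) (λ w i → trans (as w) (fr w i))
          (λ w i → trans (as w) (proj₁ (fx w i)) , new w i μ' now other (w ≟ᵛ v)))
        (does-setVa b X xs)
        where
        new : ∀ w → ¬ w ∈ vs → ∀ μ' → vl μ' v ≡ b → (∀ w → w ≢ v → vl μ' w ≡ vl μ w) → Dec (w ≡ v) →
          vl μ' w ≡ update V v b (proj₁ w) (proj₂ w)
        new w i μ' now other (yes refl) = trans now (sym (update-same V v b))
        new w i μ' now other (no d) = trans (other w d) (trans (proj₂ (fx w i))
          (trans (update-other V v b' _ _ d) (sym (update-other V v b _ _ d))))

      -- Marking v as fixed exposes whatever bit the value array happens to hold, hence the update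
      -- by `vl μ v`, which `does-setTo` replaces.
      does-fix : ∀ {V μ} → At (v ∷ vs) V μ →
        Does (wr (tag (inj₂ (asN X))) xs true) ρ μ (λ r μ' → r ≡ false × At vs (update V v (vl μ v)) μ')
      does-fix {V} {μ} (at-state r fr fx) = does-imp
        (λ q μ' (e , r' , now , other , va) → e , at-state (r' r)
          (λ w i → trans (other w (λ { refl → v∉ i })) (fr w (there i)))
          (λ w i → new w i μ' now other va (w ≟ᵛ v)))
        (does-setAs true X xs)
        where
        new : ∀ w → ¬ w ∈ vs → ∀ μ' → asg μ' v ≡ true → (∀ w → w ≢ v → asg μ' w ≡ asg μ w) → (∀ w → vl μ' w ≡ vl μ w) → Dec (w ≡ v) →
          asg μ' w ≡ true × vl μ' w ≡ update V v (vl μ v) (proj₁ w) (proj₂ w)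
        new w i μ' now other va (yes refl) = now , trans (va v) (sym (update-same V v (vl μ v)))
        new w i μ' now other va (no d) = trans (other w d) (proj₁ (fx w out)) ,
          trans (va w) (trans (proj₂ (fx w out)) (sym (update-other V v (vl μ v) _ _ d)))
          where
          out : ¬ w ∈ v ∷ vs
          out (here p)  = d p
          out (there j) = i j

      -- Here `K b` is the number of paths below the value b. A value that is not entered has `K b`
      -- = 0, so the sum is right in each of the three outcomes of the tests; that both values fail
      -- is excluded by `Possible`.
      sem-branch : ∀ (σ : Vec (Fin m') m) {V μ κ} {K : Bool → ℕ} → lookups ρ σ ≡ env → At (v ∷ vs) V μ → Possible (v ∷ vs) V →
        (∀ b μ' → At vs (update V v b) μ' → Possible vs (update V v b) → κ false μ' ≡ K b) →
        (∀ b → ¬ Possible vs (update V v b) → K b ≡ 0) →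
        sem (branchP (X , xs) σ φ) κ ρ μ ≡ K false + K true
      sem-branch σ {V} {μ} {κ} {K} eqn a possible good bad with does-fix a
      ... | does-by (false , μ₁ , e₁ , _ , a₁) with does-setTo false (vl μ v) a₁
      ... | does-by (false , μ₂ , e₂ , _ , a₂) with does-checkAt σ eqn a₂
      ... | does-by (false , μ₃ , e₃ , a₃ , none) with does-setTo true false a₃
      ... | does-by (false , μ₄ , e₄ , _ , a₄) =
        trans (e₁ _) (trans (e₂ _) (trans (e₃ _) (trans (e₄ κ) (trans (good true μ₄ a₄ other) (cong (_+ K true) (sym (bad false none)))))))
        where
        other : Possible vs (update V v true)
        other with choice possible
        ... | true  , p = p
        ... | false , p = ⊥-elim (none p)
      sem-branch σ {V} {μ} {κ} {K} eqn a possible good bad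
          | does-by (false , μ₁ , e₁ , _ , a₁) | does-by (false , μ₂ , e₂ , _ , a₂) | does-by (true , μ₃ , e₃ , a₃ , some)
          with does-setTo true false a₃
      ... | does-by (false , μ₄ , e₄ , _ , a₄) with does-checkAt σ eqn a₄
      ... | does-by (false , μ₅ , e₅ , a₅ , none) with does-setTo false true a₅
      ... | does-by (false , μ₆ , e₆ , _ , a₆) =
        trans (e₁ _) (trans (e₂ _) (trans (e₃ _) (trans (e₄ _) (trans (e₅ _) (trans (e₆ κ)
          (trans (good false μ₆ a₆ some) (trans (sym (+-identityʳ _)) (cong (K false +_) (sym (bad true none))))))))))
      sem-branch σ {V} {μ} {κ} {K} eqn a possible good bad
          | does-by (false , μ₁ , e₁ , _ , a₁) | does-by (false , μ₂ , e₂ , _ , a₂) | does-by (true , μ₃ , e₃ , a₃ , some)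
          | does-by (false , μ₄ , e₄ , _ , a₄) | does-by (true , μ₅ , e₅ , a₅ , some') with does-setTo false true a₅
      ... | does-by (false , μ₆ , e₆ , _ , a₆) =
        trans (e₁ _) (trans (e₂ _) (trans (e₃ _) (trans (e₄ _) (trans (e₅ _)
          (cong₂ _+_ (trans (e₆ κ) (good false μ₆ a₆ some)) (good true μ₅ a₅ some'))))))

    module _ {m'} (σ : Vec (Fin m') m) {ρ : Vec (Fin n) m'} (eqn : lookups ρ σ ≡ env) where

      body : V' → Cont → Mem → ℕ
      body (X , t) κ = sem (branchP (tupleVar X) (Vec.map (wk (soArity Δ X)) σ) φ) κ (t ⊕ᵛ ρ)

      iter-branches : ∀ vs V μ → Unique vs → At vs V μ → Possible vs V → ∀ κ → (∀ μ' → κ false μ' ≡ 1) →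
        iter body vs κ μ ≡ count indicator vs V
      iter-branches []       V μ _ a (W , agree , e) κ one =
        trans (one μ) (cong (λ b → if b then 1 else 0) (sym (trans (satΣ₂-ext φ env {V} {W} (λ X t → sym (agree (X , t) (λ ())))) e)))
      iter-branches ((X , t) ∷ vs) V μ (v∉ ∷ u) a possible κ one = unfold
        (sem-branch {X = X} (tupleVars (soArity Δ X)) {t ⊕ᵛ ρ} {vs}
          (λ i → All.lookup v∉ (subst (λ z → (X , z) ∈ vs) (lookups-tupleVars t ρ) i) refl)
          (Vec.map (wk (soArity Δ X)) σ) {V} {μ} {λ b → if b then κ true else iter body vs κ} {K} (trans (lookups-wk t ρ σ) eqn)
          (subst (λ z → At ((X , z) ∷ vs) V μ) (sym (lookups-tupleVars t ρ)) a)
          (subst (λ z → Possible ((X , z) ∷ vs) V) (sym (lookups-tupleVars t ρ)) possible)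
          (λ b μ' a' p → iter-branches vs _ μ' u a' p κ one)
          (λ b h → count-impossible vs _ h))
        where
        K : Bool → ℕ
        K b = count indicator vs (update V (X , lookups (t ⊕ᵛ ρ) (tupleVars (soArity Δ X))) b)
        unfold : ∀ {x} → x ≡ K false + K true → x ≡ count indicator ((X , t) ∷ vs) V
        unfold e = trans e (cong (λ z → count indicator vs (update V (X , z) false) + count indicator vs (update V (X , z) true)) (lookups-tupleVars t ρ))

      does-reset : ∀ {μ} → Rel μ → Does resetP ρ μ (λ r μ' → r ≡ false × At (vars n Δ) (λ _ _ → false) μ')
      does-reset {μ} r = does-imp (λ q μ' (e , (r' , _) , d) → e , at-state (r' r) (λ v _ → d v) (λ v i → ⊥-elim (i (∈-vars Δ v))))
        (vars-forall keeps-preorder (λ v μ → asg μ v ≡ false) (λ (_ , s) d → s _ d)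
          (λ X t μ₁ _ → does-imp
            (λ q μ' (e , r' , now , other , _) → e ,
              (r' , λ w d → keep now other w d (w ≟ᵛ (X , lookups (t ⊕ᵛ ρ) (tupleVars (soArity Δ X))))) ,
              subst (λ z → asg μ' (X , z) ≡ false) (lookups-tupleVars t ρ) now)
            (does-setAs false X (tupleVars (soArity Δ X)))))
        where
        Keeps : Mem → Mem → Set
        Keeps μ μ' = (Rel μ → Rel μ') × (∀ v → asg μ v ≡ false → asg μ' v ≡ false)
        keeps-preorder : Preorder Keeps
        keeps-preorder = record { reflexive = (λ r → r) , (λ _ e → e) ; transitive = λ (f , g) (f' , g') → (λ r → f' (f r)) , (λ v e → g' v (g v e)) }
        keep : ∀ {v μ μ'} → asg μ' v ≡ false → (∀ w → w ≢ v → asg μ' w ≡ asg μ w) → ∀ w → asg μ w ≡ false → Dec (w ≡ v) → asg μ' w ≡ false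
        keep now other w d (yes refl) = now
        keep now other w d (no h)     = trans (other w h) d

      -- All paths of the search halt, so `κ` is called once only, on the other side of the fork.
      -- Without a solution there is no fork, and the sum is 0.
      sem-block : ∀ {μ κ k} → Rel μ → (∀ μ' → Rel μ' → κ false μ' ≡ k) → sem (blockP σ φ) κ ρ μ ≡ sumAll 𝒜 Δ indicator + k
      sem-block {μ} {κ} {k} r h with does-reset r
      ... | does-by (false , μ₁ , e₁ , _ , a₁) with does-checkAt σ eqn a₁
      ... | does-by (false , μ₂ , e₂ , a₂ , none) = trans (e₁ _) (trans (e₂ _) (trans (h μ₂ (At.relations a₂))
        (cong (_+ k) (sym (trans (sym (count-sumAll 𝒜 Δ indicator-ext (λ _ _ → false))) (count-impossible (vars n Δ) _ none))))))
      ... | does-by (true , μ₂ , e₂ , a₂ , some) = trans (e₁ _) (trans (e₂ _) (cong₂ _+_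
        (trans (sem-forVars _ _ ρ μ₂) (trans (iter-branches (vars n Δ) _ μ₂ (vars-unique n Δ) a₂ some _ (λ _ → refl))
          (count-sumAll 𝒜 Δ indicator-ext (λ _ _ → false))))
        (h μ₂ (At.relations a₂))))

-- The program of a sentence

BlockName-code : ∀ Δ → Code (BlockName Δ)
BlockName-code Δ = retract to from inv
  (Fin-code (length Δ) ⊎-code Fin-code (length Δ) ⊎-code (Bool-code ×-code Fin-code (length Δ)) ×-code (Bool-code ×-code Fin-code (length Δ)))
  where
  Sum : Set
  Sum = Fin (length Δ) ⊎ Fin (length Δ) ⊎ (Bool × Fin (length Δ)) × (Bool × Fin (length Δ))
  to : BlockName Δ → Sum
  to (asN X)         = inj₁ X
  to (vaN X)         = inj₂ (inj₁ X)
  to (clN s X s' X') = inj₂ (inj₂ ((s , X) , (s' , X')))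
  from : Sum → BlockName Δ
  from (inj₁ X)                             = asN X
  from (inj₂ (inj₁ X))                      = vaN X
  from (inj₂ (inj₂ ((s , X) , (s' , X')))) = clN s X s' X'
  inv : ∀ x → from (to x) ≡ x
  inv (asN X)         = refl
  inv (vaN X)         = refl
  inv (clN s X s' X') = refl

-- A constant s is handled as a sum of s copies of a valid formula.
valid : ∀ {τ m Δ} → Σ₂2SAT τ m Δ
valid = record { a = 0 ; b = 0 ; clauses = [] }

repeat : ∀ {m} → ℕ → Prog m → Prog m
repeat zero    P = ret false
repeat (suc s) P = seq P (repeat s P)

-- The number of arrays depends on Δ, which varies within a sentence; so each leaf receives tags of
-- its own.
names : ∀ {τ m Δ} → ΣQSO τ m Δ → ℕ
names {Δ = Δ} (formula φ) = card (BlockName-code Δ)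
names {Δ = Δ} (const s)   = card (BlockName-code Δ)
names (plus α β)          = names α + names β
names (sumFO α)           = names α
names (sumSO k α)         = names α

module Sentences (τ : Vocab) (T : ℕ) (relTag : Fin (length τ) → Fin T) where

  tagOf : ∀ Δ → (Fin (card (BlockName-code Δ)) → Fin T) → Fin (length τ) ⊎ BlockName Δ → Fin T
  tagOf Δ e (inj₁ i)  = relTag i
  tagOf Δ e (inj₂ nm) = e (enc (BlockName-code Δ) nm)

  program : ∀ {m m' Δ} (α : ΣQSO τ m Δ) → (Fin (names α) → Fin T) → Vec (Fin m') m → Prog m'
  program {Δ = Δ} (formula φ) e σ = Block.blockP τ T Δ (tagOf Δ e) σ φ
  program {Δ = Δ} (const s)   e σ = repeat s (Block.blockP τ T Δ (tagOf Δ e) σ valid)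
  program (plus α β)  e σ = seq (program α (λ i → e (i Fin.↑ˡ names β)) σ) (program β (λ i → e (names α Fin.↑ʳ i)) σ)
  program (sumFO α)   e σ = for (program α e (zero ∷ Vec.map suc σ))
  program (sumSO k α) e σ = program α e σ

  record Fresh {k : ℕ} (e : Fin k → Fin T) : Set where
    constructor fresh
    field
      injective : ∀ {i j} → e i ≡ e j → i ≡ j
      disjoint  : ∀ {i j} → relTag i ≢ e j

  module _ (relTag-injective : ∀ {i j} → relTag i ≡ relTag j → i ≡ j) (𝒜 : Structure τ) where

    private
      n : ℕ
      n = size 𝒜

    tagOf-injective : ∀ Δ {e} → Fresh e → ∀ {x y} → tagOf Δ e x ≡ tagOf Δ e y → x ≡ y
    tagOf-injective Δ f {inj₁ i} {inj₁ j} p = cong inj₁ (relTag-injective p)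
    tagOf-injective Δ f {inj₁ i} {inj₂ y} p = ⊥-elim (Fresh.disjoint f p)
    tagOf-injective Δ f {inj₂ x} {inj₁ j} p = ⊥-elim (Fresh.disjoint f (sym p))
    tagOf-injective Δ f {inj₂ x} {inj₂ y} p = cong inj₂ (enc-injective (BlockName-code Δ) (Fresh.injective f p))

    OK : Mem → Set
    OK = RelOK relTag 𝒜

    -- In this additive form, + of sentences becomes sequential composition, a sum over elements
    -- becomes a loop, and the single surviving path is passed on as k.
    Adds : ∀ {m} → Prog m → Vec (Fin n) m → ℕ → Set
    Adds P ρ v = ∀ {κ k μ} → OK μ → (∀ μ' → OK μ' → κ false μ' ≡ k) → sem P κ ρ μ ≡ v + k

    sumList : ∀ Δ (h : Fin n → SOEnv n Δ → ℕ) as →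
      sumAll 𝒜 Δ (λ V → sum (map (λ a → h a V) as)) ≡ sum (map (λ a → sumAll 𝒜 Δ (h a)) as)
    sumList Δ h []       = sumAll-0 𝒜 Δ
    sumList Δ h (a ∷ as) = trans (sumAll-+ 𝒜 Δ (h a) _) (cong (sumAll 𝒜 Δ (h a) +_) (sumList Δ h as))

    value : ∀ {m Δ} → ΣQSO τ m Δ → Vec (Fin n) m → ℕ
    value {Δ = Δ} α ρ = sumAll 𝒜 Δ (λ V → ⟦_⟧ 𝒜 α ρ V)

    adds-block : ∀ {m m' Δ} (φ : Σ₂2SAT τ m Δ) {e} → Fresh e → (σ : Vec (Fin m') m) (ρ : Vec (Fin n) m') →
      Adds (Block.blockP τ T Δ (tagOf Δ e) σ φ) ρ (value (formula φ) (lookups ρ σ))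
    adds-block {Δ = Δ} φ {e} f σ ρ {κ} ok h = BlockCount.Branching.sem-block τ T Δ (tagOf Δ e) (tagOf-injective Δ f) 𝒜 φ (lookups ρ σ) σ refl {κ = κ} ok h

    adds-repeat : ∀ {m} {P : Prog m} {ρ v} → Adds P ρ v → ∀ s → Adds (repeat s P) ρ (s * v)
    adds-repeat ad zero    ok h = h _ ok
    adds-repeat {P = P} {ρ} {v} ad (suc s) {κ} {k} ok h = trans (ad ok (λ μ' ok' → adds-repeat {P = P} {ρ} {v} ad s {κ} {k} ok' h)) (sym (+-assoc v (s * v) k))

    -- Below second-order sums s is added once for every assignment, and the assignments are the
    -- solutions of a valid formula.
    value-const : ∀ {m} Δ s (ρ : Vec (Fin n) m) → value {Δ = Δ} (const s) ρ ≡ s * value {Δ = Δ} (formula valid) ρ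
    value-const Δ zero    ρ = sumAll-0 𝒜 Δ
    value-const Δ (suc s) ρ = trans (sumAll-+ 𝒜 Δ (λ _ → 1) (λ _ → s)) (cong (value {Δ = Δ} (formula valid) ρ +_) (value-const Δ s ρ))

    fresh-∘ : ∀ {k l} {e : Fin k → Fin T} (g : Fin l → Fin k) → (∀ {i j} → g i ≡ g j → i ≡ j) → Fresh e → Fresh (λ i → e (g i))
    fresh-∘ g inj (fresh i d) = fresh (λ p → inj (i p)) d

    adds : ∀ {m m' Δ} (α : ΣQSO τ m Δ) {e} → Fresh e → (σ : Vec (Fin m') m) (ρ : Vec (Fin n) m') →
      Adds (program α e σ) ρ (value α (lookups ρ σ))
    adds (formula φ) f σ ρ {κ} {k} ok h = adds-block φ f σ ρ {κ} {k} ok h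
    adds {Δ = Δ} (const s) f σ ρ {κ} {k} {μ} ok h = trans (adds-repeat (λ {κ} {k} {μ} → adds-block (valid {Δ = Δ}) f σ ρ {κ} {k} {μ}) s {κ} {k} ok h)
      (cong (_+ k) (sym (value-const Δ s (lookups ρ σ))))
    adds {Δ = Δ} (plus α β) f σ ρ {κ} {k} ok h = trans
      (adds α (fresh-∘ (Fin._↑ˡ names β) (FinP.↑ˡ-injective (names β) _ _) f) σ ρ ok
        (λ μ' ok' → adds β (fresh-∘ (names α Fin.↑ʳ_) (FinP.↑ʳ-injective (names α) _ _) f) σ ρ {κ} {k} ok' h))
      (trans (sym (+-assoc (value α (lookups ρ σ)) (value β (lookups ρ σ)) k)) (cong (_+ k) (sym (sumAll-+ 𝒜 Δ _ _))))
    adds {m} {m'} {Δ} (sumFO α) {e} f σ ρ {κ} {k} ok h = trans (each (allFin n) ok) (cong (_+ k) (sym (sumList Δ (λ a V → ⟦_⟧ 𝒜 α (a ∷ lookups ρ σ) V) (allFin n))))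
      where
      env : ∀ a → lookups (a ∷ ρ) (zero ∷ Vec.map suc σ) ≡ a ∷ lookups ρ σ
      env a = cong (a ∷_) (sym (VecP.map-∘ (lookup (a ∷ ρ)) suc σ))
      each : ∀ as {μ} → OK μ → iter (λ a κ' → sem (program α e (zero ∷ Vec.map suc σ)) κ' (a ∷ ρ)) as κ μ
        ≡ sum (map (λ a → value α (a ∷ lookups ρ σ)) as) + k
      each []       ok = h _ ok
      each (a ∷ as) ok = trans (adds α f (zero ∷ Vec.map suc σ) (a ∷ ρ) ok (λ μ' ok' → each as ok'))
        (trans (cong (λ z → value α z + (sum (map (λ a → value α (a ∷ lookups ρ σ)) as) + k)) (env a))
          (sym (+-assoc (value α (a ∷ lookups ρ σ)) (sum (map (λ a → value α (a ∷ lookups ρ σ)) as)) k)))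
    -- A second-order sum needs no code of its own: it is the innermost part of `sumAll` over the
    -- longer context.
    adds (sumSO j α) f σ ρ {κ} {k} ok h = adds α f σ ρ {κ} {k} ok h

  -- Reading the relations from the input

  open Access T

  positions : (τ : Vocab) → List (Fin (length τ))
  positions []      = []
  positions (a ∷ τ) = zero ∷ map suc (positions τ)

  ∈-positions : ∀ τ i → i ∈ positions τ
  ∈-positions (a ∷ τ) zero    = here refl
  ∈-positions (a ∷ τ) (suc i) = there (MemP.∈-map⁺ suc (∈-positions τ i))

  encRels-positions : ∀ τ n (r : (i : Fin (length τ)) → Vec (Fin n) (arityτ τ i) → Bool) →
    encRels τ n r ≡ concatMap (λ i → map (r i) (allTuples n (arityτ τ i))) (positions τ)
  encRels-positions []      n r = refl
  encRels-positions (a ∷ τ) n r = cong (map (r zero) (allTuples n a) ++_)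
    (trans (encRels-positions τ n (λ i → r (suc i))) (sym (ListP.concatMap-map (λ i → map (r i) (allTuples n (arityτ (a ∷ τ) i))) suc (positions τ))))

  loadBit : ∀ {m} (i : Fin (length τ)) → Prog (arityτ τ i ⊕ m)
  loadBit i = ite (op input) (wr (relTag i) (tupleVars (arityτ τ i)) true) (wr (relTag i) (tupleVars (arityτ τ i)) false)

  loadP : Prog 0
  loadP = anyOf (map (λ i → nest (arityτ τ i) (loadBit i)) (positions τ))

  module _ (relTag-injective : ∀ {i j} → relTag i ≡ relTag j → i ≡ j) (𝒜 : Structure τ) where

    private
      n : ℕ
      n = size 𝒜

    Entry : Set
    Entry = Σ (Fin (length τ)) λ i → Vec (Fin n) (arityτ τ i)

    entries : List Entry
    entries = concatMap (λ i → map (i ,_) (allTuples n (arityτ τ i))) (positions τ)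

    ∈-entries : ∀ c → c ∈ entries
    ∈-entries (i , t) = MemP.∈-concatMap⁺ _ (Any.map (λ { refl → MemP.∈-map⁺ (i ,_) (∈-allTuples t) }) (∈-positions τ i))

    entry : Entry → Bool
    entry (i , t) = rel 𝒜 i t

    -- The string encoding lists the bits in the very order in which the loading loop visits the
    -- tuples.
    encRels-entries : encRels τ n (rel 𝒜) ≡ map entry entries
    encRels-entries = trans (encRels-positions τ n (rel 𝒜))
      (trans (ListP.concatMap-cong (λ i → ListP.map-∘ (allTuples n (arityτ τ i))) (positions τ))
        (sym (ListP.map-concatMap entry (λ i → map (i ,_) (allTuples n (arityτ τ i))) (positions τ))))

    entryAddr : Entry → ℕ
    entryAddr (i , t) = address (relTag i) t

    entryAddr-injective : ∀ c c' → entryAddr c ≡ entryAddr c' → c ≡ c'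
    entryAddr-injective (i , t) (j , u) e with relTag-injective (address-tag {t = t} {u} e)
    ... | refl = cong (i ,_) (address-tuple {t = t} {u} e)

    body : Entry → Cont → Mem → ℕ
    body (i , t) κ = sem (loadBit i) κ (t ⊕ᵛ [])

    body-ext : Extensional body
    body-ext (i , t) = sem-ext (loadBit i) (t ⊕ᵛ [])

    Loading : List Entry → Mem → Set
    Loading rest μ = Mem.inq μ ≡ map entry rest × ∀ c → c ∈ rest ⊎ bit μ (entryAddr c) ≡ entry c

    load-step : ∀ c rest μ → Loading (c ∷ rest) μ → Runs (body c) μ (λ b μ' → if b then ⊥ else Loading rest μ')
    load-step c@(i , t) rest μ (q , done) = runs (does-ite {A = op input} {ρ = t ⊕ᵛ []} {μ}
      (does-op input {t ⊕ᵛ []} {μ} {Post = λ b μ' → b ≡ entry c × Mem.inq μ' ≡ map entry rest × (∀ a → bit μ' a ≡ bit μ a)}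
        (read-bit {μ} q , read-rest {μ} q , readInput-bits μ))
      (λ μ' (e , q' , same') → does-imp (λ { false μ'' (_ , w) → stored e q' same' w }) (does-wr (relTag i) (tupleVars (arityτ τ i)) true))
      (λ μ' (e , q' , same') → does-imp (λ { false μ'' (_ , w) → stored e q' same' w }) (does-wr (relTag i) (tupleVars (arityτ τ i)) false)))
      where
      read-bit : ∀ {μ b bs} → Mem.inq μ ≡ b ∷ bs → proj₁ (readInput μ) ≡ b
      read-bit {mem j (_ ∷ _) _ _ _} refl = refl
      read-rest : ∀ {μ b bs} → Mem.inq μ ≡ b ∷ bs → Mem.inq (proj₂ (readInput μ)) ≡ bs
      read-rest {mem j (_ ∷ _) _ _ _} refl = refl
      stored : ∀ {v μ₁ μ₂} → v ≡ entry c → Mem.inq μ₁ ≡ map entry rest → (∀ a → bit μ₁ a ≡ bit μ a) →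
        Written (address (relTag i) (lookups (t ⊕ᵛ []) (tupleVars (arityτ τ i)))) v μ₁ μ₂ → Loading rest μ₂
      stored {v} {μ₁} {μ₂} e q' same' w = trans (Written.queue w) q' , λ c' → settle c' (entryAddr c' ≟ entryAddr c) (done c')
        where
        w' : Written (entryAddr c) v μ₁ μ₂
        w' = subst (λ u → Written (address (relTag i) u) v μ₁ μ₂) (lookups-tupleVars t []) w
        settle : ∀ c' → Dec (entryAddr c' ≡ entryAddr c) → c' ∈ c ∷ rest ⊎ bit μ (entryAddr c') ≡ entry c' →
          c' ∈ rest ⊎ bit μ₂ (entryAddr c') ≡ entry c'
        settle c' (yes p) _ with entryAddr-injective c' c p
        ... | refl = inj₂ (trans (Written.here-bit w') e)
        settle c' (no p) (inj₁ (here refl)) = ⊥-elim (p refl)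
        settle c' (no p) (inj₁ (there k))   = inj₁ k
        settle c' (no p) (inj₂ d)           = inj₂ (trans (Written.others w' _ p) (trans (same' _) d))

    sem-loadP : ∀ κ μ → sem {n} loadP κ [] μ ≡ iter body entries κ μ
    sem-loadP κ μ = trans (sem-anyOf (λ i → nest (arityτ τ i) (loadBit i)) (positions τ) κ [] μ)
      (trans (iter-cong (λ i → sem-ext (nest (arityτ τ i) (loadBit i)) [])
        (λ i κ μ → trans (sem-nest (arityτ τ i) (loadBit i) κ [] μ) (sym (iter-map body-ext (i ,_) (allTuples n (arityτ τ i)) κ μ)))
        (positions τ) κ μ)
        (sym (iter-concatMap body-ext (λ i → map (i ,_) (allTuples n (arityτ τ i))) (positions τ) κ μ)))

    does-load : ∀ {μ} → Mem.inq μ ≡ encRels τ n (rel 𝒜) → Does loadP [] μ (λ b μ' → RelOK relTag 𝒜 μ')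
    does-load {μ} q with runs-iter Loading (λ _ → ⊥) load-step entries μ (trans q encRels-entries , λ c → inj₁ (∈-entries c))
    ... | false , μ' , e , (_ , done) = does-by (false , μ' , (λ κ → trans (sem-loadP κ μ) (e κ)) , λ i t → settled (done (i , t)))
      where
      settled : ∀ {c} → c ∈ [] ⊎ bit μ' (entryAddr c) ≡ entry c → bit μ' (entryAddr c) ≡ entry c
      settled (inj₂ p) = p

ones-encode : ∀ {τ} (𝒜 : Structure τ) → ones (encode 𝒜) ≡ size 𝒜
ones-encode 𝒜 = lem (size 𝒜)
  where
  lem : ∀ k {x} → ones (replicate k true ++ false ∷ x) ≡ k
  lem zero    = refl
  lem (suc k) = cong suc (lem k)

payload-encode : ∀ {τ} (𝒜 : Structure τ) → payload (encode 𝒜) ≡ encRels τ (size 𝒜) (rel 𝒜)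
payload-encode 𝒜 = lem (size 𝒜)
  where
  lem : ∀ k {x} → payload (replicate k true ++ false ∷ x) ≡ x
  lem zero    = refl
  lem (suc k) = lem k

-- Assembly: tags, loading and counting for a whole sentence

module Main (τ : Vocab) (α : Sentence τ) where

  tags : ℕ
  tags = length τ + names α

  relTag : Fin (length τ) → Fin tags
  relTag i = i Fin.↑ˡ names α

  blockTag : Fin (names α) → Fin tags
  blockTag i = length τ Fin.↑ʳ i

  open Sentences τ tags relTag

  relTag-injective : ∀ {i j} → relTag i ≡ relTag j → i ≡ j
  relTag-injective = FinP.↑ˡ-injective (names α) _ _

  blockTag-fresh : Fresh blockTag
  blockTag-fresh = fresh (FinP.↑ʳ-injective (length τ) _ _) (λ {i} {j} p → absurd
    (trans (sym (FinP.splitAt-↑ˡ (length τ) i (names α))) (trans (cong (splitAt (length τ)) p) (FinP.splitAt-↑ʳ (length τ) (names α) j))))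
    where
    absurd : ∀ {i : Fin (length τ)} {j : Fin (names α)} → inj₁ i ≢ inj₂ j
    absurd ()

  whole : Prog 0
  whole = seq loadP (program α blockTag [])

  sem-whole : ∀ 𝒜 → sem {ones (encode 𝒜)} whole (λ _ _ → 1) [] (initial (encode 𝒜)) ≡ ⟦ α ⟧ˢ 𝒜 + 1
  sem-whole 𝒜 = trans
    -- On an encoding, the parsed universe and queue are those of the structure.
    (cong₂ (λ k q → sem {k} whole (λ _ _ → 1) [] (mem 0 q [] false [])) (ones-encode 𝒜) (payload-encode 𝒜))
    (counted (does-load relTag-injective 𝒜 refl))
    where
    start : Mem
    start = mem 0 (encRels τ (size 𝒜) (rel 𝒜)) [] false []
    counted : Does loadP [] start (λ _ μ' → RelOK relTag 𝒜 μ') → sem {size 𝒜} whole (λ _ _ → 1) [] start ≡ ⟦ α ⟧ˢ 𝒜 + 1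
    counted (does-by (true  , μ' , e , ok)) = trans (e _) (adds relTag-injective 𝒜 α blockTag-fresh [] [] ok (λ _ _ → refl))
    counted (does-by (false , μ' , e , ok)) = trans (e _) (adds relTag-injective 𝒜 α blockTag-fresh [] [] ok (λ _ _ → refl))

theorem3 : (τ : Vocab) (f : Structure τ → ℕ) → InΣQSOΣ₂2SAT τ f → InTotP τ f
theorem3 τ f (α , defines) = let (M , c , d , halts , counts) = realize (Main.whole τ α) in
  M , c , d , halts , λ 𝒜 → trans (counts (encode 𝒜))
    (trans (cong (_∸ 1) (Main.sem-whole τ α 𝒜)) (trans (m+n∸n≡m (⟦ α ⟧ˢ 𝒜) 1) (defines 𝒜)))
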